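{- The set of primitive diagrams in $\mathcal{D}_3$ is the preimage under the map $H:\mathcal{D}_3\to S_4\times\{\pm1\}$ of the union of the three conjugacy classes of $S_4\times\{\pm 1\}$ with representatives $(\mathrm{id},1)$, $((1,2,3),1)$ and $((1,2,3,4),1)$.
   Context: Diagrams. A $3\times n$ diagram is a $3\times n$ grid of squares, each colored black or white. $\mathcal{D}_3$ is the semigroup (monoid) of all diagrams with exactly $3$ rows (and any number $n\ge 0$ of columns) under $\star$, where $C_1\star C_2$ is obtained by placing $C_2$ immediately to the right of $C_1$; the empty diagram is the identity. For $S\subseteq\{1,2,3\}$, $C(S)$ is the $3\times1$ diagram whose white squares are precisely in the rows indexed by $S$; $\mathcal{D}_3$ is the free monoid on the eight columns $C(S)$. Primitivity. Label the $N$ white squares of a diagram $D$ by $1,\dots,N$, increasing left to right in each row, with all labels in a higher row smaller than those in a lower row. $M(D)$ is the $N\times N$ matrix with $(i,j)$ entry $1$ if square $i$ is in the same row as and strictly left of square $j$, or in the same column as and strictly above square $j$; $-1$ if square $i$ is in the same row as and strictly right of square $j$, or in the same column as and strictly below square $j$; $0$ otherwise. $D$ is primitive if $\det M(D)\ne0$ (the $0\times0$ determinant being $1$). The map $[\,\cdot\,]$. $\mathrm{Ex}_3=\{(\mathbf v,\mathbf h,\varepsilon):\mathbf v,\mathbf h\in(\mathbb{Z}/2)^3,\ \varepsilon\in\{\pm1\},\ v_1+v_2+v_3=0\}$ is the group with $(\mathbf v,\mathbf h,\varepsilon)\cdot(\mathbf v',\mathbf h',\varepsilon')=(\mathbf v+\mathbf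 v',\mathbf h+\mathbf h',\varepsilon'')$, $\varepsilon''=\varepsilon\varepsilon'(-1)^{\sum_{1\le i<j\le 3}v_j(v_i'+h_i')+\sum_{1\le i\le j\le 3}v_j'h_i}$. $J_3$ is the ideal of the group ring $\mathbb{Z}_3[\mathrm{Ex}_3]$ ($\mathbb{Z}_3=\mathbb{Z}/3\mathbb{Z}$) generated by $(\mathbf 0,\mathbf 0,+1)+(\mathbf 0,\mathbf 0,-1)$. A decomposition $(V,H)\vdash C$ of a diagram $C$ with white squares labelled $1,\dots,k$, increasing left to right in each row, with all labels in a higher row smaller than those in a lower row, is a partition $V\sqcup H=\{1,\dots,k\}$ such that every column contains an even number of squares of $V$. For a set $S$ of labels, $\mathrm{excess}(S)\in(\mathbb{Z}/2)^3$ is the vector whose $i$th entry is the number mod $2$ of squares of $S$ in row $i$. $\mathrm{inv}(V)$ is the number of pairs $i<j$ in $V$ such that square $j$ is southwest of square $i$ (strictly lower row, strictly further left column), $\mathrm{sgn}(V,H)=(-1)^{\mathrm{inv}(V)}(-1)^{\#\{(i,j): i<j,\ i\in H,\ j\in V\}}$, and $f(V,H)=(\mathrm{excess}(V),\mathrm{excess}(H),\mathrm{sgn}(V,H))\in\mathrm{Ex}_3$. The map $[\,\cdot\,]:\mathcal{D}_3\to\mathbb{Z}_3[\mathrm{Ex}_3]/J_3$, $[C]=\sum_{(V,H)\vdash C}f(V,H)+J_3$, is a semigroup homomorphism to the multiplicative semigroup. The map $H$. $G_3=\{[D]:D\in\mathcal{D}_3\}$ is a finite group under multiplication, and $N=\{[D]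 : D\in\mathcal{D}_3,\ [D]=\pm(\mathbf v,\mathbf 0,\varepsilon)+J_3\text{ for some }\mathbf v\in(\mathbb{Z}/2)^3,\ \varepsilon\in\{\pm1\}\}$ is a normal subgroup of $G_3$. There is an isomorphism $\psi:G_3/N\to S_4\times\{\pm1\}$ (permutations composed right to left) determined by the following values on cosets of the generators: $[C(\{1,2,3\})]\mapsto((124),-1)$, $[C(\{1,2\})]\mapsto((1243),1)$, $[C(\{1,3\})]\mapsto((1324),1)$, $[C(\{2,3\})]\mapsto((1234),1)$, $[C(\{1\})]\mapsto((13)(24),-1)$, $[C(\{2\})]\mapsto((12)(34),-1)$, $[C(\{3\})]\mapsto((14)(23),-1)$, $[C(\emptyset)]\mapsto(\mathrm{id},1)$. With $h:G_3\to G_3/N$ the canonical surjection, the map $H:\mathcal{D}_3\to S_4\times\{\pm1\}$ is $H=\psi\circ h\circ[\,\cdot\,]$. (The letter $H$ for this map is unrelated to the $H$ in a decomposition $(V,H)$.) -}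

module Defs where

import Algebra.Construct.DirectProduct as DirectProduct
import Algebra.Morphism.GroupMonomorphism as GroupMonomorphism
import Algebra.Properties.Group as GroupProperties
import Algebra.Properties.Semiring.Sum as SumProperties
import Algebra.Solver.CommutativeMonoid as CommutativeMonoidSolver
import Algebra.Solver.Ring.AlmostCommutativeRing as ACR
import Algebra.Solver.Ring.Simple as RingSolver
open import Algebra.Bundles using (Group; RawGroup; CommutativeRing)
open import Algebra.Morphism.Structures using (module GroupMorphisms)
open import Data.Bool as Bool using (true; false; if_then_else_; _∧_; _∨_)
open import Data.Fin as Fin using (Fin; zero; suc; toℕ; punchIn; #_)
import Data.Fin.Properties as Fin
open import Data.Fin.Permutation as Perm using (Permutation′; _⟨$⟩ʳ_; _∘ₚ_)
open import Data.Fin.Subset using (Subset; inside; outside; _∈_; _⊆_; ∣_∣)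
open import Data.Fin.Subset.Properties using (_∈?_; _⊆?_)
open import Data.Integer as ℤ using (ℤ; 0ℤ; 1ℤ; -1ℤ)
import Data.Integer.Properties as ℤ
open import Data.List using (List; []; _∷_; [_]; _++_; map; mapMaybe; concatMap;
  filter; length; lookup; allFin; tabulate; cartesianProduct; cartesianProductWith)
import Data.List.Properties as List
open import Data.List.Membership.Propositional using (find) renaming (_∈_ to _∈ᴸ_)
open import Data.List.Relation.Unary.All as All using (All; []; _∷_)
open import Data.List.Relation.Unary.Any as Any using (Any; here; there)
open import Data.Maybe using (Maybe; just; nothing)
open import Data.Nat as ℕ using (ℕ; zero; suc; parity)
open import Data.Nat.DivMod using (_mod_)
open import Data.Parity as ℙ using (Parity; 0ℙ; 1ℙ; toSign)
import Data.Parity.Base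
import Data.Parity.Properties as ℙ
open import Data.Product using (Σ; ∃-syntax; _×_; _,_; proj₁; proj₂)
import Data.Product.Properties as Product
open import Data.Sign as Sign using (Sign)
import Data.Sign.Properties as Sign
open import Data.Sum using (_⊎_)
open import Data.Vec as Vec using (Vec; []; _∷_)
import Data.Vec.Properties as Vec
open import Function using (_∘_; id)
open import Function.Bundles using (mk⇔)
open import Level using (0ℓ)
open import Relation.Binary.Bundles using (Setoid)
open import Relation.Binary.Definitions using (DecidableEquality)
open import Relation.Binary.PropositionalEquality hiding ([_])
import Relation.Binary.Reasoning.Setoid as SetoidReasoning
open import Relation.Nullary using (Dec; yes; no; does; ¬?; _×-dec_; _⊎-dec_; _→-dec_)
import Relation.Nullary.Decidable as Dec
open import Relation.Unary using (Pred; Decidable)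

open SumProperties (CommutativeRing.semiring ℤ.+-*-commutativeRing) using () renaming (sum to ∑ℤ)

-- The subset S stands for the column C(S): row i is white iff i ∈ S.
-- Rows are numbered from the top.
𝒟₃ : Set
𝒟₃ = List (Subset 3)

C : Subset 3 → 𝒟₃
C S = [ S ]

infixr 5 _⋆_
_⋆_ : 𝒟₃ → 𝒟₃ → 𝒟₃
_⋆_ = _++_

Square : ℕ → Set
Square n = Fin 3 × Fin n

-- In label order: row by row, and from left to right in each row.
squares : ∀ n → List (Square n)
squares n = cartesianProduct (allFin 3) (allFin n)

White : ∀ D → Pred (Square (length D)) 0ℓ
White D (i , j) = i ∈ lookup D j

white? : ∀ D → Decidable (White D)
white? D (i , j) = i ∈? lookup D j

whiteSquares : ∀ D → List (Square (length D))
whiteSquares D = filter (white? D) (squares (length D))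

-- Expansion along the first row.
det : ∀ {n} → (Fin n → Fin n → ℤ) → ℤ
det {zero}  A = 1ℤ
det {suc n} A =
  ∑ℤ λ j → (-1ℤ ℤ.^ toℕ j) ℤ.* A zero j ℤ.* det λ i k → A (suc i) (punchIn j k)

LeftOfOrAbove : ∀ {n} → Square n → Square n → Set
LeftOfOrAbove (i , j) (k , l) = (i ≡ k × j Fin.< l) ⊎ (j ≡ l × i Fin.< k)

leftOfOrAbove? : ∀ {n} (p q : Square n) → Dec (LeftOfOrAbove p q)
leftOfOrAbove? (i , j) (k , l) =
  (i Fin.≟ k ×-dec j Fin.<? l) ⊎-dec (j Fin.≟ l ×-dec i Fin.<? k)

entry : ∀ {n} → Square n → Square n → ℤ
entry p q = if does (leftOfOrAbove? p q) then 1ℤ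
            else if does (leftOfOrAbove? q p) then -1ℤ
            else 0ℤ

M : ∀ D → let N = length (whiteSquares D) in Fin N → Fin N → ℤ
M D a b = entry (lookup (whiteSquares D) a) (lookup (whiteSquares D) b)

Primitive : Pred 𝒟₃ 0ℓ
Primitive D = det (M D) ≢ 0ℤ

infixl 6 _⊕_
_⊕_ : ∀ {n} → Vec Parity n → Vec Parity n → Vec Parity n
_⊕_ = Vec.zipWith ℙ._+_

total : ∀ {n} → Vec Parity n → Parity
total = Vec.foldr′ ℙ._+_ 0ℙ

record Ex₃ : Set where
  constructor ex
  field
    v h : Vec Parity 3
    ε : Sign
    .total-v : total v ≡ 0ℙ

-- ∑_{i<j} vⱼ(v′ᵢ + h′ᵢ) + ∑_{i≤j} v′ⱼhᵢ. In Data.Parity, _+_ and _*_ have the same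
-- precedence, hence the parentheses.
twist : (v h v′ h′ : Vec Parity 3) → Parity
twist (v₁ ∷ v₂ ∷ v₃ ∷ []) (h₁ ∷ h₂ ∷ h₃ ∷ []) (v₁′ ∷ v₂′ ∷ v₃′ ∷ []) (h₁′ ∷ h₂′ ∷ h₃′ ∷ []) =
  ((v₂ * (v₁′ + h₁′)) + (v₃ * (v₁′ + h₁′)) + (v₃ * (v₂′ + h₂′)))
  + ((v₁′ * h₁) + (v₂′ * h₁) + (v₃′ * h₁) + (v₂′ * h₂) + (v₃′ * h₂) + (v₃′ * h₃))
  where open Data.Parity.Base using (_+_; _*_)

module ℙ-Solver = RingSolver (ACR.fromCommutativeRing ℙ.+-*-commutativeRing) ℙ._≟_

total-⊕ : (v w : Vec Parity 3) → total (v ⊕ w) ≡ total v ℙ.+ total w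
total-⊕ (a ∷ b ∷ c ∷ []) (d ∷ e ∷ f ∷ []) =
  solve 6 (λ a b c d e f → (a :+ d) :+ ((b :+ e) :+ ((c :+ f) :+ con 0ℙ))
             := (a :+ (b :+ (c :+ con 0ℙ))) :+ (d :+ (e :+ (f :+ con 0ℙ))))
    refl a b c d e f
  where open ℙ-Solver

total-⊕≡0 : (v w : Vec Parity 3) → total v ≡ 0ℙ → total w ≡ 0ℙ → total (v ⊕ w) ≡ 0ℙ
total-⊕≡0 v w p q = trans (total-⊕ v w) (cong₂ ℙ._+_ p q)

infixl 7 _·_
_·_ : Ex₃ → Ex₃ → Ex₃
ex v h ε p · ex v′ h′ ε′ p′ =
  ex (v ⊕ v′) (h ⊕ h′) (ε Sign.* ε′ Sign.* toSign (twist v h v′ h′)) (total-⊕≡0 v v′ p p′)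

𝟎 : ∀ {n} → Vec Parity n
𝟎 = Vec.replicate _ 0ℙ

1ᴱ : Ex₃
1ᴱ = ex 𝟎 𝟎 Sign.+ refl

infix 8 -ᴱ_
-ᴱ_ : Ex₃ → Ex₃
-ᴱ ex v h ε p = ex v h (Sign.opposite ε) p

ex-≡ : ∀ {v v′ h h′ ε ε′} .{p p′} → v ≡ v′ → h ≡ h′ → ε ≡ ε′ → ex v h ε p ≡ ex v′ h′ ε′ p′
ex-≡ refl refl refl = refl

infix 4 _≟ᴱ_
_≟ᴱ_ : (g g′ : Ex₃) → Dec (g ≡ g′)
ex v h ε p ≟ᴱ ex v′ h′ ε′ p′ = Dec.map′
  (λ (a , b , c) → ex-≡ a b c)
  (λ { refl → refl , refl , refl })
  (Vec.≡-dec ℙ._≟_ v v′ ×-dec Vec.≡-dec ℙ._≟_ h h′ ×-dec ε Sign.≟ ε′)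

ℤ₃ : Set
ℤ₃ = Fin 3

infixl 6 _+₃_
infixl 7 _*₃_
infix 8 -₃_

_+₃_ _*₃_ : ℤ₃ → ℤ₃ → ℤ₃
a +₃ b = (toℕ a ℕ.+ toℕ b) mod 3
a *₃ b = (toℕ a ℕ.* toℕ b) mod 3

-₃_ : ℤ₃ → ℤ₃
-₃ a = (3 ℕ.∸ toℕ a) mod 3

pattern 0₃ = zero
pattern 1₃ = suc zero

-- Formal linear combinations; as elements of the group ring they are compared by _≋_.
ℤ₃[Ex₃] : Set
ℤ₃[Ex₃] = List (ℤ₃ × Ex₃)

coeff : ℤ₃[Ex₃] → Ex₃ → ℤ₃
coeff []            g = 0₃
coeff ((a , k) ∷ x) g = (if does (k ≟ᴱ g) then a else 0₃) +₃ coeff x g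

infix 4 _≋_ _≈_
_≋_ : ℤ₃[Ex₃] → ℤ₃[Ex₃] → Set
x ≋ y = ∀ g → coeff x g ≡ coeff y g

infixl 6 _⊞_ _⊟_
infixl 7 _⊠_
_⊞_ _⊟_ _⊠_ : ℤ₃[Ex₃] → ℤ₃[Ex₃] → ℤ₃[Ex₃]
x ⊞ y = x ++ y
x ⊟ y = x ⊞ map (λ (a , g) → -₃ a , g) y
x ⊠ y = cartesianProductWith (λ (a , g) (b , h) → a *₃ b , g · h) x y

⟦_⟧ : Ex₃ → ℤ₃[Ex₃]
⟦ g ⟧ = [ (1₃ , g) ]

generator : ℤ₃[Ex₃]
generator = ⟦ 1ᴱ ⟧ ⊞ ⟦ -ᴱ 1ᴱ ⟧

-- The two-sided ideal generated by (0,0,+1) + (0,0,-1): the sums of elements a·generator·b.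
J₃ : ℤ₃[Ex₃] → Set
J₃ x = Σ (List (ℤ₃[Ex₃] × ℤ₃[Ex₃])) λ abs →
  x ≋ concatMap (λ (a , b) → a ⊠ generator ⊠ b) abs

record _≈_ (x y : ℤ₃[Ex₃]) : Set where
  constructor mod-J₃
  field ⊟∈J₃ : J₃ (x ⊟ y)

-- The squares of V in a column with white squares c.
record EvenPart (c : Subset 3) : Set where
  constructor evenPart
  field
    part   : Subset 3
    .white : part ⊆ c
    .even  : parity ∣ part ∣ ≡ 0ℙ

open EvenPart using (part)

-- V is given column by column, and H consists of the white squares that are not in V.
Decomposition : 𝒟₃ → Set
Decomposition = All EvenPart

V : ∀ {D} → Decomposition D → Fin (length D) → Subset 3
V (e ∷ d) zero    = part e
V (e ∷ d) (suc j) = V d j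

Vsquares Hsquares : ∀ {D} → Decomposition D → List (Square (length D))
Vsquares {D} d = filter (λ (i , j) → i ∈? V d j) (squares (length D))
Hsquares {D} d = filter (λ (i , j) → white? D (i , j) ×-dec ¬? (i ∈? V d j)) (squares (length D))

allSubsets : ∀ n → List (Subset n)
allSubsets zero    = [ [] ]
allSubsets (suc n) = map (outside ∷_) (allSubsets n) ++ map (inside ∷_) (allSubsets n)

evenPart? : ∀ c → Subset 3 → Maybe (EvenPart c)
evenPart? c p with p ⊆? c | parity ∣ p ∣ ℙ.≟ 0ℙ
... | yes p⊆c | yes even = just (evenPart p p⊆c even)
... | _       | _        = nothing

evenParts : ∀ c → List (EvenPart c)
evenParts c = mapMaybe (evenPart? c) (allSubsets 3)

decompositions : ∀ D → List (Decomposition D)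
decompositions []      = [ [] ]
decompositions (c ∷ D) = cartesianProductWith _∷_ (evenParts c) (decompositions D)

-- Sets of labels are given by the lists of the squares with these labels.
excess : ∀ {n} → List (Square n) → Vec Parity 3
excess S = Vec.tabulate λ i → parity (length (filter (λ p → proj₁ p Fin.≟ i) S))

-- The label of p is smaller than that of q.
_≺_ : ∀ {n} → Square n → Square n → Set
(i , j) ≺ (k , l) = i Fin.< k ⊎ (i ≡ k × j Fin.< l)

_≺?_ : ∀ {n} (p q : Square n) → Dec (p ≺ q)
(i , j) ≺? (k , l) = i Fin.<? k ⊎-dec (i Fin.≟ k ×-dec j Fin.<? l)

-- q is southwest of p; in particular p ≺ q.
SouthWest : ∀ {n} → Square n → Square n → Set
SouthWest (i , j) (k , l) = i Fin.< k × l Fin.< j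

southWest? : ∀ {n} (p q : Square n) → Dec (SouthWest p q)
southWest? (i , j) (k , l) = i Fin.<? k ×-dec l Fin.<? j

inv cross : ∀ {D} → Decomposition D → ℕ
inv   d = length (filter (λ (p , q) → southWest? p q) (cartesianProduct (Vsquares d) (Vsquares d)))
cross d = length (filter (λ (p , q) → p ≺? q) (cartesianProduct (Hsquares d) (Vsquares d)))

sgn : ∀ {D} → Decomposition D → Sign
sgn d = toSign (parity (inv d)) Sign.* toSign (parity (cross d))

open SumProperties (CommutativeRing.semiring ℙ.+-*-commutativeRing)
  using (sum-cong-≗; sum-replicate-zero; ∑-distrib-+; *-distribˡ-sum; *-distribʳ-sum) renaming (sum to ∑)

ind : ∀ {a} {A : Set a} → Dec A → Parity
ind a? = if does a? then 1ℙ else 0ℙ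

∑ᴸ : ∀ {A : Set} → List A → (A → Parity) → Parity
∑ᴸ []       φ = 0ℙ
∑ᴸ (x ∷ xs) φ = φ x ℙ.+ ∑ᴸ xs φ

∑ᴸ-cong : ∀ {A : Set} (xs : List A) {φ χ} → (∀ x → φ x ≡ χ x) → ∑ᴸ xs φ ≡ ∑ᴸ xs χ
∑ᴸ-cong []       eq = refl
∑ᴸ-cong (x ∷ xs) eq = cong₂ ℙ._+_ (eq x) (∑ᴸ-cong xs eq)

∑ᴸ-++ : ∀ {A : Set} (xs ys : List A) φ → ∑ᴸ (xs ++ ys) φ ≡ ∑ᴸ xs φ ℙ.+ ∑ᴸ ys φ
∑ᴸ-++ []       ys φ = refl
∑ᴸ-++ (x ∷ xs) ys φ = trans (cong (φ x ℙ.+_) (∑ᴸ-++ xs ys φ)) (sym (ℙ.+-assoc (φ x) _ _))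

∑ᴸ-map : ∀ {A B : Set} (f : A → B) xs φ → ∑ᴸ (map f xs) φ ≡ ∑ᴸ xs (φ ∘ f)
∑ᴸ-map f []       φ = refl
∑ᴸ-map f (x ∷ xs) φ = cong (φ (f x) ℙ.+_) (∑ᴸ-map f xs φ)

∑ᴸ-× : ∀ {A B : Set} (xs : List A) (ys : List B) φ →
  ∑ᴸ (cartesianProduct xs ys) φ ≡ ∑ᴸ xs λ x → ∑ᴸ ys λ y → φ (x , y)
∑ᴸ-× []       ys φ = refl
∑ᴸ-× (x ∷ xs) ys φ = trans (∑ᴸ-++ (map (x ,_) ys) _ φ) (cong₂ ℙ._+_ (∑ᴸ-map (x ,_) ys φ) (∑ᴸ-× xs ys φ))

∑ᴸ-tabulate : ∀ {A : Set} {n} (f : Fin n → A) φ → ∑ᴸ (tabulate f) φ ≡ ∑ (φ ∘ f)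
∑ᴸ-tabulate {n = zero}  f φ = refl
∑ᴸ-tabulate {n = suc n} f φ = cong (φ (f zero) ℙ.+_) (∑ᴸ-tabulate (f ∘ suc) φ)

∑ᴸ-filter : ∀ {A : Set} {P : Pred A 0ℓ} (P? : Decidable P) xs φ →
  ∑ᴸ (filter P? xs) φ ≡ ∑ᴸ xs λ x → ind (P? x) ℙ.* φ x
∑ᴸ-filter P? []       φ = refl
∑ᴸ-filter P? (x ∷ xs) φ with does (P? x)
... | true  = cong (φ x ℙ.+_) (∑ᴸ-filter P? xs φ)
... | false = ∑ᴸ-filter P? xs φ

parity-suc : ∀ n → parity (suc n) ≡ 1ℙ ℙ.+ parity n
parity-suc n = trans (sym (ℙ.⁻¹-involutive _)) (cong ℙ._⁻¹ (ℙ.suc-homo-⁻¹ n))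

parity-filter : ∀ {A : Set} {P : Pred A 0ℓ} (P? : Decidable P) xs →
  parity (length (filter P? xs)) ≡ ∑ᴸ xs (ind ∘ P?)
parity-filter P? []       = refl
parity-filter P? (x ∷ xs) with does (P? x)
... | true  = trans (parity-suc (length (filter P? xs))) (cong (1ℙ ℙ.+_) (parity-filter P? xs))
... | false = parity-filter P? xs

∑² : ∀ {n} → (Square n → Parity) → Parity
∑² φ = ∑ λ i → ∑ λ j → φ (i , j)

∑²-cong : ∀ {n} {φ χ : Square n → Parity} → (∀ p → φ p ≡ χ p) → ∑² φ ≡ ∑² χ
∑²-cong eq = sum-cong-≗ λ i → sum-cong-≗ λ j → eq (i , j)

∑²-+ : ∀ {n} (φ χ : Square n → Parity) → ∑² (λ p → φ p ℙ.+ χ p) ≡ ∑² φ ℙ.+ ∑² χ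
∑²-+ φ χ = trans (sum-cong-≗ λ i → ∑-distrib-+ (λ j → φ (i , j)) (λ j → χ (i , j)))
  (∑-distrib-+ (λ i → ∑ λ j → φ (i , j)) (λ i → ∑ λ j → χ (i , j)))

∑ᴸ-squares : ∀ {n} φ → ∑ᴸ (squares n) φ ≡ ∑² φ
∑ᴸ-squares {n} φ = trans (∑ᴸ-× (allFin 3) (allFin n) φ) (trans (∑ᴸ-tabulate {n = 3} id (λ i → ∑ᴸ (allFin n) λ j → φ (i , j)))
  (sum-cong-≗ λ i → ∑ᴸ-tabulate id λ j → φ (i , j)))

first : ∀ {n} → (Square (suc n) → Parity) → Fin 3 → Parity
first φ i = φ (i , zero)

rest : ∀ {n} → (Square (suc n) → Parity) → Square n → Parity
rest φ (i , j) = φ (i , suc j)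

∑²-suc : ∀ {n} (φ : Square (suc n) → Parity) → ∑² φ ≡ ∑ (first φ) ℙ.+ ∑² (rest φ)
∑²-suc φ = ∑-distrib-+ (first φ) (λ i → ∑ λ j → rest φ (i , j))

rows : ∀ {n} → (Square n → Parity) → Fin 3 → Parity
rows φ i = ∑ λ j → φ (i , j)

∑²-rows : ∀ {n} (φ : Square n → Parity) (κ : Fin 3 → Parity) →
  ∑² (λ p → φ p ℙ.* κ (proj₁ p)) ≡ ∑ λ i → rows φ i ℙ.* κ i
∑²-rows φ κ = sum-cong-≗ λ i → sym (*-distribʳ-sum (κ i) λ j → φ (i , j))

pairs : ∀ {n} → (x y : Square n → Parity) → (Square n → Square n → Parity) → Parity
pairs x y κ = ∑² λ p → x p ℙ.* ∑² λ q → y q ℙ.* κ p q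

form : (κ : Fin 3 → Fin 3 → Parity) → (x y : Fin 3 → Parity) → Parity
form κ x y = ∑ λ i → x i ℙ.* ∑ λ k → y k ℙ.* κ i k

pairs-suc : ∀ {n} (x y : Square (suc n) → Parity) {κ κ′} {κ₀₀ κ₀₁ κ₁₀ : Fin 3 → Fin 3 → Parity} →
  (∀ i k → κ (i , zero) (k , zero) ≡ κ₀₀ i k) →
  (∀ i k b → κ (i , zero) (k , suc b) ≡ κ₀₁ i k) →
  (∀ i a k → κ (i , suc a) (k , zero) ≡ κ₁₀ i k) →
  (∀ i a k b → κ (i , suc a) (k , suc b) ≡ κ′ (i , a) (k , b)) →
  pairs x y κ ≡ (form κ₀₀ (first x) (first y) ℙ.+ form κ₀₁ (first x) (rows (rest y)))
                ℙ.+ (form κ₁₀ (rows (rest x)) (first y) ℙ.+ pairs (rest x) (rest y) κ′)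
pairs-suc x y {κ} {κ′} {κ₀₀} {κ₀₁} {κ₁₀} e₀₀ e₀₁ e₁₀ e₁₁ = begin
  pairs x y κ
    ≡⟨ ∑²-suc (λ p → x p ℙ.* R p) ⟩
  ∑ (λ i → first x i ℙ.* R (i , zero)) ℙ.+ ∑² (λ p → rest x p ℙ.* rest R p)
    ≡⟨ cong₂ ℙ._+_ left right ⟩
  _ ∎
  where
  open ≡-Reasoning
  R : Square (suc _) → Parity
  R p = ∑² λ q → y q ℙ.* κ p q
  s₀₀ s₀₁ s₁₀ : Fin 3 → Parity
  s₀₀ i = ∑ λ k → first y k ℙ.* κ₀₀ i k
  s₀₁ i = ∑ λ k → rows (rest y) k ℙ.* κ₀₁ i k
  s₁₀ i = ∑ λ k → first y k ℙ.* κ₁₀ i k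
  R′ : Square _ → Parity
  R′ p = ∑² λ q → rest y q ℙ.* κ′ p q
  R-zero : ∀ i → R (i , zero) ≡ s₀₀ i ℙ.+ s₀₁ i
  R-zero i = trans (∑²-suc λ q → y q ℙ.* κ (i , zero) q) (cong₂ ℙ._+_
    (sum-cong-≗ λ k → cong (first y k ℙ.*_) (e₀₀ i k))
    (trans (∑²-cong λ (k , b) → cong (rest y (k , b) ℙ.*_) (e₀₁ i k b)) (∑²-rows (rest y) (κ₀₁ i))))
  R-suc : ∀ i a → R (i , suc a) ≡ s₁₀ i ℙ.+ R′ (i , a)
  R-suc i a = trans (∑²-suc λ q → y q ℙ.* κ (i , suc a) q) (cong₂ ℙ._+_
    (sum-cong-≗ λ k → cong (first y k ℙ.*_) (e₁₀ i a k))
    (∑²-cong λ (k , b) → cong (rest y (k , b) ℙ.*_) (e₁₁ i a k b)))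
  left : ∑ (λ i → first x i ℙ.* R (i , zero)) ≡ form κ₀₀ (first x) (first y) ℙ.+ form κ₀₁ (first x) (rows (rest y))
  left = trans
    (sum-cong-≗ λ i → trans (cong (first x i ℙ.*_) (R-zero i)) (ℙ.*-distribˡ-+ (first x i) (s₀₀ i) (s₀₁ i)))
    (∑-distrib-+ (λ i → first x i ℙ.* s₀₀ i) (λ i → first x i ℙ.* s₀₁ i))
  right : ∑² (λ p → rest x p ℙ.* rest R p) ≡ form κ₁₀ (rows (rest x)) (first y) ℙ.+ pairs (rest x) (rest y) κ′
  right = trans
    (∑²-cong λ (i , a) → trans (cong (rest x (i , a) ℙ.*_) (R-suc i a)) (ℙ.*-distribˡ-+ (rest x (i , a)) (s₁₀ i) (R′ (i , a))))
    (trans (∑²-+ (λ p → rest x p ℙ.* s₁₀ (proj₁ p)) (λ p → rest x p ℙ.* R′ p))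
      (cong (ℙ._+ pairs (rest x) (rest y) κ′) (∑²-rows (rest x) s₁₀)))

vᴵ hᴵ : ∀ {D} → Decomposition D → Square (length D) → Parity
vᴵ d (i , j) = ind (i ∈? V d j)
hᴵ {D} d (i , j) = ind (white? D (i , j) ×-dec ¬? (i ∈? V d j))

excess-filter : ∀ {n} {P : Pred (Square n) 0ℓ} (P? : Decidable P) →
  excess (filter P? (squares n)) ≡ Vec.tabulate (rows (ind ∘ P?))
excess-filter {n} P? = Vec.tabulate-cong λ i → begin
  parity (length (filter (λ p → proj₁ p Fin.≟ i) (filter P? (squares n))))
    ≡⟨ parity-filter _ (filter P? (squares n)) ⟩
  ∑ᴸ (filter P? (squares n)) (λ p → ind (proj₁ p Fin.≟ i))
    ≡⟨ ∑ᴸ-filter P? (squares n) _ ⟩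
  ∑ᴸ (squares n) (λ p → ind (P? p) ℙ.* ind (proj₁ p Fin.≟ i))
    ≡⟨ ∑ᴸ-squares (λ p → ind (P? p) ℙ.* ind (proj₁ p Fin.≟ i)) ⟩
  ∑² (λ p → ind (P? p) ℙ.* ind (proj₁ p Fin.≟ i))
    ≡⟨ ∑²-rows (ind ∘ P?) (λ k → ind (k Fin.≟ i)) ⟩
  ∑ (λ k → r k ℙ.* ind (k Fin.≟ i))
    ≡⟨ pick i (r zero) (r (suc zero)) (r (suc (suc zero))) ⟩
  Vec.lookup (r zero ∷ r (suc zero) ∷ r (suc (suc zero)) ∷ []) i
    ≡⟨ Vec.lookup∘tabulate r i ⟩
  r i ∎
  where
  open ≡-Reasoning
  r : Fin 3 → Parity
  r = rows (ind ∘ P?)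
  open ℙ-Solver
  pick : ∀ i a b c → ∑ (λ k → Vec.lookup (a ∷ b ∷ c ∷ []) k ℙ.* ind (k Fin.≟ i)) ≡ Vec.lookup (a ∷ b ∷ c ∷ []) i
  pick zero             = solve 3 (λ a b c → (a :* con 1ℙ) :+ ((b :* con 0ℙ) :+ ((c :* con 0ℙ) :+ con 0ℙ)) := a) refl
  pick (suc zero)       = solve 3 (λ a b c → (a :* con 0ℙ) :+ ((b :* con 1ℙ) :+ ((c :* con 0ℙ) :+ con 0ℙ)) := b) refl
  pick (suc (suc zero)) = solve 3 (λ a b c → (a :* con 0ℙ) :+ ((b :* con 0ℙ) :+ ((c :* con 1ℙ) :+ con 0ℙ)) := c) refl

excess-V : ∀ {D} (d : Decomposition D) → excess (Vsquares d) ≡ Vec.tabulate (rows (vᴵ d))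
excess-V d = excess-filter (λ (i , j) → i ∈? V d j)

excess-H : ∀ {D} (d : Decomposition D) → excess (Hsquares d) ≡ Vec.tabulate (rows (hᴵ d))
excess-H {D} d = excess-filter (λ (i , j) → white? D (i , j) ×-dec ¬? (i ∈? V d j))

total-part : ∀ (p : Subset 3) → total (Vec.tabulate λ i → ind (i ∈? p)) ≡ parity ∣ p ∣
total-part (outside ∷ outside ∷ outside ∷ []) = refl
total-part (outside ∷ outside ∷ inside  ∷ []) = refl
total-part (outside ∷ inside  ∷ outside ∷ []) = refl
total-part (outside ∷ inside  ∷ inside  ∷ []) = refl
total-part (inside  ∷ outside ∷ outside ∷ []) = refl
total-part (inside  ∷ outside ∷ inside  ∷ []) = refl
total-part (inside  ∷ inside  ∷ outside ∷ []) = refl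
total-part (inside  ∷ inside  ∷ inside  ∷ []) = refl

total-rows : ∀ {D} (d : Decomposition D) → total (Vec.tabulate (rows (vᴵ d))) ≡ 0ℙ
total-rows []      = refl
total-rows (e@(evenPart p _ even) ∷ d) = trans
  (total-⊕ (Vec.tabulate λ i → ind (i ∈? p)) (Vec.tabulate (rows (vᴵ d))))
  (cong₂ ℙ._+_ (trans (total-part p) (Dec.recompute (parity ∣ p ∣ ℙ.≟ 0ℙ) even)) (total-rows d))

total-excess : ∀ {D} (d : Decomposition D) → total (excess (Vsquares d)) ≡ 0ℙ
total-excess d = trans (cong total (excess-V d)) (total-rows d)

f : ∀ {D} → Decomposition D → Ex₃
f d = ex (excess (Vsquares d)) (excess (Hsquares d)) (sgn d) (total-excess d)

-- A representative of [D] modulo J₃.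
⟪_⟫ : 𝒟₃ → ℤ₃[Ex₃]
⟪ D ⟫ = map (λ d → 1₃ , f d) (decompositions D)

-- σ ∙ τ applies τ first.
S₄ : Group 0ℓ 0ℓ
S₄ = record
  { Carrier = Permutation′ 4
  ; _≈_     = Perm._≈_
  ; _∙_     = λ σ τ → τ ∘ₚ σ
  ; ε       = Perm.id
  ; _⁻¹     = Perm.flip
  ; isGroup = record
    { isMonoid = record
      { isSemigroup = record
        { isMagma = record
          { isEquivalence = record
            { refl  = λ i → refl
            ; sym   = λ p i → sym (p i)
            ; trans = λ p q i → trans (p i) (q i)
            }
          ; ∙-cong = λ {σ} {σ′} {τ} {τ′} p q i → trans (cong (σ ⟨$⟩ʳ_) (q i)) (p (τ′ ⟨$⟩ʳ i))
          }
        ; assoc = λ σ τ υ i → refl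
        }
      ; identity = (λ σ i → refl) , (λ σ i → refl)
      }
    ; inverse = (λ σ i → Perm.inverseˡ σ) , (λ σ i → Perm.inverseʳ σ)
    ; ⁻¹-cong = λ {σ} {τ} p i → begin
        Perm.flip σ ⟨$⟩ʳ i                              ≡⟨ cong (Perm.flip σ ⟨$⟩ʳ_) (Perm.inverseʳ τ) ⟨
        Perm.flip σ ⟨$⟩ʳ (τ ⟨$⟩ʳ (Perm.flip τ ⟨$⟩ʳ i))  ≡⟨ cong (Perm.flip σ ⟨$⟩ʳ_) (p (Perm.flip τ ⟨$⟩ʳ i)) ⟨
        Perm.flip σ ⟨$⟩ʳ (σ ⟨$⟩ʳ (Perm.flip τ ⟨$⟩ʳ i))  ≡⟨ Perm.inverseˡ σ ⟩
        Perm.flip τ ⟨$⟩ʳ i                              ∎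
    }
  }
  where open ≡-Reasoning

module 𝕊₄ = Group S₄

S₄×±1 : Group 0ℓ 0ℓ
S₄×±1 = DirectProduct.group S₄ Sign.*-group

module 𝔾 = Group S₄×±1

-- The points 1, 2, 3, 4 permuted by S₄.
pattern ① = zero
pattern ② = suc zero
pattern ③ = suc (suc zero)
pattern ④ = suc (suc (suc zero))

-- (a₁ a₂ … aₖ) = (a₁ a₂) ∙ (a₂ a₃) ∙ … ∙ (aₖ₋₁ aₖ)
cycle : List (Fin 4) → Permutation′ 4
cycle (a ∷ b ∷ as) = Perm.transpose a b 𝕊₄.∙ cycle (b ∷ as)
cycle _            = Perm.id

ConjugacyClass : 𝔾.Carrier → Pred 𝔾.Carrier 0ℓ
ConjugacyClass x y = ∃[ g ] y 𝔾.≈ g 𝔾.∙ x 𝔾.∙ g 𝔾.⁻¹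

pattern ∅      = outside ∷ outside ∷ outside ∷ []
pattern ⁅1⁆    = inside  ∷ outside ∷ outside ∷ []
pattern ⁅2⁆    = outside ∷ inside  ∷ outside ∷ []
pattern ⁅3⁆    = outside ∷ outside ∷ inside  ∷ []
pattern ⁅12⁆   = inside  ∷ inside  ∷ outside ∷ []
pattern ⁅13⁆   = inside  ∷ outside ∷ inside  ∷ []
pattern ⁅23⁆   = outside ∷ inside  ∷ inside  ∷ []
pattern ⁅123⁆  = inside  ∷ inside  ∷ inside  ∷ []

ψ[C_] : Subset 3 → 𝔾.Carrier
ψ[C ⁅123⁆ ] = cycle (① ∷ ② ∷ ④ ∷ []) , Sign.-
ψ[C ⁅12⁆  ] = cycle (① ∷ ② ∷ ④ ∷ ③ ∷ []) , Sign.+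
ψ[C ⁅13⁆  ] = cycle (① ∷ ③ ∷ ② ∷ ④ ∷ []) , Sign.+
ψ[C ⁅23⁆  ] = cycle (① ∷ ② ∷ ③ ∷ ④ ∷ []) , Sign.+
ψ[C ⁅1⁆   ] = cycle (① ∷ ③ ∷ []) 𝕊₄.∙ cycle (② ∷ ④ ∷ []) , Sign.-
ψ[C ⁅2⁆   ] = cycle (① ∷ ② ∷ []) 𝕊₄.∙ cycle (③ ∷ ④ ∷ []) , Sign.-
ψ[C ⁅3⁆   ] = cycle (① ∷ ④ ∷ []) 𝕊₄.∙ cycle (② ∷ ③ ∷ []) , Sign.-
ψ[C ∅     ] = Perm.id , Sign.+

-- From here to the definition of G₃, it is shown that [·] is a homomorphism and that
-- Ψ D is determined by the coset of [D] and determines it.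

⊕-assoc : ∀ {n} (u v w : Vec Parity n) → (u ⊕ v) ⊕ w ≡ u ⊕ (v ⊕ w)
⊕-assoc = Vec.zipWith-assoc ℙ.+-assoc

⊕-self : ∀ {n} (u : Vec Parity n) → u ⊕ u ≡ 𝟎
⊕-self []      = refl
⊕-self (a ∷ u) = cong₂ _∷_ (ℙ.p+p≡0ℙ a) (⊕-self u)

⊕-identityˡ : ∀ {n} (u : Vec Parity n) → 𝟎 ⊕ u ≡ u
⊕-identityˡ = Vec.zipWith-identityˡ ℙ.+-identityˡ

⊕-identityʳ : ∀ {n} (u : Vec Parity n) → u ⊕ 𝟎 ≡ u
⊕-identityʳ = Vec.zipWith-identityʳ ℙ.+-identityʳ

twist-cocycle : ∀ v h v′ h′ v″ h″ →
  twist v h v′ h′ ℙ.+ twist (v ⊕ v′) (h ⊕ h′) v″ h″ ≡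
  twist v′ h′ v″ h″ ℙ.+ twist v h (v′ ⊕ v″) (h′ ⊕ h″)
twist-cocycle (a₁ ∷ a₂ ∷ a₃ ∷ []) (b₁ ∷ b₂ ∷ b₃ ∷ []) (c₁ ∷ c₂ ∷ c₃ ∷ []) (d₁ ∷ d₂ ∷ d₃ ∷ []) (e₁ ∷ e₂ ∷ e₃ ∷ []) (f₁ ∷ f₂ ∷ f₃ ∷ []) =
  solve 18 (λ a₁ a₂ a₃ b₁ b₂ b₃ c₁ c₂ c₃ d₁ d₂ d₃ e₁ e₂ e₃ f₁ f₂ f₃ →
     let t = λ v₁ v₂ v₃ h₁ h₂ h₃ v₁′ v₂′ v₃′ h₁′ h₂′ h₃′ →
               (v₂ :* (v₁′ :+ h₁′) :+ v₃ :* (v₁′ :+ h₁′) :+ v₃ :* (v₂′ :+ h₂′))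
                :+ (v₁′ :* h₁ :+ v₂′ :* h₁ :+ v₃′ :* h₁ :+ v₂′ :* h₂ :+ v₃′ :* h₂ :+ v₃′ :* h₃)
     in t a₁ a₂ a₃ b₁ b₂ b₃ c₁ c₂ c₃ d₁ d₂ d₃
        :+ t (a₁ :+ c₁) (a₂ :+ c₂) (a₃ :+ c₃) (b₁ :+ d₁) (b₂ :+ d₂) (b₃ :+ d₃) e₁ e₂ e₃ f₁ f₂ f₃
      := t c₁ c₂ c₃ d₁ d₂ d₃ e₁ e₂ e₃ f₁ f₂ f₃
        :+ t a₁ a₂ a₃ b₁ b₂ b₃ (c₁ :+ e₁) (c₂ :+ e₂) (c₃ :+ e₃) (d₁ :+ f₁) (d₂ :+ f₂) (d₃ :+ f₃))
    refl a₁ a₂ a₃ b₁ b₂ b₃ c₁ c₂ c₃ d₁ d₂ d₃ e₁ e₂ e₃ f₁ f₂ f₃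
  where open ℙ-Solver

·-assoc : ∀ g g′ g″ → (g · g′) · g″ ≡ g · (g′ · g″)
·-assoc (ex v h ε _) (ex v′ h′ ε′ _) (ex v″ h″ ε″ _) =
  ex-≡ (⊕-assoc v v′ v″) (⊕-assoc h h′ h″) (begin
    ε Sign.* ε′ Sign.* a Sign.* ε″ Sign.* b     ≡⟨ regroupˡ ⟩
    ε Sign.* (ε′ Sign.* ε″) Sign.* (a Sign.* b) ≡⟨ cong (ε Sign.* (ε′ Sign.* ε″) Sign.*_) ab≡cd ⟩
    ε Sign.* (ε′ Sign.* ε″) Sign.* (c Sign.* d) ≡⟨ regroupʳ ⟩
    ε Sign.* (ε′ Sign.* ε″ Sign.* c) Sign.* d   ∎)
  where
  open ≡-Reasoning
  t₁ = twist v h v′ h′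
  t₂ = twist (v ⊕ v′) (h ⊕ h′) v″ h″
  t₃ = twist v′ h′ v″ h″
  t₄ = twist v h (v′ ⊕ v″) (h′ ⊕ h″)
  a = toSign t₁
  b = toSign t₂
  c = toSign t₃
  d = toSign t₄
  ab≡cd : a Sign.* b ≡ c Sign.* d
  ab≡cd = trans (sym (ℙ.+-homo-* t₁ t₂)) (trans (cong toSign (twist-cocycle v h v′ h′ v″ h″)) (ℙ.+-homo-* t₃ t₄))
  open CommutativeMonoidSolver Sign.*-commutativeMonoid using (solve; _⊜_) renaming (_⊕_ to _:*_)
  regroupˡ = solve 5 (λ ε ε′ ε″ a b → (((ε :* ε′) :* a) :* ε″) :* b ⊜ (ε :* (ε′ :* ε″)) :* (a :* b)) refl ε ε′ ε″ a b
  regroupʳ = solve 5 (λ ε ε′ ε″ c d → (ε :* (ε′ :* ε″)) :* (c :* d) ⊜ (ε :* ((ε′ :* ε″) :* c)) :* d) refl ε ε′ ε″ c d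

twist-𝟎ˡ : ∀ v h → twist 𝟎 𝟎 v h ≡ 0ℙ
twist-𝟎ˡ (v₁ ∷ v₂ ∷ v₃ ∷ []) (h₁ ∷ h₂ ∷ h₃ ∷ []) = begin
  twist 𝟎 𝟎 (v₁ ∷ v₂ ∷ v₃ ∷ []) (h₁ ∷ h₂ ∷ h₃ ∷ [])
    ≡⟨ solve 3 (λ v₁ v₂ v₃ → con 0ℙ :+ ((v₁ :* con 0ℙ) :+ (v₂ :* con 0ℙ) :+ (v₃ :* con 0ℙ) :+ (v₂ :* con 0ℙ) :+ (v₃ :* con 0ℙ) :+ (v₃ :* con 0ℙ)) := con 0ℙ) refl v₁ v₂ v₃ ⟩
  0ℙ ∎
  where open ≡-Reasoning ; open ℙ-Solver

twist-𝟎ʳ : ∀ v h → twist v h 𝟎 𝟎 ≡ 0ℙ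
twist-𝟎ʳ (v₁ ∷ v₂ ∷ v₃ ∷ []) (h₁ ∷ h₂ ∷ h₃ ∷ []) =
  solve 2 (λ v₂ v₃ → (v₂ :* con 0ℙ) :+ (v₃ :* con 0ℙ) :+ (v₃ :* con 0ℙ) :+ con 0ℙ := con 0ℙ) refl v₂ v₃
  where open ℙ-Solver

·-identityˡ : ∀ g → 1ᴱ · g ≡ g
·-identityˡ (ex v h ε _) = ex-≡ (⊕-identityˡ v) (⊕-identityˡ h)
  (trans (cong (λ t → ε Sign.* toSign t) (twist-𝟎ˡ v h)) (Sign.*-identityʳ ε))

·-identityʳ : ∀ g → g · 1ᴱ ≡ g
·-identityʳ (ex v h ε _) = ex-≡ (⊕-identityʳ v) (⊕-identityʳ h)
  (trans (cong₂ (λ s t → s Sign.* toSign t) (Sign.*-identityʳ ε) (twist-𝟎ʳ v h)) (Sign.*-identityʳ ε))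

infix 8 _⁻¹ᴱ
_⁻¹ᴱ : Ex₃ → Ex₃
ex v h ε p ⁻¹ᴱ = ex v h (ε Sign.* toSign (twist v h v h)) p

·-inverseˡ : ∀ g → g ⁻¹ᴱ · g ≡ 1ᴱ
·-inverseˡ (ex v h ε _) = ex-≡ (⊕-self v) (⊕-self h) (lemma ε (toSign (twist v h v h)))
  where
  lemma : ∀ s t → s Sign.* t Sign.* s Sign.* t ≡ Sign.+
  lemma Sign.+ Sign.+ = refl
  lemma Sign.+ Sign.- = refl
  lemma Sign.- Sign.+ = refl
  lemma Sign.- Sign.- = refl

·-inverseʳ : ∀ g → g · g ⁻¹ᴱ ≡ 1ᴱ
·-inverseʳ (ex v h ε _) = ex-≡ (⊕-self v) (⊕-self h) (lemma ε (toSign (twist v h v h)))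
  where
  lemma : ∀ s t → s Sign.* (s Sign.* t) Sign.* t ≡ Sign.+
  lemma Sign.+ Sign.+ = refl
  lemma Sign.+ Sign.- = refl
  lemma Sign.- Sign.+ = refl
  lemma Sign.- Sign.- = refl

-ᴱ-involutive : ∀ g → -ᴱ (-ᴱ g) ≡ g
-ᴱ-involutive (ex v h ε _) = ex-≡ refl refl (Sign.opposite-involutive ε)

-ᴱ-·ˡ : ∀ g g′ → (-ᴱ g) · g′ ≡ -ᴱ (g · g′)
-ᴱ-·ˡ (ex v h Sign.+ _) (ex v′ h′ ε _) = ex-≡ refl refl (lemma ε (toSign (twist v h v′ h′)))
  where
  lemma : ∀ s t → Sign.opposite s Sign.* t ≡ Sign.opposite (s Sign.* t)
  lemma Sign.+ t = refl
  lemma Sign.- t = sym (Sign.opposite-involutive t)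
-ᴱ-·ˡ (ex v h Sign.- _) (ex v′ h′ ε _) = ex-≡ refl refl (lemma ε (toSign (twist v h v′ h′)))
  where
  lemma : ∀ s t → s Sign.* t ≡ Sign.opposite (Sign.opposite s Sign.* t)
  lemma Sign.+ t = sym (Sign.opposite-involutive t)
  lemma Sign.- t = refl

-ᴱ-·ʳ : ∀ g g′ → g · (-ᴱ g′) ≡ -ᴱ (g · g′)
-ᴱ-·ʳ (ex v h ε _) (ex v′ h′ ε′ _) = ex-≡ refl refl (lemma ε ε′ (toSign (twist v h v′ h′)))
  where
  lemma : ∀ r s t → r Sign.* Sign.opposite s Sign.* t ≡ Sign.opposite (r Sign.* s Sign.* t)
  lemma Sign.+ Sign.+ t = refl
  lemma Sign.+ Sign.- t = sym (Sign.opposite-involutive t)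
  lemma Sign.- Sign.+ t = sym (Sign.opposite-involutive t)
  lemma Sign.- Sign.- t = refl

private
  all₁ : {P : ℤ₃ → Set} → P (# 0) → P (# 1) → P (# 2) → ∀ a → P a
  all₁ p q r zero             = p
  all₁ p q r (suc zero)       = q
  all₁ p q r (suc (suc zero)) = r

+₃-comm : ∀ a b → a +₃ b ≡ b +₃ a
+₃-comm = Dec.from-yes (Fin.all? λ a → Fin.all? λ b → a +₃ b Fin.≟ b +₃ a)

+₃-assoc : ∀ a b c → (a +₃ b) +₃ c ≡ a +₃ (b +₃ c)
+₃-assoc = Dec.from-yes (Fin.all? λ a → Fin.all? λ b → Fin.all? λ c → (a +₃ b) +₃ c Fin.≟ a +₃ (b +₃ c))

+₃-identityˡ : ∀ a → 0₃ +₃ a ≡ a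
+₃-identityˡ = all₁ refl refl refl

+₃-identityʳ : ∀ a → a +₃ 0₃ ≡ a
+₃-identityʳ = all₁ refl refl refl

+₃-inverseʳ : ∀ a → a +₃ -₃ a ≡ 0₃
+₃-inverseʳ = all₁ refl refl refl

*₃-comm : ∀ a b → a *₃ b ≡ b *₃ a
*₃-comm = Dec.from-yes (Fin.all? λ a → Fin.all? λ b → a *₃ b Fin.≟ b *₃ a)

*₃-assoc : ∀ a b c → (a *₃ b) *₃ c ≡ a *₃ (b *₃ c)
*₃-assoc = Dec.from-yes (Fin.all? λ a → Fin.all? λ b → Fin.all? λ c → (a *₃ b) *₃ c Fin.≟ a *₃ (b *₃ c))

*₃-identityˡ : ∀ a → 1₃ *₃ a ≡ a
*₃-identityˡ = all₁ refl refl refl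

*₃-identityʳ : ∀ a → a *₃ 1₃ ≡ a
*₃-identityʳ = all₁ refl refl refl

*₃-zeroʳ : ∀ a → a *₃ 0₃ ≡ 0₃
*₃-zeroʳ = all₁ refl refl refl

*₃-distribˡ : ∀ a b c → a *₃ (b +₃ c) ≡ a *₃ b +₃ a *₃ c
*₃-distribˡ = Dec.from-yes (Fin.all? λ a → Fin.all? λ b → Fin.all? λ c → a *₃ (b +₃ c) Fin.≟ a *₃ b +₃ a *₃ c)

-₃-*ʳ : ∀ a b → a *₃ -₃ b ≡ -₃ (a *₃ b)
-₃-*ʳ = Dec.from-yes (Fin.all? λ a → Fin.all? λ b → a *₃ -₃ b Fin.≟ -₃ (a *₃ b))

-₃-*ˡ : ∀ a b → -₃ a *₃ b ≡ -₃ (a *₃ b)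
-₃-*ˡ = Dec.from-yes (Fin.all? λ a → Fin.all? λ b → -₃ a *₃ b Fin.≟ -₃ (a *₃ b))

-₃-+ : ∀ a b → -₃ (a +₃ b) ≡ -₃ a +₃ -₃ b
-₃-+ = Dec.from-yes (Fin.all? λ a → Fin.all? λ b → -₃ (a +₃ b) Fin.≟ -₃ a +₃ -₃ b)

-₃-involutive : ∀ a → -₃ (-₃ a) ≡ a
-₃-involutive = all₁ refl refl refl

one : ∀ a → 1₃ *₃ a +₃ 0₃ ≡ a
one a = trans (+₃-identityʳ (1₃ *₃ a)) (*₃-identityˡ a)

-₃-≡ : ∀ a b → a +₃ -₃ b ≡ 0₃ → a ≡ b
-₃-≡ a b p = begin
  a                  ≡⟨ +₃-identityʳ a ⟨
  a +₃ 0₃            ≡⟨ cong (a +₃_) (trans (+₃-comm (-₃ b) b) (+₃-inverseʳ b)) ⟨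
  a +₃ (-₃ b +₃ b)   ≡⟨ +₃-assoc a (-₃ b) b ⟨
  (a +₃ -₃ b) +₃ b   ≡⟨ cong (_+₃ b) p ⟩
  0₃ +₃ b            ≡⟨ +₃-identityˡ b ⟩
  b                  ∎
  where open ≡-Reasoning

+₃-medial : ∀ a b c d → (a +₃ b) +₃ (c +₃ d) ≡ (a +₃ c) +₃ (b +₃ d)
+₃-medial a b c d = begin
  (a +₃ b) +₃ (c +₃ d) ≡⟨ +₃-assoc a b (c +₃ d) ⟩
  a +₃ (b +₃ (c +₃ d)) ≡⟨ cong (a +₃_) (+₃-assoc b c d) ⟨
  a +₃ ((b +₃ c) +₃ d) ≡⟨ cong (λ e → a +₃ (e +₃ d)) (+₃-comm b c) ⟩
  a +₃ ((c +₃ b) +₃ d) ≡⟨ cong (a +₃_) (+₃-assoc c b d) ⟩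
  a +₃ (c +₃ (b +₃ d)) ≡⟨ +₃-assoc a c (b +₃ d) ⟨
  (a +₃ c) +₃ (b +₃ d) ∎
  where open ≡-Reasoning

-- x ⋄ φ is the value at x of the linear extension of φ.

infix 5 _⋄_
_⋄_ : ℤ₃[Ex₃] → (Ex₃ → ℤ₃) → ℤ₃
[]            ⋄ φ = 0₃
((a , g) ∷ x) ⋄ φ = a *₃ φ g +₃ (x ⋄ φ)

⋄-cong : ∀ x {φ χ} → (∀ g → φ g ≡ χ g) → (x ⋄ φ) ≡ (x ⋄ χ)
⋄-cong []            eq = refl
⋄-cong ((a , g) ∷ x) eq = cong₂ _+₃_ (cong (a *₃_) (eq g)) (⋄-cong x eq)

⋄-⊞ : ∀ x y φ → (x ⊞ y ⋄ φ) ≡ (x ⋄ φ) +₃ (y ⋄ φ)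
⋄-⊞ []            y φ = sym (+₃-identityˡ _)
⋄-⊞ ((a , g) ∷ x) y φ = trans (cong (a *₃ φ g +₃_) (⋄-⊞ x y φ)) (sym (+₃-assoc (a *₃ φ g) _ _))

⋄-neg : ∀ y φ → (map (λ (a , g) → -₃ a , g) y ⋄ φ) ≡ -₃ (y ⋄ φ)
⋄-neg []            φ = refl
⋄-neg ((a , g) ∷ y) φ = trans (cong₂ _+₃_ (-₃-*ˡ a (φ g)) (⋄-neg y φ)) (sym (-₃-+ (a *₃ φ g) (y ⋄ φ)))

⋄-⊟ : ∀ x y φ → (x ⊟ y ⋄ φ) ≡ (x ⋄ φ) +₃ -₃ (y ⋄ φ)
⋄-⊟ x y φ = trans (⋄-⊞ x _ φ) (cong ((x ⋄ φ) +₃_) (⋄-neg y φ))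

⋄-scale : ∀ a g y φ → (map (λ (b , h) → a *₃ b , g · h) y ⋄ φ) ≡ a *₃ (y ⋄ λ h → φ (g · h))
⋄-scale a g []            φ = sym (*₃-zeroʳ a)
⋄-scale a g ((b , h) ∷ y) φ = trans
  (cong₂ _+₃_ (*₃-assoc a b (φ (g · h))) (⋄-scale a g y φ))
  (sym (*₃-distribˡ a (b *₃ φ (g · h)) (y ⋄ λ h → φ (g · h))))

⋄-⊠ : ∀ x y φ → (x ⊠ y ⋄ φ) ≡ (x ⋄ λ g → y ⋄ λ h → φ (g · h))
⋄-⊠ []            y φ = refl
⋄-⊠ ((a , g) ∷ x) y φ = trans (⋄-⊞ (map _ y) (x ⊠ y) φ) (cong₂ _+₃_ (⋄-scale a g y φ) (⋄-⊠ x y φ))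

⋄-0 : ∀ x → (x ⋄ λ _ → 0₃) ≡ 0₃
⋄-0 []            = refl
⋄-0 ((a , g) ∷ x) = cong₂ _+₃_ (*₃-zeroʳ a) (⋄-0 x)

⋄-+ : ∀ x φ χ → (x ⋄ λ g → φ g +₃ χ g) ≡ (x ⋄ φ) +₃ (x ⋄ χ)
⋄-+ []            φ χ = refl
⋄-+ ((a , g) ∷ x) φ χ = trans
  (cong₂ _+₃_ (*₃-distribˡ a (φ g) (χ g)) (⋄-+ x φ χ))
  (+₃-medial (a *₃ φ g) (a *₃ χ g) (x ⋄ φ) (x ⋄ χ))

⋄-- : ∀ x φ → (x ⋄ λ g → -₃ φ g) ≡ -₃ (x ⋄ φ)
⋄-- []            φ = refl
⋄-- ((a , g) ∷ x) φ = trans (cong₂ _+₃_ (-₃-*ʳ a (φ g)) (⋄-- x φ)) (sym (-₃-+ (a *₃ φ g) (x ⋄ φ)))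

⋄-* : ∀ x b φ → (x ⋄ λ g → b *₃ φ g) ≡ b *₃ (x ⋄ φ)
⋄-* []            b φ = sym (*₃-zeroʳ b)
⋄-* ((a , g) ∷ x) b φ = trans (cong₂ _+₃_ lemma (⋄-* x b φ)) (sym (*₃-distribˡ b (a *₃ φ g) (x ⋄ φ)))
  where
  lemma : a *₃ (b *₃ φ g) ≡ b *₃ (a *₃ φ g)
  lemma = trans (sym (*₃-assoc a b (φ g))) (trans (cong (_*₃ φ g) (*₃-comm a b)) (*₃-assoc b a (φ g)))

⋄-swap : ∀ x y (φ : Ex₃ → Ex₃ → ℤ₃) → (x ⋄ λ g → y ⋄ λ h → φ g h) ≡ (y ⋄ λ h → x ⋄ λ g → φ g h)
⋄-swap []            y φ = sym (⋄-0 y)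
⋄-swap ((a , g) ∷ x) y φ = begin
  a *₃ (y ⋄ φ g) +₃ (x ⋄ λ g → y ⋄ φ g)                       ≡⟨ cong₂ _+₃_ (sym (⋄-* y a (φ g))) (⋄-swap x y φ) ⟩
  (y ⋄ λ h → a *₃ φ g h) +₃ (y ⋄ λ h → x ⋄ λ g → φ g h)       ≡⟨ ⋄-+ y (λ h → a *₃ φ g h) (λ h → x ⋄ λ g → φ g h) ⟨
  (y ⋄ λ h → a *₃ φ g h +₃ (x ⋄ λ g → φ g h))                 ∎
  where open ≡-Reasoning

-- An element of the group ring is determined modulo J₃ by its values under the
-- functionals o w, the differences of the coefficients of w and -w (≈⇒∼ and ∼⇒≈).

δ : Ex₃ → Ex₃ → ℤ₃
δ w g = if does (g ≟ᴱ w) then 1₃ else 0₃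

δ-≡ : ∀ {w g w′ g′} → (g ≡ w → g′ ≡ w′) → (g′ ≡ w′ → g ≡ w) → δ w g ≡ δ w′ g′
δ-≡ {w} {g} {w′} {g′} to from =
  cong (if_then 1₃ else 0₃) (Dec.does-⇔ (mk⇔ to from) (g ≟ᴱ w) (g′ ≟ᴱ w′))

δ-≢ : ∀ {w g} → g ≢ w → δ w g ≡ 0₃
δ-≢ {w} {g} g≢w = cong (if_then 1₃ else 0₃) (Dec.dec-false (g ≟ᴱ w) g≢w)

coeff-⋄ : ∀ x w → coeff x w ≡ (x ⋄ δ w)
coeff-⋄ []            w = refl
coeff-⋄ ((a , g) ∷ x) w = cong₂ _+₃_ (lemma (does (g ≟ᴱ w))) (coeff-⋄ x w)
  where
  lemma : ∀ b → (if b then a else 0₃) ≡ a *₃ (if b then 1₃ else 0₃)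
  lemma true  = sym (*₃-identityʳ a)
  lemma false = sym (*₃-zeroʳ a)

o : Ex₃ → Ex₃ → ℤ₃
o w g = δ w g +₃ -₃ δ (-ᴱ w) g

Odd : (Ex₃ → ℤ₃) → Set
Odd φ = ∀ g → φ (-ᴱ g) ≡ -₃ φ g

δ-neg : ∀ w g → δ w (-ᴱ g) ≡ δ (-ᴱ w) g
δ-neg w g = δ-≡ {w} { -ᴱ g} { -ᴱ w} {g}
  (λ eq → trans (sym (-ᴱ-involutive g)) (cong -ᴱ_ eq))
  (λ eq → trans (cong -ᴱ_ eq) (-ᴱ-involutive w))

o-odd : ∀ w → Odd (o w)
o-odd w g = begin
  δ w (-ᴱ g) +₃ -₃ δ (-ᴱ w) (-ᴱ g)        ≡⟨ cong₂ (λ a b → a +₃ -₃ b) (δ-neg w g)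
                                               (trans (δ-neg (-ᴱ w) g) (cong (λ k → δ k g) (-ᴱ-involutive w))) ⟩
  δ (-ᴱ w) g +₃ -₃ δ w g                  ≡⟨ lemma (δ w g) (δ (-ᴱ w) g) ⟩
  -₃ (δ w g +₃ -₃ δ (-ᴱ w) g)             ∎
  where
  open ≡-Reasoning
  lemma : ∀ a b → b +₃ -₃ a ≡ -₃ (a +₃ -₃ b)
  lemma a b = sym (trans (-₃-+ a (-₃ b)) (trans (cong (-₃ a +₃_) (-₃-involutive b)) (+₃-comm (-₃ a) b)))

δ-·ˡ : ∀ w g h → δ w (g · h) ≡ δ (g ⁻¹ᴱ · w) h
δ-·ˡ w g h = δ-≡ {w} {g · h} {g ⁻¹ᴱ · w} {h}
  (λ eq → trans (sym (cancel h)) (cong (g ⁻¹ᴱ ·_) eq))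
  (λ eq → trans (cong (g ·_) eq) (trans (sym (·-assoc g (g ⁻¹ᴱ) w)) (trans (cong (_· w) (·-inverseʳ g)) (·-identityˡ w))))
  where
  cancel : ∀ k → g ⁻¹ᴱ · (g · k) ≡ k
  cancel k = trans (sym (·-assoc (g ⁻¹ᴱ) g k)) (trans (cong (_· k) (·-inverseˡ g)) (·-identityˡ k))

δ-·ʳ : ∀ w g h → δ w (g · h) ≡ δ (w · h ⁻¹ᴱ) g
δ-·ʳ w g h = δ-≡ {w} {g · h} {w · h ⁻¹ᴱ} {g}
  (λ eq → trans (sym cancel) (cong (_· h ⁻¹ᴱ) eq))
  (λ eq → trans (cong (_· h) eq) (trans (·-assoc w (h ⁻¹ᴱ) h) (trans (cong (w ·_) (·-inverseˡ h)) (·-identityʳ w))))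
  where
  cancel : (g · h) · h ⁻¹ᴱ ≡ g
  cancel = trans (·-assoc g h (h ⁻¹ᴱ)) (trans (cong (g ·_) (·-inverseʳ h)) (·-identityʳ g))

o-·ˡ : ∀ w g h → o w (g · h) ≡ o (g ⁻¹ᴱ · w) h
o-·ˡ w g h = cong₂ (λ a b → a +₃ -₃ b) (δ-·ˡ w g h)
  (trans (δ-·ˡ (-ᴱ w) g h) (cong (λ k → δ k h) (-ᴱ-·ʳ (g ⁻¹ᴱ) w)))

o-·ʳ : ∀ w g h → o w (g · h) ≡ o (w · h ⁻¹ᴱ) g
o-·ʳ w g h = cong₂ (λ a b → a +₃ -₃ b) (δ-·ʳ w g h)
  (trans (δ-·ʳ (-ᴱ w) g h) (cong (λ k → δ k g) (-ᴱ-·ˡ w (h ⁻¹ᴱ))))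

o-⋄ : ∀ x w → (x ⋄ o w) ≡ coeff x w +₃ -₃ coeff x (-ᴱ w)
o-⋄ x w = trans (⋄-+ x (δ w) _) (cong₂ _+₃_ (sym (coeff-⋄ x w))
  (trans (⋄-- x (δ (-ᴱ w))) (cong -₃_ (sym (coeff-⋄ x (-ᴱ w))))))

infix 4 _∼_
_∼_ : ℤ₃[Ex₃] → ℤ₃[Ex₃] → Set
x ∼ y = ∀ w → (x ⋄ o w) ≡ (y ⋄ o w)

generator-odd : ∀ {φ} → Odd φ → ∀ a b → (a ⊠ generator ⊠ b ⋄ φ) ≡ 0₃
generator-odd {φ} φ-odd a b = begin
  a ⊠ generator ⊠ b ⋄ φ                         ≡⟨ ⋄-⊠ (a ⊠ generator) b φ ⟩
  a ⊠ generator ⋄ F                             ≡⟨ ⋄-⊠ a generator F ⟩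
  (a ⋄ λ g → generator ⋄ λ k → F (g · k))       ≡⟨ ⋄-cong a F-cancel ⟩
  (a ⋄ λ g → 0₃)                                ≡⟨ ⋄-0 a ⟩
  0₃                                            ∎
  where
  open ≡-Reasoning
  F : Ex₃ → ℤ₃
  F k = b ⋄ λ h → φ (k · h)
  F-odd : Odd F
  F-odd k = trans (⋄-cong b λ h → trans (cong φ (-ᴱ-·ˡ k h)) (φ-odd (k · h))) (⋄-- b λ h → φ (k · h))
  F-cancel : ∀ g → (generator ⋄ λ k → F (g · k)) ≡ 0₃
  F-cancel g = begin
    1₃ *₃ F (g · 1ᴱ) +₃ (1₃ *₃ F (g · (-ᴱ 1ᴱ)) +₃ 0₃)
      ≡⟨ cong₂ _+₃_ (*₃-identityˡ (F (g · 1ᴱ))) (one (F (g · (-ᴱ 1ᴱ)))) ⟩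
    F (g · 1ᴱ) +₃ F (g · (-ᴱ 1ᴱ))
      ≡⟨ cong (λ k → F (g · 1ᴱ) +₃ F k) (-ᴱ-·ʳ g 1ᴱ) ⟩
    F (g · 1ᴱ) +₃ F (-ᴱ (g · 1ᴱ))
      ≡⟨ cong (F (g · 1ᴱ) +₃_) (F-odd (g · 1ᴱ)) ⟩
    F (g · 1ᴱ) +₃ -₃ F (g · 1ᴱ)
      ≡⟨ +₃-inverseʳ (F (g · 1ᴱ)) ⟩
    0₃ ∎

≈⇒∼ : ∀ {x y} → x ≈ y → x ∼ y
≈⇒∼ {x} {y} (mod-J₃ (abs , eq)) w = -₃-≡ (x ⋄ o w) (y ⋄ o w) (begin
  (x ⋄ o w) +₃ -₃ (y ⋄ o w)                          ≡⟨ ⋄-⊟ x y (o w) ⟨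
  (x ⊟ y ⋄ o w)                                      ≡⟨ o-⋄ (x ⊟ y) w ⟩
  coeff (x ⊟ y) w +₃ -₃ coeff (x ⊟ y) (-ᴱ w)         ≡⟨ cong₂ (λ a b → a +₃ -₃ b) (eq w) (eq (-ᴱ w)) ⟩
  coeff s w +₃ -₃ coeff s (-ᴱ w)                     ≡⟨ o-⋄ s w ⟨
  (s ⋄ o w)                                          ≡⟨ vanish abs ⟩
  0₃                                                 ∎)
  where
  open ≡-Reasoning
  S : List (ℤ₃[Ex₃] × ℤ₃[Ex₃]) → ℤ₃[Ex₃]
  S = concatMap (λ (a , b) → a ⊠ generator ⊠ b)
  s : ℤ₃[Ex₃]
  s = S abs
  vanish : ∀ abs → (S abs ⋄ o w) ≡ 0₃
  vanish []              = refl
  vanish ((a , b) ∷ abs) = trans (⋄-⊞ (a ⊠ generator ⊠ b) (S abs) (o w))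
    (cong₂ _+₃_ (generator-odd (o-odd w) a b) (vanish abs))

positive : ℤ₃[Ex₃] → ℤ₃[Ex₃]
positive []                            = []
positive ((a , ex v h Sign.+ p) ∷ x) = (a , ex v h Sign.+ p) ∷ positive x
positive ((a , ex v h Sign.- p) ∷ x) = positive x

plus : Ex₃ → Ex₃
plus (ex v h _ p) = ex v h Sign.+ p

positive-⋄ : ∀ x w → (positive x ⋄ λ g → δ w g +₃ δ w (-ᴱ g)) ≡ (x ⋄ δ (plus w))
positive-⋄ []                          w = refl
positive-⋄ ((a , ex v h Sign.- p) ∷ x) w = trans (positive-⋄ x w) (sym (trans
  (cong (_+₃ (x ⋄ δ (plus w))) (trans (cong (a *₃_) (δ-≢ {plus w} {ex v h Sign.- p} λ ())) (*₃-zeroʳ a)))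
  (+₃-identityˡ _)))
positive-⋄ ((a , g@(ex v h Sign.+ p)) ∷ x) w@(ex _ _ Sign.+ _) =
  cong₂ _+₃_ (cong (a *₃_) (trans (cong (δ w g +₃_) (δ-≢ {w} { -ᴱ g} λ ())) (+₃-identityʳ (δ w g)))) (positive-⋄ x w)
positive-⋄ ((a , g@(ex v h Sign.+ p)) ∷ x) w@(ex _ _ Sign.- _) =
  cong₂ _+₃_ (cong (a *₃_) (trans (cong₂ _+₃_ (δ-≢ {w} {g} λ ()) (δ-neg w g)) (+₃-identityˡ (δ (-ᴱ w) g)))) (positive-⋄ x w)

∼⇒≈ : ∀ {x y} → x ∼ y → x ≈ y
∼⇒≈ {x} {y} eq = mod-J₃ ([ (positive u , ⟦ 1ᴱ ⟧) ] , λ w → begin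
  coeff u w                                                     ≡⟨ coeff-plus w ⟩
  coeff u (plus w)                                              ≡⟨ coeff-⋄ u (plus w) ⟩
  (u ⋄ δ (plus w))                                              ≡⟨ positive-⋄ u w ⟨
  (positive u ⋄ λ g → δ w g +₃ δ w (-ᴱ g))                      ≡⟨ ⋄-cong (positive u) (λ g → sym (inner w g)) ⟩
  (positive u ⋄ λ g → generator ⋄ λ k → ⟦ 1ᴱ ⟧ ⋄ λ h → δ w (g · k · h))
                                                                ≡⟨ ⋄-⊠ (positive u) generator _ ⟨
  (positive u ⊠ generator ⋄ λ k → ⟦ 1ᴱ ⟧ ⋄ λ h → δ w (k · h))   ≡⟨ ⋄-⊠ (positive u ⊠ generator) ⟦ 1ᴱ ⟧ (δ w) ⟨
  (positive u ⊠ generator ⊠ ⟦ 1ᴱ ⟧ ⋄ δ w)                       ≡⟨ trans (⋄-⊞ (positive u ⊠ generator ⊠ ⟦ 1ᴱ ⟧) [] (δ w)) (+₃-identityʳ (positive u ⊠ generator ⊠ ⟦ 1ᴱ ⟧ ⋄ δ w)) ⟨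
  (positive u ⊠ generator ⊠ ⟦ 1ᴱ ⟧ ⊞ [] ⋄ δ w)                 ≡⟨ coeff-⋄ (positive u ⊠ generator ⊠ ⟦ 1ᴱ ⟧ ⊞ []) w ⟨
  coeff (positive u ⊠ generator ⊠ ⟦ 1ᴱ ⟧ ⊞ []) w               ∎)
  where
  open ≡-Reasoning
  u : ℤ₃[Ex₃]
  u = x ⊟ y
  coeff-neg : ∀ w → coeff u w ≡ coeff u (-ᴱ w)
  coeff-neg w = -₃-≡ (coeff u w) (coeff u (-ᴱ w)) (trans (sym (o-⋄ u w)) (trans (⋄-⊟ x y (o w))
    (trans (cong (_+₃ -₃ (y ⋄ o w)) (eq w)) (+₃-inverseʳ (y ⋄ o w)))))
  coeff-plus : ∀ w → coeff u w ≡ coeff u (plus w)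
  coeff-plus (ex _ _ Sign.+ _) = refl
  coeff-plus w@(ex _ _ Sign.- _) = coeff-neg w
  inner : ∀ w g → (generator ⋄ λ k → ⟦ 1ᴱ ⟧ ⋄ λ h → δ w (g · k · h)) ≡ δ w g +₃ δ w (-ᴱ g)
  inner w g = cong₂ _+₃_
    (trans (*₃-identityˡ (⟦ 1ᴱ ⟧ ⋄ λ h → δ w (g · 1ᴱ · h))) (trans (one (δ w (g · 1ᴱ · 1ᴱ))) (cong (δ w) (trans (·-identityʳ _) (·-identityʳ g)))))
    (trans (one (⟦ 1ᴱ ⟧ ⋄ λ h → δ w (g · (-ᴱ 1ᴱ) · h))) (trans (one (δ w (g · (-ᴱ 1ᴱ) · 1ᴱ))) (cong (δ w) (trans (·-identityʳ _) (trans (-ᴱ-·ʳ g 1ᴱ) (cong -ᴱ_ (·-identityʳ g)))))))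

⊠-congˡ : ∀ x {y y′} → y ∼ y′ → x ⊠ y ∼ x ⊠ y′
⊠-congˡ x {y} {y′} eq w = trans (⋄-⊠ x y (o w)) (trans (⋄-cong x λ g →
    trans (⋄-cong y (o-·ˡ w g)) (trans (eq (g ⁻¹ᴱ · w)) (sym (⋄-cong y′ (o-·ˡ w g)))))
  (sym (⋄-⊠ x y′ (o w))))

⊠-congʳ : ∀ {x x′} y → x ∼ x′ → x ⊠ y ∼ x′ ⊠ y
⊠-congʳ {x} {x′} y eq w = trans (trans (⋄-⊠ x y (o w)) (⋄-swap x y _)) (trans (⋄-cong y λ h →
    trans (⋄-cong x (λ g → o-·ʳ w g h)) (trans (eq (w · h ⁻¹ᴱ)) (sym (⋄-cong x′ (λ g → o-·ʳ w g h)))))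
  (sym (trans (⋄-⊠ x′ y (o w)) (⋄-swap x′ y _))))

⊠-cong : ∀ {x x′ y y′} → x ∼ x′ → y ∼ y′ → x ⊠ y ∼ x′ ⊠ y′
⊠-cong {x} {x′} {y} {y′} p q w = trans (⊠-congʳ {x} {x′} y p w) (⊠-congˡ x′ {y} {y′} q w)

⊠-assoc : ∀ x y z → (x ⊠ y) ⊠ z ∼ x ⊠ (y ⊠ z)
⊠-assoc x y z w = begin
  ((x ⊠ y) ⊠ z ⋄ o w)                                       ≡⟨ ⋄-⊠ (x ⊠ y) z (o w) ⟩
  (x ⊠ y ⋄ λ k → z ⋄ λ l → o w (k · l))                     ≡⟨ ⋄-⊠ x y _ ⟩
  (x ⋄ λ g → y ⋄ λ h → z ⋄ λ l → o w (g · h · l))           ≡⟨ (⋄-cong x λ g → ⋄-cong y λ h → ⋄-cong z λ l → cong (o w) (·-assoc g h l)) ⟩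
  (x ⋄ λ g → y ⋄ λ h → z ⋄ λ l → o w (g · (h · l)))         ≡⟨ (⋄-cong x λ g → ⋄-⊠ y z λ k → o w (g · k)) ⟨
  (x ⋄ λ g → y ⊠ z ⋄ λ k → o w (g · k))                     ≡⟨ ⋄-⊠ x (y ⊠ z) (o w) ⟨
  (x ⊠ (y ⊠ z) ⋄ o w)                                       ∎
  where open ≡-Reasoning

⊠-identityˡ : ∀ x → ⟦ 1ᴱ ⟧ ⊠ x ∼ x
⊠-identityˡ x w = trans (⋄-⊠ ⟦ 1ᴱ ⟧ x (o w)) (trans (one (x ⋄ λ g → o w (1ᴱ · g)))
  (⋄-cong x λ g → cong (o w) (·-identityˡ g)))

⊠-identityʳ : ∀ x → x ⊠ ⟦ 1ᴱ ⟧ ∼ x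
⊠-identityʳ x w = trans (⋄-⊠ x ⟦ 1ᴱ ⟧ (o w)) (⋄-cong x λ g →
  trans (one (o w (g · 1ᴱ))) (cong (o w) (·-identityʳ g)))

swᴵ ≺ᴵ : ∀ {n} → Square n → Square n → Parity
swᴵ p q = ind (southWest? p q)
≺ᴵ p q = ind (p ≺? q)

parity-pairs : ∀ {n} {P Q : Pred (Square n) 0ℓ} {R : Square n → Square n → Set}
  (P? : Decidable P) (Q? : Decidable Q) (R? : ∀ p q → Dec (R p q)) →
  parity (length (filter (λ (p , q) → R? p q) (cartesianProduct (filter P? (squares n)) (filter Q? (squares n)))))
  ≡ pairs (ind ∘ P?) (ind ∘ Q?) (λ p q → ind (R? p q))
parity-pairs {n} P? Q? R? = begin
  _ ≡⟨ parity-filter (λ (p , q) → R? p q) (cartesianProduct (filter P? (squares n)) (filter Q? (squares n))) ⟩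
  ∑ᴸ (cartesianProduct (filter P? (squares n)) (filter Q? (squares n))) (λ (p , q) → ind (R? p q))
    ≡⟨ ∑ᴸ-× (filter P? (squares n)) (filter Q? (squares n)) _ ⟩
  ∑ᴸ (filter P? (squares n)) (λ p → ∑ᴸ (filter Q? (squares n)) λ q → ind (R? p q))
    ≡⟨ ∑ᴸ-filter P? (squares n) _ ⟩
  ∑ᴸ (squares n) (λ p → ind (P? p) ℙ.* ∑ᴸ (filter Q? (squares n)) λ q → ind (R? p q))
    ≡⟨ ∑ᴸ-squares (λ p → ind (P? p) ℙ.* ∑ᴸ (filter Q? (squares n)) λ q → ind (R? p q)) ⟩
  ∑² (λ p → ind (P? p) ℙ.* ∑ᴸ (filter Q? (squares n)) λ q → ind (R? p q))
    ≡⟨ (∑²-cong λ p → cong (ind (P? p) ℙ.*_) (trans (∑ᴸ-filter Q? (squares n) (λ q → ind (R? p q)))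
         (∑ᴸ-squares λ q → ind (Q? q) ℙ.* ind (R? p q)))) ⟩
  pairs (ind ∘ P?) (ind ∘ Q?) (λ p q → ind (R? p q)) ∎
  where open ≡-Reasoning

parity-inv : ∀ {D} (d : Decomposition D) → parity (inv d) ≡ pairs (vᴵ d) (vᴵ d) swᴵ
parity-inv d = parity-pairs (λ (i , j) → i ∈? V d j) (λ (i , j) → i ∈? V d j) southWest?

parity-cross : ∀ {D} (d : Decomposition D) → parity (cross d) ≡ pairs (hᴵ d) (vᴵ d) ≺ᴵ
parity-cross {D} d = parity-pairs (λ (i , j) → white? D (i , j) ×-dec ¬? (i ∈? V d j)) (λ (i , j) → i ∈? V d j) _≺?_

κ< κ≤ κ0 : Fin 3 → Fin 3 → Parity
κ< i k = ind (i Fin.<? k)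
κ≤ i k = ind (i Fin.≤? k)
κ0 i k = 0ℙ

inv-suc : ∀ {n} (x y : Square (suc n) → Parity) →
  pairs x y swᴵ ≡ (form κ0 (first x) (first y) ℙ.+ form κ0 (first x) (rows (rest y)))
                  ℙ.+ (form κ< (rows (rest x)) (first y) ℙ.+ pairs (rest x) (rest y) swᴵ)
inv-suc x y = pairs-suc x y {swᴵ} {swᴵ} {κ0} {κ0} {κ<}
  (λ i k → lemma₀ (does (i Fin.<? k)))
  (λ i k b → lemma₀ (does (i Fin.<? k)))
  (λ i a k → lemma₁ (does (i Fin.<? k)))
  (λ i a k b → refl)
  where
  lemma₀ : ∀ b → (if b ∧ false then 1ℙ else 0ℙ) ≡ 0ℙ
  lemma₀ true  = refl
  lemma₀ false = refl
  lemma₁ : ∀ b → (if b ∧ true then 1ℙ else 0ℙ) ≡ (if b then 1ℙ else 0ℙ)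
  lemma₁ true  = refl
  lemma₁ false = refl

cross-suc : ∀ {n} (x y : Square (suc n) → Parity) →
  pairs x y ≺ᴵ ≡ (form κ< (first x) (first y) ℙ.+ form κ≤ (first x) (rows (rest y)))
                 ℙ.+ (form κ< (rows (rest x)) (first y) ℙ.+ pairs (rest x) (rest y) ≺ᴵ)
cross-suc x y = pairs-suc x y {≺ᴵ} {≺ᴵ} {κ<} {κ≤} {κ<}
  (λ i k → lemma₀ (does (i Fin.<? k)) (does (i Fin.≟ k)))
  (λ i k b → Dec.from-yes (Fin.all? λ i → Fin.all? λ k → lemma₁ i k ℙ.≟ κ≤ i k) i k)
  (λ i a k → lemma₀ (does (i Fin.<? k)) (does (i Fin.≟ k)))
  (λ i a k b → refl)
  where
  lemma₀ : ∀ a b → (if a ∨ (b ∧ false) then 1ℙ else 0ℙ) ≡ (if a then 1ℙ else 0ℙ)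
  lemma₀ true  b     = refl
  lemma₀ false true  = refl
  lemma₀ false false = refl
  lemma₁ : Fin 3 → Fin 3 → Parity
  lemma₁ i k = if does (i Fin.<? k) ∨ (does (i Fin.≟ k) ∧ true) then 1ℙ else 0ℙ

exponent : ∀ {D} → Decomposition D → Parity
exponent d = pairs (vᴵ d) (vᴵ d) swᴵ ℙ.+ pairs (hᴵ d) (vᴵ d) ≺ᴵ

sgn-exponent : ∀ {D} (d : Decomposition D) → sgn d ≡ toSign (exponent d)
sgn-exponent d = trans (cong₂ (λ a b → toSign a Sign.* toSign b) (parity-inv d) (parity-cross d))
  (sym (ℙ.+-homo-* (pairs (vᴵ d) (vᴵ d) swᴵ) (pairs (hᴵ d) (vᴵ d) ≺ᴵ)))

column : ∀ {c} → EvenPart c → Decomposition (C c)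
column e = e ∷ []

exponent-suc : ∀ {c D} (e : EvenPart c) (d : Decomposition D) → exponent (e ∷ d) ≡
  exponent (column e) ℙ.+ exponent d ℙ.+
  twist (Vec.tabulate (rows (vᴵ (column e)))) (Vec.tabulate (rows (hᴵ (column e))))
        (Vec.tabulate (rows (vᴵ d))) (Vec.tabulate (rows (hᴵ d)))
exponent-suc {c} {D} e d = begin
  exponent (e ∷ d)
    ≡⟨ cong₂ ℙ._+_ (inv-suc (vᴵ (e ∷ d)) (vᴵ (e ∷ d))) (cross-suc (hᴵ (e ∷ d)) (vᴵ (e ∷ d))) ⟩
  _ ≡⟨ identity (v # 0) (v # 1) (v # 2) (h # 0) (h # 1) (h # 2) (a # 0) (a # 1) (a # 2) (b # 0) (b # 1) (b # 2)
         (pairs (vᴵ d) (vᴵ d) swᴵ) (pairs (hᴵ d) (vᴵ d) ≺ᴵ) ⟩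
  _ ≡⟨ cong (λ s → s ℙ.+ exponent d ℙ.+ t)
         (cong₂ ℙ._+_ (inv-suc (vᴵ (column e)) (vᴵ (column e))) (cross-suc (hᴵ (column e)) (vᴵ (column e)))) ⟨
  _ ∎
  where
  open ≡-Reasoning
  t = twist (Vec.tabulate (rows (vᴵ (column e)))) (Vec.tabulate (rows (hᴵ (column e))))
            (Vec.tabulate (rows (vᴵ d))) (Vec.tabulate (rows (hᴵ d)))
  infix 9 _#_
  _#_ : (Fin 3 → Parity) → (i : ℕ) {i<3 : Dec.True (i ℕ.<? 3)} → Parity
  (x # i) {i<3} = x (Fin.#_ i {m<n = i<3})
  v h a b : Fin 3 → Parity
  v = first (vᴵ (e ∷ d))
  h = first (hᴵ (e ∷ d))
  a = rows (vᴵ d)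
  b = rows (hᴵ d)
  open ℙ-Solver
  formᴾ : ∀ {n} → (Fin 3 → Fin 3 → Parity) → (x₁ x₂ x₃ y₁ y₂ y₃ : Polynomial n) → Polynomial n
  formᴾ κ x₁ x₂ x₃ y₁ y₂ y₃ =
    (x₁ :* row zero) :+ ((x₂ :* row (suc zero)) :+ ((x₃ :* row (suc (suc zero))) :+ con 0ℙ))
    where
    row : Fin 3 → Polynomial _
    row i = (y₁ :* con (κ i zero)) :+ ((y₂ :* con (κ i (suc zero))) :+ ((y₃ :* con (κ i (suc (suc zero)))) :+ con 0ℙ))
  identity = solve 14 (λ v₁ v₂ v₃ h₁ h₂ h₃ a₁ a₂ a₃ b₁ b₂ b₃ I K →
    ((formᴾ κ0 v₁ v₂ v₃ v₁ v₂ v₃ :+ formᴾ κ0 v₁ v₂ v₃ a₁ a₂ a₃) :+ (formᴾ κ< a₁ a₂ a₃ v₁ v₂ v₃ :+ I))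
    :+ ((formᴾ κ< h₁ h₂ h₃ v₁ v₂ v₃ :+ formᴾ κ≤ h₁ h₂ h₃ a₁ a₂ a₃) :+ (formᴾ κ< b₁ b₂ b₃ v₁ v₂ v₃ :+ K))
    := let v₁′ = v₁ :+ con 0ℙ ; v₂′ = v₂ :+ con 0ℙ ; v₃′ = v₃ :+ con 0ℙ
           h₁′ = h₁ :+ con 0ℙ ; h₂′ = h₂ :+ con 0ℙ ; h₃′ = h₃ :+ con 0ℙ
           o = con 0ℙ in
    (((formᴾ κ0 v₁ v₂ v₃ v₁ v₂ v₃ :+ formᴾ κ0 v₁ v₂ v₃ o o o) :+ (formᴾ κ< o o o v₁ v₂ v₃ :+ o))
     :+ ((formᴾ κ< h₁ h₂ h₃ v₁ v₂ v₃ :+ formᴾ κ≤ h₁ h₂ h₃ o o o) :+ (formᴾ κ< o o o v₁ v₂ v₃ :+ o)))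
    :+ (I :+ K)
    :+ (((v₂′ :* (a₁ :+ b₁)) :+ (v₃′ :* (a₁ :+ b₁)) :+ (v₃′ :* (a₂ :+ b₂)))
        :+ ((a₁ :* h₁′) :+ (a₂ :* h₁′) :+ (a₃ :* h₁′) :+ (a₂ :* h₂′) :+ (a₃ :* h₂′) :+ (a₃ :* h₃′))))
    refl

tabulate-⊕ : ∀ (x y : Fin 3 → Parity) → Vec.tabulate (λ i → x i ℙ.+ y i) ≡ Vec.tabulate (λ i → x i ℙ.+ 0ℙ) ⊕ Vec.tabulate y
tabulate-⊕ x y = cong₂ _∷_ (l zero) (cong₂ _∷_ (l (suc zero)) (cong (_∷ []) (l (suc (suc zero)))))
  where
  l : ∀ i → x i ℙ.+ y i ≡ (x i ℙ.+ 0ℙ) ℙ.+ y i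
  l i = cong (ℙ._+ y i) (sym (ℙ.+-identityʳ (x i)))

f-∷ : ∀ {c D} (e : EvenPart c) (d : Decomposition D) → f (e ∷ d) ≡ f (column e) · f d
f-∷ e d = ex-≡ excess-v excess-h (begin
  sgn (e ∷ d)                                                    ≡⟨ sgn-exponent (e ∷ d) ⟩
  toSign (exponent (e ∷ d))                                      ≡⟨ cong toSign (exponent-suc e d) ⟩
  toSign (exponent (column e) ℙ.+ exponent d ℙ.+ t)              ≡⟨ ℙ.+-homo-* (exponent (column e) ℙ.+ exponent d) t ⟩
  toSign (exponent (column e) ℙ.+ exponent d) Sign.* toSign t    ≡⟨ cong (Sign._* toSign t) (ℙ.+-homo-* (exponent (column e)) (exponent d)) ⟩
  toSign (exponent (column e)) Sign.* toSign (exponent d) Sign.* toSign t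
    ≡⟨ cong₂ (λ r s → r Sign.* s Sign.* toSign t) (sgn-exponent (column e)) (sgn-exponent d) ⟨
  sgn (column e) Sign.* sgn d Sign.* toSign t                    ≡⟨ cong (λ t → sgn (column e) Sign.* sgn d Sign.* toSign t) t≡ ⟨
  sgn (column e) Sign.* sgn d Sign.* toSign (twist (excess (Vsquares (column e))) (excess (Hsquares (column e))) (excess (Vsquares d)) (excess (Hsquares d))) ∎)
  where
  open ≡-Reasoning
  t = twist (Vec.tabulate (rows (vᴵ (column e)))) (Vec.tabulate (rows (hᴵ (column e))))
            (Vec.tabulate (rows (vᴵ d))) (Vec.tabulate (rows (hᴵ d)))
  t≡ : twist (excess (Vsquares (column e))) (excess (Hsquares (column e))) (excess (Vsquares d)) (excess (Hsquares d)) ≡ t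
  t≡ = trans (cong₂ (λ p q → twist p q (excess (Vsquares d)) (excess (Hsquares d))) (excess-V (column e)) (excess-H (column e)))
             (cong₂ (twist (Vec.tabulate (rows (vᴵ (column e)))) (Vec.tabulate (rows (hᴵ (column e))))) (excess-V d) (excess-H d))
  excess-v : excess (Vsquares (e ∷ d)) ≡ excess (Vsquares (column e)) ⊕ excess (Vsquares d)
  excess-v = trans (excess-V (e ∷ d)) (trans (tabulate-⊕ (first (vᴵ (e ∷ d))) (rows (vᴵ d))) (sym (cong₂ _⊕_ (excess-V (column e)) (excess-V d))))
  excess-h : excess (Hsquares (e ∷ d)) ≡ excess (Hsquares (column e)) ⊕ excess (Hsquares d)
  excess-h = trans (excess-H (e ∷ d)) (trans (tabulate-⊕ (first (hᴵ (e ∷ d))) (rows (hᴵ d))) (sym (cong₂ _⊕_ (excess-H (column e)) (excess-H d))))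

⟪⟫-∷ : ∀ c D → ⟪ c ∷ D ⟫ ≡ ⟪ C c ⟫ ⊠ ⟪ D ⟫
⟪⟫-∷ c D = go (evenParts c)
  where
  F : ∀ {D} → Decomposition D → ℤ₃ × Ex₃
  F d = 1₃ , f d
  inner : ∀ e ds → map F (map (e ∷_) ds) ≡ map (λ (b , h) → 1₃ *₃ b , f (column e) · h) (map F ds)
  inner e []       = refl
  inner e (d ∷ ds) = cong₂ _∷_ (cong (1₃ ,_) (f-∷ e d)) (inner e ds)
  go : ∀ es → map F (cartesianProductWith _∷_ es (decompositions D)) ≡ map F (cartesianProductWith _∷_ es [ [] ]) ⊠ ⟪ D ⟫
  go []       = refl
  go (e ∷ es) = trans (List.map-++ F (map (e ∷_) (decompositions D)) _)
    (cong₂ _++_ (inner e (decompositions D)) (go es))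

⟪[]⟫ : ⟪ [] ⟫ ≡ ⟦ 1ᴱ ⟧
⟪[]⟫ = refl

⟪⟫-⋆ : ∀ D E → ⟪ D ⋆ E ⟫ ∼ ⟪ D ⟫ ⊠ ⟪ E ⟫
⟪⟫-⋆ []      E w = sym (⊠-identityˡ ⟪ E ⟫ w)
⟪⟫-⋆ (c ∷ D) E w = begin
  (⟪ c ∷ D ⋆ E ⟫ ⋄ o w)                    ≡⟨ cong (_⋄ o w) (⟪⟫-∷ c (D ⋆ E)) ⟩
  (⟪ C c ⟫ ⊠ ⟪ D ⋆ E ⟫ ⋄ o w)              ≡⟨ ⊠-congˡ ⟪ C c ⟫ {⟪ D ⋆ E ⟫} {⟪ D ⟫ ⊠ ⟪ E ⟫} (⟪⟫-⋆ D E) w ⟩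
  (⟪ C c ⟫ ⊠ (⟪ D ⟫ ⊠ ⟪ E ⟫) ⋄ o w)        ≡⟨ ⊠-assoc ⟪ C c ⟫ ⟪ D ⟫ ⟪ E ⟫ w ⟨
  (⟪ C c ⟫ ⊠ ⟪ D ⟫ ⊠ ⟪ E ⟫ ⋄ o w)          ≡⟨ cong (λ x → x ⊠ ⟪ E ⟫ ⋄ o w) (⟪⟫-∷ c D) ⟨
  (⟪ c ∷ D ⟫ ⊠ ⟪ E ⟫ ⋄ o w)                ∎
  where open ≡-Reasoning

-- The isomorphism ψ has to send the coset of [D] to Ψ D, because it is multiplicative
-- with values ψ[C S ] on the cosets of the generators.
Ψ : 𝒟₃ → 𝔾.Carrier
Ψ []      = 𝔾.ε
Ψ (S ∷ D) = ψ[C S ] 𝔾.∙ Ψ D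

Ψ-⋆ : ∀ D E → Ψ (D ⋆ E) 𝔾.≈ Ψ D 𝔾.∙ Ψ E
Ψ-⋆ []      E = 𝔾.sym {𝔾.ε 𝔾.∙ Ψ E} {Ψ E} (𝔾.identityˡ (Ψ E))
Ψ-⋆ (S ∷ D) E = 𝔾.trans {ψ[C S ] 𝔾.∙ Ψ (D ⋆ E)} {ψ[C S ] 𝔾.∙ (Ψ D 𝔾.∙ Ψ E)} {ψ[C S ] 𝔾.∙ Ψ D 𝔾.∙ Ψ E}
  (𝔾.∙-congˡ {ψ[C S ]} {Ψ (D ⋆ E)} {Ψ D 𝔾.∙ Ψ E} (Ψ-⋆ D E))
  (𝔾.sym {ψ[C S ] 𝔾.∙ Ψ D 𝔾.∙ Ψ E} {ψ[C S ] 𝔾.∙ (Ψ D 𝔾.∙ Ψ E)} (𝔾.assoc ψ[C S ] (Ψ D) (Ψ E)))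

∼-refl : ∀ {x} → x ∼ x
∼-refl w = refl

∼-sym : ∀ {x y} → x ∼ y → y ∼ x
∼-sym p w = sym (p w)

∼-trans : ∀ {x y z} → x ∼ y → y ∼ z → x ∼ z
∼-trans p q w = trans (p w) (q w)

≡⇒∼ : ∀ {x y} → x ≡ y → x ∼ y
≡⇒∼ refl w = refl

Tree : ℕ → Set
Tree zero    = ℤ₃
Tree (suc n) = Tree n × Tree n

0ᵀ : ∀ n → Tree n
0ᵀ zero    = 0₃
0ᵀ (suc n) = 0ᵀ n , 0ᵀ n

look : ∀ {n} → Tree n → Vec Parity n → ℤ₃
look a       []       = a
look (l , r) (0ℙ ∷ k) = look l k
look (l , r) (1ℙ ∷ k) = look r k

add : ∀ {n} → Vec Parity n → ℤ₃ → Tree n → Tree n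
add []       a b       = a +₃ b
add (0ℙ ∷ k) a (l , r) = add k a l , r
add (1ℙ ∷ k) a (l , r) = l , add k a r

_≟ᵀ_ : ∀ {n} → DecidableEquality (Tree n)
_≟ᵀ_ {zero}  = Fin._≟_
_≟ᵀ_ {suc n} = Product.≡-dec _≟ᵀ_ _≟ᵀ_

look-ext : ∀ n {t u : Tree n} → (∀ k → look t k ≡ look u k) → t ≡ u
look-ext zero    eq = eq []
look-ext (suc n) eq = cong₂ _,_ (look-ext n (λ k → eq (0ℙ ∷ k))) (look-ext n (λ k → eq (1ℙ ∷ k)))

_≟ⱽ_ : ∀ {n} → DecidableEquality (Vec Parity n)
_≟ⱽ_ = Vec.≡-dec ℙ._≟_

_at_ : ∀ {A : Set} → ℤ₃ → Dec A → ℤ₃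
a at a? = if does a? then a else 0₃

look-0ᵀ : ∀ n k → look (0ᵀ n) k ≡ 0₃
look-0ᵀ zero    []       = refl
look-0ᵀ (suc n) (0ℙ ∷ k) = look-0ᵀ n k
look-0ᵀ (suc n) (1ℙ ∷ k) = look-0ᵀ n k

look-add : ∀ {n} (k : Vec Parity n) a t k′ → look (add k a t) k′ ≡ (a at (k ≟ⱽ k′)) +₃ look t k′
look-add []       a t       []        = refl
look-add (0ℙ ∷ k) a (l , r) (0ℙ ∷ k′) = look-add k a l k′
look-add (0ℙ ∷ k) a (l , r) (1ℙ ∷ k′) = sym (+₃-identityˡ (look r k′))
look-add (1ℙ ∷ k) a (l , r) (0ℙ ∷ k′) = sym (+₃-identityˡ (look l k′))
look-add (1ℙ ∷ k) a (l , r) (1ℙ ∷ k′) = look-add k a r k′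

key : Ex₃ → Vec Parity 5
key (ex (v₁ ∷ v₂ ∷ _ ∷ []) h _ _) = v₁ ∷ v₂ ∷ h

sign₃ : Sign → ℤ₃
sign₃ Sign.+ = 1₃
sign₃ Sign.- = -₃ 1₃

nf : ℤ₃[Ex₃] → Tree 5
nf []            = 0ᵀ 5
nf ((a , g) ∷ x) = add (key g) (a *₃ sign₃ (Ex₃.ε g)) (nf x)

at-* : ∀ {A : Set} a b (a? : Dec A) → (a *₃ b) at a? ≡ a *₃ (b at a?)
at-* a b (yes _) = refl
at-* a b (no  _) = sym (*₃-zeroʳ a)

look-nf : ∀ x k → look (nf x) k ≡ (x ⋄ λ g → sign₃ (Ex₃.ε g) at (key g ≟ⱽ k))
look-nf []            k = look-0ᵀ 5 k
look-nf ((a , g) ∷ x) k = trans (look-add (key g) (a *₃ sign₃ (Ex₃.ε g)) (nf x) k)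
  (cong₂ _+₃_ (at-* a (sign₃ (Ex₃.ε g)) (key g ≟ⱽ k)) (look-nf x k))

last-v : ∀ v₁ v₂ v₃ → .(total (v₁ ∷ v₂ ∷ v₃ ∷ []) ≡ 0ℙ) → v₃ ≡ v₁ ℙ.+ v₂
last-v v₁ v₂ v₃ p = go v₁ v₂ v₃ (Dec.recompute (total (v₁ ∷ v₂ ∷ v₃ ∷ []) ℙ.≟ 0ℙ) p)
  where
  go : ∀ v₁ v₂ v₃ → total (v₁ ∷ v₂ ∷ v₃ ∷ []) ≡ 0ℙ → v₃ ≡ v₁ ℙ.+ v₂
  go 0ℙ 0ℙ 0ℙ p = refl
  go 0ℙ 1ℙ 1ℙ p = refl
  go 1ℙ 0ℙ 1ℙ p = refl
  go 1ℙ 1ℙ 0ℙ p = refl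

key-injective : ∀ g g′ → Ex₃.ε g ≡ Ex₃.ε g′ → key g ≡ key g′ → g ≡ g′
key-injective (ex (v₁ ∷ v₂ ∷ v₃ ∷ []) h ε p) (ex (_ ∷ _ ∷ v₃′ ∷ []) _ _ p′) refl refl =
  ex-≡ (cong (λ v → v₁ ∷ v₂ ∷ v ∷ []) (trans (last-v v₁ v₂ v₃ p) (sym (last-v v₁ v₂ v₃′ p′)))) refl refl

key-neg : ∀ g → key (-ᴱ g) ≡ key g
key-neg (ex (v₁ ∷ v₂ ∷ _ ∷ []) h _ _) = refl

o-key : ∀ w g → o w g ≡ sign₃ (Ex₃.ε w) *₃ (sign₃ (Ex₃.ε g) at (key g ≟ⱽ key w))
o-key w g = trans (cong₂ (λ a b → a +₃ -₃ b) (δ-key w g) (trans (δ-key (-ᴱ w) g) (cong (λ k → same (Sign.opposite (Ex₃.ε w)) (Ex₃.ε g) at (key g ≟ⱽ k)) (key-neg w))))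
  (finish (Ex₃.ε w) (Ex₃.ε g) (key g ≟ⱽ key w))
  where
  same : Sign → Sign → ℤ₃
  same Sign.+ Sign.+ = 1₃
  same Sign.+ Sign.- = 0₃
  same Sign.- Sign.+ = 0₃
  same Sign.- Sign.- = 1₃
  0-at : ∀ {A : Set} (a? : Dec A) → 0₃ ≡ 0₃ at a?
  0-at (yes _) = refl
  0-at (no  _) = refl
  δ-eq : ∀ w g → Ex₃.ε g ≡ Ex₃.ε w → δ w g ≡ 1₃ at (key g ≟ⱽ key w)
  δ-eq w g eq = cong (if_then 1₃ else 0₃)
    (Dec.does-⇔ (mk⇔ (cong key) (key-injective g w eq)) (g ≟ᴱ w) (key g ≟ⱽ key w))
  δ-key : ∀ w g → δ w g ≡ same (Ex₃.ε w) (Ex₃.ε g) at (key g ≟ⱽ key w)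
  δ-key w@(ex _ _ Sign.+ _) g@(ex _ _ Sign.+ _) = δ-eq w g refl
  δ-key w@(ex _ _ Sign.+ _) g@(ex _ _ Sign.- _) = trans (δ-≢ {w} {g} λ ()) (0-at (key g ≟ⱽ key w))
  δ-key w@(ex _ _ Sign.- _) g@(ex _ _ Sign.+ _) = trans (δ-≢ {w} {g} λ ()) (0-at (key g ≟ⱽ key w))
  δ-key w@(ex _ _ Sign.- _) g@(ex _ _ Sign.- _) = δ-eq w g refl
  finish : ∀ {A : Set} s t (a? : Dec A) →
    (same s t at a?) +₃ -₃ (same (Sign.opposite s) t at a?) ≡ sign₃ s *₃ (sign₃ t at a?)
  finish Sign.+ Sign.+ (yes _) = refl
  finish Sign.+ Sign.- (yes _) = refl
  finish Sign.- Sign.+ (yes _) = refl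
  finish Sign.- Sign.- (yes _) = refl
  finish Sign.+ Sign.+ (no  _) = refl
  finish Sign.+ Sign.- (no  _) = refl
  finish Sign.- Sign.+ (no  _) = refl
  finish Sign.- Sign.- (no  _) = refl

⋄-o : ∀ x w → (x ⋄ o w) ≡ sign₃ (Ex₃.ε w) *₃ look (nf x) (key w)
⋄-o x w = trans (⋄-cong x (o-key w)) (trans (⋄-* x (sign₃ (Ex₃.ε w)) _) (cong (sign₃ (Ex₃.ε w) *₃_) (sym (look-nf x (key w)))))

nf⇒∼ : ∀ x y → nf x ≡ nf y → x ∼ y
nf⇒∼ x y eq w = trans (⋄-o x w) (trans (cong (λ t → sign₃ (Ex₃.ε w) *₃ look t (key w)) eq) (sym (⋄-o y w)))

∼⇒nf : ∀ x y → x ∼ y → nf x ≡ nf y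
∼⇒nf x y x∼y = look-ext 5 eq
  where
  eq : ∀ k → look (nf x) k ≡ look (nf y) k
  eq k@(v₁ ∷ v₂ ∷ h) = trans (sym (*₃-identityˡ (look (nf x) k)))
    (trans (trans (sym (⋄-o x w)) (trans (x∼y w) (⋄-o y w))) (*₃-identityˡ (look (nf y) k)))
    where
    lemma : ∀ a b → a ℙ.+ (b ℙ.+ (a ℙ.+ b ℙ.+ 0ℙ)) ≡ 0ℙ
    lemma 0ℙ 0ℙ = refl
    lemma 0ℙ 1ℙ = refl
    lemma 1ℙ 0ℙ = refl
    lemma 1ℙ 1ℙ = refl
    w : Ex₃
    w = ex (v₁ ∷ v₂ ∷ v₁ ℙ.+ v₂ ∷ []) h Sign.+ (lemma v₁ v₂)

-- The elements of the form [D], with equality that of the quotient by J₃.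
record ∣G₃∣ : Set where
  field
    element   : ℤ₃[Ex₃]
    diagram   : 𝒟₃
    isBracket : ⟪ diagram ⟫ ≈ element
open ∣G₃∣

[_]ᴳ : 𝒟₃ → ∣G₃∣
[ D ]ᴳ = record { element = ⟪ D ⟫ ; diagram = D ; isBracket = ∼⇒≈ {⟪ D ⟫} {⟪ D ⟫} (∼-refl {⟪ D ⟫}) }

-- The elements ±(v,0,ε) + J₃.
N : Pred ∣G₃∣ 0ℓ
N x = Σ Sign λ s → Σ (Vec Parity 3) λ v → Σ Sign λ ε → Σ (total v ≡ 0ℙ) λ p →
  element x ≈ [ (sign₃ s , ex v 𝟎 ε p) ]

γ : Subset 3 → ℤ₃[Ex₃]
γ ∅     = ⟦ 1ᴱ ⟧
γ ⁅1⁆   = ⟦ ex 𝟎 (1ℙ ∷ 0ℙ ∷ 0ℙ ∷ []) Sign.+ refl ⟧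
γ ⁅2⁆   = ⟦ ex 𝟎 (0ℙ ∷ 1ℙ ∷ 0ℙ ∷ []) Sign.+ refl ⟧
γ ⁅3⁆   = ⟦ ex 𝟎 (0ℙ ∷ 0ℙ ∷ 1ℙ ∷ []) Sign.+ refl ⟧
γ ⁅12⁆  = ⟦ ex 𝟎 (1ℙ ∷ 1ℙ ∷ 0ℙ ∷ []) Sign.+ refl ⟧ ⊞ ⟦ ex (1ℙ ∷ 1ℙ ∷ 0ℙ ∷ []) 𝟎 Sign.+ refl ⟧
γ ⁅13⁆  = ⟦ ex 𝟎 (1ℙ ∷ 0ℙ ∷ 1ℙ ∷ []) Sign.+ refl ⟧ ⊞ ⟦ ex (1ℙ ∷ 0ℙ ∷ 1ℙ ∷ []) 𝟎 Sign.+ refl ⟧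
γ ⁅23⁆  = ⟦ ex 𝟎 (0ℙ ∷ 1ℙ ∷ 1ℙ ∷ []) Sign.+ refl ⟧ ⊞ ⟦ ex (0ℙ ∷ 1ℙ ∷ 1ℙ ∷ []) 𝟎 Sign.+ refl ⟧
γ ⁅123⁆ = ⟦ ex 𝟎 (1ℙ ∷ 1ℙ ∷ 1ℙ ∷ []) Sign.+ refl ⟧
  ⊞ ⟦ ex (0ℙ ∷ 1ℙ ∷ 1ℙ ∷ []) (1ℙ ∷ 0ℙ ∷ 0ℙ ∷ []) Sign.+ refl ⟧
  ⊞ ⟦ ex (1ℙ ∷ 0ℙ ∷ 1ℙ ∷ []) (0ℙ ∷ 1ℙ ∷ 0ℙ ∷ []) Sign.- refl ⟧
  ⊞ ⟦ ex (1ℙ ∷ 1ℙ ∷ 0ℙ ∷ []) (0ℙ ∷ 0ℙ ∷ 1ℙ ∷ []) Sign.+ refl ⟧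

γ-correct : ∀ S → ⟪ C S ⟫ ≡ γ S
γ-correct ∅     = refl
γ-correct ⁅1⁆   = refl
γ-correct ⁅2⁆   = refl
γ-correct ⁅3⁆   = refl
γ-correct ⁅12⁆  = refl
γ-correct ⁅13⁆  = refl
γ-correct ⁅23⁆  = refl
γ-correct ⁅123⁆ = refl

eval : 𝒟₃ → ℤ₃[Ex₃]
eval []      = ⟦ 1ᴱ ⟧
eval (S ∷ D) = γ S ⊠ eval D

eval-correct : ∀ D → ⟪ D ⟫ ≡ eval D
eval-correct []      = refl
eval-correct (S ∷ D) = trans (⟪⟫-∷ S D) (cong₂ _⊠_ (γ-correct S) (eval-correct D))

Code : Set
Code = Vec (Fin 4) 4 × Sign

code : 𝔾.Carrier → Code
code (σ , s) = Vec.tabulate (σ ⟨$⟩ʳ_) , s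

act : Subset 3 → Code → Code
act S (v , s) = Vec.map (proj₁ ψ[C S ] ⟨$⟩ʳ_) v , proj₂ ψ[C S ] Sign.* s

codeΨ : 𝒟₃ → Code
codeΨ []      = code 𝔾.ε
codeΨ (S ∷ D) = act S (codeΨ D)

codeΨ-correct : ∀ D → code (Ψ D) ≡ codeΨ D
codeΨ-correct []      = refl
codeΨ-correct (S ∷ D) = trans
  (cong (_, proj₂ ψ[C S ] Sign.* proj₂ (Ψ D)) (Vec.tabulate-∘ (proj₁ ψ[C S ] ⟨$⟩ʳ_) (proj₁ (Ψ D) ⟨$⟩ʳ_)))
  (cong (act S) (codeΨ-correct D))

_≟ᶜ_ : DecidableEquality Code
_≟ᶜ_ = Product.≡-dec (Vec.≡-dec Fin._≟_) Sign._≟_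

-- One diagram in each coset of N.
words : List 𝒟₃
words = cartesianProductWith _++_ ([] ∷ (⁅1⁆ ∷ ⁅2⁆ ∷ ⁅3⁆ ∷ []) ∷ [])
  (cartesianProductWith _++_ ([] ∷ C ⁅1⁆ ∷ C ⁅2⁆ ∷ C ⁅3⁆ ∷ [])
    ([] ∷ C ⁅12⁆ ∷ C ⁅13⁆ ∷ C ⁅23⁆ ∷ (⁅12⁆ ∷ ⁅13⁆ ∷ []) ∷ (⁅13⁆ ∷ ⁅12⁆ ∷ []) ∷ []))

data IsV : Ex₃ → Set where
  isV : ∀ v ε .p → IsV (ex v 𝟎 ε p)

vs : List Ex₃
vs = cartesianProductWith (λ v ε → v ε)
  ((λ ε → ex 𝟎 𝟎 ε refl) ∷ (λ ε → ex (1ℙ ∷ 1ℙ ∷ 0ℙ ∷ []) 𝟎 ε refl)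
    ∷ (λ ε → ex (1ℙ ∷ 0ℙ ∷ 1ℙ ∷ []) 𝟎 ε refl) ∷ (λ ε → ex (0ℙ ∷ 1ℙ ∷ 1ℙ ∷ []) 𝟎 ε refl) ∷ [])
  (Sign.+ ∷ Sign.- ∷ [])

abstract
  check₁ : All (λ S → All (λ D → Any (λ D′ → act S (codeΨ D) ≡ codeΨ D′ × Any (λ g →
    nf (γ S ⊠ eval D) ≡ nf (eval D′ ⊠ ⟦ g ⟧)) vs) words) words) (allSubsets 3)
  check₁ = Dec.from-yes (All.all? (λ S → All.all? (λ D → Any.any? (λ D′ →
    act S (codeΨ D) ≟ᶜ codeΨ D′ ×-dec Any.any? (λ g → nf (γ S ⊠ eval D) ≟ᵀ nf (eval D′ ⊠ ⟦ g ⟧)) vs) words) words) (allSubsets 3))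

  check₂ : All (λ D → All (λ D′ → codeΨ D ≡ codeΨ D′ → D ≡ D′) words) words
  check₂ = Dec.from-yes (All.all? (λ D → All.all? (λ D′ →
    (codeΨ D ≟ᶜ codeΨ D′) →-dec (List.≡-dec (Vec.≡-dec Bool._≟_) D D′)) words) words)

  check₃ : All (λ D → All (λ g → nf (eval D) ≡ nf ⟦ g ⟧ → codeΨ D ≡ code 𝔾.ε) vs) words
  check₃ = Dec.from-yes (All.all? (λ D → All.all? (λ g →
    (nf (eval D) ≟ᵀ nf ⟦ g ⟧) →-dec (codeΨ D ≟ᶜ code 𝔾.ε)) vs) words)

  check₄ : ∀ a b c d s → (a ≢ b × a ≢ c × a ≢ d × b ≢ c × b ≢ d × c ≢ d) →
    Any (λ D → codeΨ D ≡ (a ∷ b ∷ c ∷ d ∷ [] , s)) words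
  check₄ a b c d Sign.+ = Dec.from-yes (Fin.all? λ a → Fin.all? λ b → Fin.all? λ c → Fin.all? λ d →
    (¬? (a Fin.≟ b) ×-dec ¬? (a Fin.≟ c) ×-dec ¬? (a Fin.≟ d) ×-dec ¬? (b Fin.≟ c) ×-dec ¬? (b Fin.≟ d) ×-dec ¬? (c Fin.≟ d))
    →-dec Any.any? (λ D → codeΨ D ≟ᶜ (a ∷ b ∷ c ∷ d ∷ [] , Sign.+)) words) a b c d
  check₄ a b c d Sign.- = Dec.from-yes (Fin.all? λ a → Fin.all? λ b → Fin.all? λ c → Fin.all? λ d →
    (¬? (a Fin.≟ b) ×-dec ¬? (a Fin.≟ c) ×-dec ¬? (a Fin.≟ d) ×-dec ¬? (b Fin.≟ c) ×-dec ¬? (b Fin.≟ d) ×-dec ¬? (c Fin.≟ d))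
    →-dec Any.any? (λ D → codeΨ D ≟ᶜ (a ∷ b ∷ c ∷ d ∷ [] , Sign.-)) words) a b c d

vWord : Parity → Parity → Sign → 𝒟₃
vWord 0ℙ 0ℙ Sign.+ = []
vWord 0ℙ 0ℙ Sign.- = ⁅1⁆ ∷ ⁅12⁆ ∷ ⁅1⁆ ∷ ⁅12⁆ ∷ []
vWord 1ℙ 1ℙ Sign.+ = ⁅1⁆ ∷ ⁅12⁆ ∷ ⁅12⁆ ∷ ⁅2⁆ ∷ []
vWord 1ℙ 1ℙ Sign.- = ⁅1⁆ ∷ ⁅2⁆ ∷ ⁅12⁆ ∷ ⁅12⁆ ∷ []
vWord 1ℙ 0ℙ Sign.+ = ⁅1⁆ ∷ ⁅13⁆ ∷ ⁅13⁆ ∷ ⁅3⁆ ∷ []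
vWord 1ℙ 0ℙ Sign.- = ⁅1⁆ ∷ ⁅3⁆ ∷ ⁅13⁆ ∷ ⁅13⁆ ∷ []
vWord 0ℙ 1ℙ Sign.+ = ⁅2⁆ ∷ ⁅23⁆ ∷ ⁅23⁆ ∷ ⁅3⁆ ∷ []
vWord 0ℙ 1ℙ Sign.- = ⁅2⁆ ∷ ⁅3⁆ ∷ ⁅23⁆ ∷ ⁅23⁆ ∷ []

vElement : Parity → Parity → Sign → Ex₃
vElement a b ε = ex (a ∷ b ∷ a ℙ.+ b ∷ []) 𝟎 ε (lemma a b)
  where
  lemma : ∀ a b → a ℙ.+ (b ℙ.+ (a ℙ.+ b ℙ.+ 0ℙ)) ≡ 0ℙ
  lemma 0ℙ 0ℙ = refl
  lemma 0ℙ 1ℙ = refl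
  lemma 1ℙ 0ℙ = refl
  lemma 1ℙ 1ℙ = refl

vWord-correct : ∀ a b ε → nf (eval (vWord a b ε)) ≡ nf ⟦ vElement a b ε ⟧
vWord-correct 0ℙ 0ℙ Sign.+ = refl
vWord-correct 0ℙ 0ℙ Sign.- = refl
vWord-correct 1ℙ 1ℙ Sign.+ = refl
vWord-correct 1ℙ 1ℙ Sign.- = refl
vWord-correct 1ℙ 0ℙ Sign.+ = refl
vWord-correct 1ℙ 0ℙ Sign.- = refl
vWord-correct 0ℙ 1ℙ Sign.+ = refl
vWord-correct 0ℙ 1ℙ Sign.- = refl

vElement∈vs : ∀ a b ε → vElement a b ε ∈ᴸ vs
vElement∈vs 0ℙ 0ℙ Sign.+ = here refl
vElement∈vs 0ℙ 0ℙ Sign.- = there (here refl)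
vElement∈vs 1ℙ 1ℙ Sign.+ = there (there (here refl))
vElement∈vs 1ℙ 1ℙ Sign.- = there (there (there (here refl)))
vElement∈vs 1ℙ 0ℙ Sign.+ = there (there (there (there (here refl))))
vElement∈vs 1ℙ 0ℙ Sign.- = there (there (there (there (there (here refl)))))
vElement∈vs 0ℙ 1ℙ Sign.+ = there (there (there (there (there (there (here refl))))))
vElement∈vs 0ℙ 1ℙ Sign.- = there (there (there (there (there (there (there (here refl)))))))

vElement-≡ : ∀ a b c ε .p → ex (a ∷ b ∷ c ∷ []) 𝟎 ε p ≡ vElement a b ε
vElement-≡ a b c ε p = ex-≡ (cong (λ c → a ∷ b ∷ c ∷ []) (last-v a b c p)) refl refl

IsV⇒∈ : ∀ {g} → IsV g → g ∈ᴸ vs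
IsV⇒∈ (isV (a ∷ b ∷ c ∷ []) ε p) = subst (_∈ᴸ vs) (sym (vElement-≡ a b c ε p)) (vElement∈vs a b ε)

all-vs : All IsV vs
all-vs = isV _ _ _ ∷ isV _ _ _ ∷ isV _ _ _ ∷ isV _ _ _ ∷ isV _ _ _ ∷ isV _ _ _ ∷ isV _ _ _ ∷ isV _ _ _ ∷ []

IsV-· : ∀ {g h} → IsV g → IsV h → IsV (g · h)
IsV-· (isV v ε p) (isV v′ ε′ p′) = isV (v ⊕ v′) _ _

IsV-⁻¹ : ∀ {g} → IsV g → IsV (g ⁻¹ᴱ)
IsV-⁻¹ (isV v ε p) = isV v _ _

IsV-word : ∀ {g} → IsV g → ∃[ D ] ⟪ D ⟫ ∼ ⟦ g ⟧
IsV-word (isV (a ∷ b ∷ c ∷ []) ε p) = vWord a b ε , λ w → trans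
  (cong (_⋄ o w) (eval-correct (vWord a b ε)))
  (trans (nf⇒∼ (eval (vWord a b ε)) ⟦ vElement a b ε ⟧ (vWord-correct a b ε) w)
    (cong (λ g → ⟦ g ⟧ ⋄ o w) (sym (vElement-≡ a b c ε p))))

inverseColumn : Subset 3 → 𝒟₃
inverseColumn ∅     = []
inverseColumn ⁅1⁆   = C ⁅1⁆
inverseColumn ⁅2⁆   = C ⁅2⁆
inverseColumn ⁅3⁆   = C ⁅3⁆
inverseColumn ⁅12⁆  = ⁅1⁆ ∷ ⁅2⁆ ∷ ⁅23⁆ ∷ ⁅12⁆ ∷ ⁅13⁆ ∷ []
inverseColumn ⁅13⁆  = ⁅1⁆ ∷ ⁅2⁆ ∷ ⁅12⁆ ∷ ⁅23⁆ ∷ ⁅12⁆ ∷ []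
inverseColumn ⁅23⁆  = ⁅1⁆ ∷ ⁅2⁆ ∷ ⁅123⁆ ∷ ⁅1⁆ ∷ ⁅12⁆ ∷ []
inverseColumn ⁅123⁆ = ⁅1⁆ ∷ ⁅2⁆ ∷ ⁅3⁆ ∷ ⁅123⁆ ∷ ⁅123⁆ ∷ []

inverse : 𝒟₃ → 𝒟₃
inverse []      = []
inverse (S ∷ D) = inverse D ⋆ inverseColumn S

inverseColumnˡ : ∀ S → nf (eval (inverseColumn S) ⊠ γ S) ≡ nf ⟦ 1ᴱ ⟧
inverseColumnˡ ∅     = refl
inverseColumnˡ ⁅1⁆   = refl
inverseColumnˡ ⁅2⁆   = refl
inverseColumnˡ ⁅3⁆   = refl
inverseColumnˡ ⁅12⁆  = refl
inverseColumnˡ ⁅13⁆  = refl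
inverseColumnˡ ⁅23⁆  = refl
inverseColumnˡ ⁅123⁆ = refl

inverseColumnʳ : ∀ S → nf (γ S ⊠ eval (inverseColumn S)) ≡ nf ⟦ 1ᴱ ⟧
inverseColumnʳ ∅     = refl
inverseColumnʳ ⁅1⁆   = refl
inverseColumnʳ ⁅2⁆   = refl
inverseColumnʳ ⁅3⁆   = refl
inverseColumnʳ ⁅12⁆  = refl
inverseColumnʳ ⁅13⁆  = refl
inverseColumnʳ ⁅23⁆  = refl
inverseColumnʳ ⁅123⁆ = refl

inverseColumn-Ψ : ∀ S → codeΨ (inverseColumn S ⋆ C S) ≡ code 𝔾.ε
inverseColumn-Ψ ∅     = refl
inverseColumn-Ψ ⁅1⁆   = refl
inverseColumn-Ψ ⁅2⁆   = refl
inverseColumn-Ψ ⁅3⁆   = refl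
inverseColumn-Ψ ⁅12⁆  = refl
inverseColumn-Ψ ⁅13⁆  = refl
inverseColumn-Ψ ⁅23⁆  = refl
inverseColumn-Ψ ⁅123⁆ = refl

infix 4 _≃_
record _≃_ (x y : ℤ₃[Ex₃]) : Set where
  constructor mk≃
  field un≃ : x ∼ y
open _≃_

≃-setoid : Setoid 0ℓ 0ℓ
≃-setoid = record
  { Carrier = ℤ₃[Ex₃]
  ; _≈_     = _≃_
  ; isEquivalence = record
    { refl  = mk≃ λ w → refl
    ; sym   = λ p → mk≃ λ w → sym (un≃ p w)
    ; trans = λ p q → mk≃ λ w → trans (un≃ p w) (un≃ q w)
    }
  }
module ≃ = Setoid ≃-setoid
module ≃-Reasoning = SetoidReasoning ≃-setoid

≈⇒≃ : ∀ {x y} → x ≈ y → x ≃ y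
≈⇒≃ {x} {y} p = mk≃ (≈⇒∼ {x} {y} p)

≃⇒≈ : ∀ {x y} → x ≃ y → x ≈ y
≃⇒≈ {x} {y} p = ∼⇒≈ {x} {y} (un≃ p)

nf⇒≃ : ∀ x y → nf x ≡ nf y → x ≃ y
nf⇒≃ x y eq = mk≃ (nf⇒∼ x y eq)

cong-⊠ : ∀ {x x′ y y′} → x ≃ x′ → y ≃ y′ → x ⊠ y ≃ x′ ⊠ y′
cong-⊠ {x} {x′} {y} {y′} p q = mk≃ (⊠-cong {x} {x′} {y} {y′} (un≃ p) (un≃ q))

congˡ-⊠ : ∀ x {y y′} → y ≃ y′ → x ⊠ y ≃ x ⊠ y′
congˡ-⊠ x p = cong-⊠ (≃.refl {x}) p

congʳ-⊠ : ∀ {x x′} y → x ≃ x′ → x ⊠ y ≃ x′ ⊠ y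
congʳ-⊠ y p = cong-⊠ p (≃.refl {y})

assoc-⊠ : ∀ x y z → (x ⊠ y) ⊠ z ≃ x ⊠ (y ⊠ z)
assoc-⊠ x y z = mk≃ (⊠-assoc x y z)

identityˡ-⊠ : ∀ x → ⟦ 1ᴱ ⟧ ⊠ x ≃ x
identityˡ-⊠ x = mk≃ (⊠-identityˡ x)

identityʳ-⊠ : ∀ x → x ⊠ ⟦ 1ᴱ ⟧ ≃ x
identityʳ-⊠ x = mk≃ (⊠-identityʳ x)

⟪⟫-homo : ∀ D E → ⟪ D ⋆ E ⟫ ≃ ⟪ D ⟫ ⊠ ⟪ E ⟫
⟪⟫-homo D E = mk≃ (⟪⟫-⋆ D E)

cancelˡ : ∀ x y z → x ⊠ y ≃ ⟦ 1ᴱ ⟧ → x ⊠ (y ⊠ z) ≃ z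
cancelˡ x y z p = ≃.trans (≃.sym (assoc-⊠ x y z)) (≃.trans (congʳ-⊠ z p) (identityˡ-⊠ z))

cancelʳ : ∀ x g → x ⊠ ⟦ g ⟧ ⊠ ⟦ g ⁻¹ᴱ ⟧ ≃ x
cancelʳ x g = begin
  x ⊠ ⟦ g ⟧ ⊠ ⟦ g ⁻¹ᴱ ⟧   ≈⟨ assoc-⊠ x ⟦ g ⟧ ⟦ g ⁻¹ᴱ ⟧ ⟩
  x ⊠ ⟦ g · g ⁻¹ᴱ ⟧       ≡⟨ cong (λ k → x ⊠ ⟦ k ⟧) (·-inverseʳ g) ⟩
  x ⊠ ⟦ 1ᴱ ⟧              ≈⟨ identityʳ-⊠ x ⟩
  x                       ∎
  where open ≃-Reasoning

sandwich : ∀ x x′ y y′ → x ⊠ x′ ≃ ⟦ 1ᴱ ⟧ → y ⊠ y′ ≃ ⟦ 1ᴱ ⟧ → (x ⊠ y) ⊠ (y′ ⊠ x′) ≃ ⟦ 1ᴱ ⟧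
sandwich x x′ y y′ p q = ≃.trans (assoc-⊠ x y (y′ ⊠ x′)) (≃.trans (congˡ-⊠ x (cancelˡ y y′ x′ q)) p)

column-inverseˡ : ∀ S → ⟪ inverseColumn S ⟫ ⊠ ⟪ C S ⟫ ≃ ⟦ 1ᴱ ⟧
column-inverseˡ S = subst₂ (λ x y → x ⊠ y ≃ ⟦ 1ᴱ ⟧) (sym (eval-correct (inverseColumn S))) (sym (γ-correct S))
  (nf⇒≃ (eval (inverseColumn S) ⊠ γ S) ⟦ 1ᴱ ⟧ (inverseColumnˡ S))

column-inverseʳ : ∀ S → ⟪ C S ⟫ ⊠ ⟪ inverseColumn S ⟫ ≃ ⟦ 1ᴱ ⟧
column-inverseʳ S = subst₂ (λ x y → x ⊠ y ≃ ⟦ 1ᴱ ⟧) (sym (γ-correct S)) (sym (eval-correct (inverseColumn S)))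
  (nf⇒≃ (γ S ⊠ eval (inverseColumn S)) ⟦ 1ᴱ ⟧ (inverseColumnʳ S))

inverseˡ : ∀ D → ⟪ inverse D ⟫ ⊠ ⟪ D ⟫ ≃ ⟦ 1ᴱ ⟧
inverseˡ []      = identityˡ-⊠ ⟦ 1ᴱ ⟧
inverseˡ (S ∷ D) = ≃.trans
  (cong-⊠ (⟪⟫-homo (inverse D) (inverseColumn S)) (⟪⟫-homo (C S) D))
  (sandwich ⟪ inverse D ⟫ ⟪ D ⟫ ⟪ inverseColumn S ⟫ ⟪ C S ⟫ (inverseˡ D) (column-inverseˡ S))

inverseʳ : ∀ D → ⟪ D ⟫ ⊠ ⟪ inverse D ⟫ ≃ ⟦ 1ᴱ ⟧
inverseʳ []      = identityˡ-⊠ ⟦ 1ᴱ ⟧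
inverseʳ (S ∷ D) = ≃.trans
  (cong-⊠ (⟪⟫-homo (C S) D) (⟪⟫-homo (inverse D) (inverseColumn S)))
  (sandwich ⟪ C S ⟫ ⟪ inverseColumn S ⟫ ⟪ D ⟫ ⟪ inverse D ⟫ (column-inverseʳ S) (inverseʳ D))

code-≈ : ∀ g h → code g ≡ code h → g 𝔾.≈ h
code-≈ (σ , s) (τ , t) eq = (λ i → begin
    σ ⟨$⟩ʳ i                             ≡⟨ Vec.lookup∘tabulate (σ ⟨$⟩ʳ_) i ⟨
    Vec.lookup (Vec.tabulate (σ ⟨$⟩ʳ_)) i ≡⟨ cong (λ c → Vec.lookup (proj₁ c) i) eq ⟩
    Vec.lookup (Vec.tabulate (τ ⟨$⟩ʳ_)) i ≡⟨ Vec.lookup∘tabulate (τ ⟨$⟩ʳ_) i ⟩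
    τ ⟨$⟩ʳ i                             ∎) , cong proj₂ eq
  where open ≡-Reasoning

≈-code : ∀ g h → g 𝔾.≈ h → code g ≡ code h
≈-code g h (p , q) = cong₂ _,_ (Vec.tabulate-cong p) q

codeΨ-≈ : ∀ D g → codeΨ D ≡ code g → Ψ D 𝔾.≈ g
codeΨ-≈ D g eq = code-≈ (Ψ D) g (trans (codeΨ-correct D) eq)

inverse-Ψ : ∀ D → Ψ (inverse D) 𝔾.∙ Ψ D 𝔾.≈ 𝔾.ε
inverse-Ψ []      = 𝔾.identityˡ 𝔾.ε
inverse-Ψ (S ∷ D) = begin
  Ψ (inverse D ⋆ inverseColumn S) 𝔾.∙ (ψ[C S ] 𝔾.∙ Ψ D)       ≈⟨ 𝔾.∙-congʳ {ψ[C S ] 𝔾.∙ Ψ D} {Ψ (inverse D ⋆ inverseColumn S)} {Ψ (inverse D) 𝔾.∙ i} (Ψ-⋆ (inverse D) (inverseColumn S)) ⟩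
  (Ψ (inverse D) 𝔾.∙ i) 𝔾.∙ (ψ[C S ] 𝔾.∙ Ψ D)                 ≈⟨ 𝔾.assoc (Ψ (inverse D)) i (ψ[C S ] 𝔾.∙ Ψ D) ⟩
  Ψ (inverse D) 𝔾.∙ (i 𝔾.∙ (ψ[C S ] 𝔾.∙ Ψ D))                 ≈⟨ 𝔾.∙-congˡ {Ψ (inverse D)} {i 𝔾.∙ (ψ[C S ] 𝔾.∙ Ψ D)} {Ψ D} cancel ⟩
  Ψ (inverse D) 𝔾.∙ Ψ D                                        ≈⟨ inverse-Ψ D ⟩
  𝔾.ε                                                          ∎
  where
  open SetoidReasoning 𝔾.setoid
  i = Ψ (inverseColumn S)
  column-ε : i 𝔾.∙ ψ[C S ] 𝔾.≈ 𝔾.ε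
  column-ε = begin
    i 𝔾.∙ ψ[C S ]                  ≈⟨ 𝔾.∙-congˡ {i} {ψ[C S ] 𝔾.∙ 𝔾.ε} {ψ[C S ]} (𝔾.identityʳ ψ[C S ]) ⟨
    i 𝔾.∙ Ψ (C S)                  ≈⟨ Ψ-⋆ (inverseColumn S) (C S) ⟨
    Ψ (inverseColumn S ⋆ C S)      ≈⟨ codeΨ-≈ (inverseColumn S ⋆ C S) 𝔾.ε (inverseColumn-Ψ S) ⟩
    𝔾.ε                            ∎
  cancel : i 𝔾.∙ (ψ[C S ] 𝔾.∙ Ψ D) 𝔾.≈ Ψ D
  cancel = begin
    i 𝔾.∙ (ψ[C S ] 𝔾.∙ Ψ D)        ≈⟨ 𝔾.assoc i ψ[C S ] (Ψ D) ⟨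
    (i 𝔾.∙ ψ[C S ]) 𝔾.∙ Ψ D        ≈⟨ 𝔾.∙-congʳ {Ψ D} {i 𝔾.∙ ψ[C S ]} {𝔾.ε} column-ε ⟩
    𝔾.ε 𝔾.∙ Ψ D                    ≈⟨ 𝔾.identityˡ (Ψ D) ⟩
    Ψ D                            ∎

∈-allSubsets : ∀ S → S ∈ᴸ allSubsets 3
∈-allSubsets ∅     = here refl
∈-allSubsets ⁅3⁆   = there (here refl)
∈-allSubsets ⁅2⁆   = there (there (here refl))
∈-allSubsets ⁅23⁆  = there (there (there (here refl)))
∈-allSubsets ⁅1⁆   = there (there (there (there (here refl))))
∈-allSubsets ⁅13⁆  = there (there (there (there (there (here refl)))))
∈-allSubsets ⁅12⁆  = there (there (there (there (there (there (here refl))))))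
∈-allSubsets ⁅123⁆ = there (there (there (there (there (there (there (here refl)))))))

step : ∀ S D → D ∈ᴸ words → ∃[ D′ ] D′ ∈ᴸ words × act S (codeΨ D) ≡ codeΨ D′ ×
  ∃[ g ] IsV g × nf (γ S ⊠ eval D) ≡ nf (eval D′ ⊠ ⟦ g ⟧)
step S D D∈ =
  let (D′ , D′∈ , same , any) = find (All.lookup (All.lookup check₁ (∈-allSubsets S)) D∈)
      (g , g∈ , eq) = find any
  in D′ , D′∈ , same , g , All.lookup all-vs g∈ , eq

record NormalForm (D : 𝒟₃) : Set where
  field
    word   : 𝒟₃
    ∈words : word ∈ᴸ words
    same-Ψ : codeΨ D ≡ codeΨ word
    v      : Ex₃
    v-isV  : IsV v
    equal  : ⟪ D ⟫ ≃ ⟪ word ⟫ ⊠ ⟦ v ⟧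

normalForm : ∀ D → NormalForm D
normalForm [] = record
  { word = [] ; ∈words = here refl ; same-Ψ = refl ; v = 1ᴱ ; v-isV = isV 𝟎 Sign.+ refl ; equal = ≃.sym (identityʳ-⊠ ⟦ 1ᴱ ⟧) }
normalForm (S ∷ D) = extend (normalForm D)
  where
  open ≃-Reasoning
  extend : NormalForm D → NormalForm (S ∷ D)
  extend record { word = W ; ∈words = W∈ ; same-Ψ = same ; v = v ; v-isV = v-isV ; equal = equal } =
    finish (step S W W∈)
    where
    finish : (∃[ D′ ] D′ ∈ᴸ words × act S (codeΨ W) ≡ codeΨ D′ ×
      ∃[ g ] IsV g × nf (γ S ⊠ eval W) ≡ nf (eval D′ ⊠ ⟦ g ⟧)) → NormalForm (S ∷ D)
    finish (W′ , W′∈ , same′ , v′ , v′-isV , eq) = record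
      { word = W′ ; ∈words = W′∈ ; same-Ψ = trans (cong (act S) same) same′
      ; v = v′ · v ; v-isV = IsV-· v′-isV v-isV
      ; equal = begin
          ⟪ S ∷ D ⟫                     ≈⟨ ⟪⟫-homo (C S) D ⟩
          ⟪ C S ⟫ ⊠ ⟪ D ⟫               ≈⟨ congˡ-⊠ ⟪ C S ⟫ equal ⟩
          ⟪ C S ⟫ ⊠ (⟪ W ⟫ ⊠ ⟦ v ⟧)     ≈⟨ assoc-⊠ ⟪ C S ⟫ ⟪ W ⟫ ⟦ v ⟧ ⟨
          ⟪ C S ⟫ ⊠ ⟪ W ⟫ ⊠ ⟦ v ⟧       ≡⟨ cong₂ (λ x y → x ⊠ y ⊠ ⟦ v ⟧) (γ-correct S) (eval-correct W) ⟩
          γ S ⊠ eval W ⊠ ⟦ v ⟧          ≈⟨ congʳ-⊠ ⟦ v ⟧ (nf⇒≃ (γ S ⊠ eval W) (eval W′ ⊠ ⟦ v′ ⟧) eq) ⟩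
          eval W′ ⊠ ⟦ v′ ⟧ ⊠ ⟦ v ⟧      ≡⟨ cong (λ x → x ⊠ ⟦ v′ ⟧ ⊠ ⟦ v ⟧) (eval-correct W′) ⟨
          ⟪ W′ ⟫ ⊠ ⟦ v′ ⟧ ⊠ ⟦ v ⟧       ≈⟨ assoc-⊠ ⟪ W′ ⟫ ⟦ v′ ⟧ ⟦ v ⟧ ⟩
          ⟪ W′ ⟫ ⊠ ⟦ v′ · v ⟧           ∎
      }

Ψ-trivial : ∀ D {g} → IsV g → ⟪ D ⟫ ≃ ⟦ g ⟧ → Ψ D 𝔾.≈ 𝔾.ε
Ψ-trivial D {g} g-isV D≃g = codeΨ-≈ D 𝔾.ε (trans same-Ψ
  (All.lookup (All.lookup check₃ ∈words) (IsV⇒∈ (IsV-· g-isV (IsV-⁻¹ v-isV))) (∼⇒nf (eval word) ⟦ g · v ⁻¹ᴱ ⟧ (un≃ word≃))))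
  where
  open NormalForm (normalForm D)
  open ≃-Reasoning
  word≃ : eval word ≃ ⟦ g · v ⁻¹ᴱ ⟧
  word≃ = begin
    eval word                       ≡⟨ eval-correct word ⟨
    ⟪ word ⟫                        ≈⟨ cancelʳ ⟪ word ⟫ v ⟨
    ⟪ word ⟫ ⊠ ⟦ v ⟧ ⊠ ⟦ v ⁻¹ᴱ ⟧    ≈⟨ congʳ-⊠ ⟦ v ⁻¹ᴱ ⟧ equal ⟨
    ⟪ D ⟫ ⊠ ⟦ v ⁻¹ᴱ ⟧               ≈⟨ congʳ-⊠ ⟦ v ⁻¹ᴱ ⟧ D≃g ⟩
    ⟦ g ⟧ ⊠ ⟦ v ⁻¹ᴱ ⟧               ∎

Ψ-cong : ∀ D E {g} → IsV g → ⟪ D ⟫ ≃ ⟪ E ⟫ ⊠ ⟦ g ⟧ → Ψ D 𝔾.≈ Ψ E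
Ψ-cong D E {g} g-isV D≃Eg = ∙-cancelˡ (Ψ (inverse E)) (Ψ D) (Ψ E) (begin
  Ψ (inverse E) 𝔾.∙ Ψ D   ≈⟨ Ψ-⋆ (inverse E) D ⟨
  Ψ (inverse E ⋆ D)       ≈⟨ Ψ-trivial (inverse E ⋆ D) g-isV (≃.trans (⟪⟫-homo (inverse E) D)
                               (≃.trans (congˡ-⊠ ⟪ inverse E ⟫ D≃Eg) (cancelˡ ⟪ inverse E ⟫ ⟪ E ⟫ ⟦ g ⟧ (inverseˡ E)))) ⟩
  𝔾.ε                     ≈⟨ inverse-Ψ E ⟨
  Ψ (inverse E) 𝔾.∙ Ψ E   ∎)
  where
  open SetoidReasoning 𝔾.setoid
  open GroupProperties S₄×±1 using (∙-cancelˡ)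

Ψ-injective : ∀ D E → Ψ D 𝔾.≈ Ψ E → ∃[ g ] IsV g × ⟪ D ⟫ ≃ ⟪ E ⟫ ⊠ ⟦ g ⟧
Ψ-injective D E ΨD≈ΨE = e.v ⁻¹ᴱ · d.v , IsV-· (IsV-⁻¹ e.v-isV) d.v-isV , (begin
  ⟪ D ⟫                                        ≈⟨ d.equal ⟩
  ⟪ d.word ⟫ ⊠ ⟦ d.v ⟧                         ≡⟨ cong (λ W → ⟪ W ⟫ ⊠ ⟦ d.v ⟧) word≡ ⟩
  ⟪ e.word ⟫ ⊠ ⟦ d.v ⟧                         ≈⟨ congʳ-⊠ ⟦ d.v ⟧ (cancelʳ ⟪ e.word ⟫ e.v) ⟨
  ⟪ e.word ⟫ ⊠ ⟦ e.v ⟧ ⊠ ⟦ e.v ⁻¹ᴱ ⟧ ⊠ ⟦ d.v ⟧ ≈⟨ congʳ-⊠ ⟦ d.v ⟧ (congʳ-⊠ ⟦ e.v ⁻¹ᴱ ⟧ e.equal) ⟨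
  ⟪ E ⟫ ⊠ ⟦ e.v ⁻¹ᴱ ⟧ ⊠ ⟦ d.v ⟧                ≈⟨ assoc-⊠ ⟪ E ⟫ ⟦ e.v ⁻¹ᴱ ⟧ ⟦ d.v ⟧ ⟩
  ⟪ E ⟫ ⊠ ⟦ e.v ⁻¹ᴱ · d.v ⟧                    ∎)
  where
  open ≃-Reasoning
  module d = NormalForm (normalForm D)
  module e = NormalForm (normalForm E)
  word≡ : d.word ≡ e.word
  word≡ = All.lookup (All.lookup check₂ d.∈words) e.∈words (trans (sym d.same-Ψ)
    (trans (sym (codeΨ-correct D)) (trans (≈-code (Ψ D) (Ψ E) ΨD≈ΨE) (trans (codeΨ-correct E) e.same-Ψ))))

Ψ-surjective : ∀ g → ∃[ D ] Ψ D 𝔾.≈ g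
Ψ-surjective g@(σ , s) = let (D , _ , eq) = find found in D , codeΨ-≈ D g eq
  where
  ≢ : ∀ {i j} → i ≢ j → σ ⟨$⟩ʳ i ≢ σ ⟨$⟩ʳ j
  ≢ i≢j eq = i≢j (trans (sym (Perm.inverseˡ σ)) (trans (cong (Perm.flip σ ⟨$⟩ʳ_) eq) (Perm.inverseˡ σ)))
  found = check₄ (σ ⟨$⟩ʳ ①) (σ ⟨$⟩ʳ ②) (σ ⟨$⟩ʳ ③) (σ ⟨$⟩ʳ ④) s
    (≢ (λ ()) , ≢ (λ ()) , ≢ (λ ()) , ≢ (λ ()) , ≢ (λ ()) , ≢ (λ ()))

diagram≃ : ∀ x → ⟪ diagram x ⟫ ≃ element x
diagram≃ x = ≈⇒≃ (isBracket x)

signed≃ : ∀ s v ε .p → [ (sign₃ s , ex v 𝟎 ε p) ] ≃ ⟦ ex v 𝟎 (s Sign.* ε) p ⟧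
signed≃ s (v₁ ∷ v₂ ∷ v₃ ∷ []) ε p = nf⇒≃ [ (sign₃ s , ex (v₁ ∷ v₂ ∷ v₃ ∷ []) 𝟎 ε p) ] ⟦ ex (v₁ ∷ v₂ ∷ v₃ ∷ []) 𝟎 (s Sign.* ε) p ⟧
  (cong (λ a → add (v₁ ∷ v₂ ∷ 𝟎) a (0ᵀ 5)) (lemma s ε))
  where
  lemma : ∀ s ε → sign₃ s *₃ sign₃ ε ≡ 1₃ *₃ sign₃ (s Sign.* ε)
  lemma Sign.+ Sign.+ = refl
  lemma Sign.+ Sign.- = refl
  lemma Sign.- Sign.+ = refl
  lemma Sign.- Sign.- = refl

N⇒IsV : ∀ {x} → N x → ∃[ g ] IsV g × element x ≃ ⟦ g ⟧
N⇒IsV (s , v , ε , p , eq) = ex v 𝟎 (s Sign.* ε) p , isV v _ p , ≃.trans (≈⇒≃ eq) (signed≃ s v ε p)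

IsV⇒N : ∀ {g} → IsV g → ∃[ n ] N n × element n ≃ ⟦ g ⟧
IsV⇒N g-isV@(isV v ε p) = let (D , D∼g) = IsV-word g-isV in [ D ]ᴳ ,
  (Sign.+ , v , ε , Dec.recompute (total v ℙ.≟ 0ℙ) p , ∼⇒≈ {⟪ D ⟫} {⟦ ex v 𝟎 ε p ⟧} D∼g) , mk≃ D∼g

G₃ : Group 0ℓ 0ℓ
G₃ = record
  { Carrier = ∣G₃∣
  ; _≈_ = λ x y → element x ≈ element y
  ; _∙_ = λ x y → record
    { element   = element x ⊠ element y
    ; diagram   = diagram x ⋆ diagram y
    ; isBracket = ≃⇒≈ (≃.trans (⟪⟫-homo (diagram x) (diagram y)) (cong-⊠ (diagram≃ x) (diagram≃ y)))
    }
  ; ε = [ [] ]ᴳ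
  ; _⁻¹ = λ x → [ inverse (diagram x) ]ᴳ
  ; isGroup = record
    { isMonoid = record
      { isSemigroup = record
        { isMagma = record
          { isEquivalence = record
            { refl  = λ {x} → ≃⇒≈ (≃.refl {element x})
            ; sym   = λ p → ≃⇒≈ (≃.sym (≈⇒≃ p))
            ; trans = λ p q → ≃⇒≈ (≃.trans (≈⇒≃ p) (≈⇒≃ q))
            }
          ; ∙-cong = λ p q → ≃⇒≈ (cong-⊠ (≈⇒≃ p) (≈⇒≃ q))
          }
        ; assoc = λ x y z → ≃⇒≈ (assoc-⊠ (element x) (element y) (element z))
        }
      ; identity = (λ x → ≃⇒≈ (identityˡ-⊠ (element x))) , (λ x → ≃⇒≈ (identityʳ-⊠ (element x)))
      }
    ; inverse =
        (λ x → ≃⇒≈ (≃.trans (congˡ-⊠ ⟪ inverse (diagram x) ⟫ (≃.sym (diagram≃ x))) (inverseˡ (diagram x)))) ,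
        (λ x → ≃⇒≈ (≃.trans (congʳ-⊠ ⟪ inverse (diagram x) ⟫ (≃.sym (diagram≃ x))) (inverseʳ (diagram x))))
    ; ⁻¹-cong = λ {x} {y} p → ≃⇒≈ (⁻¹-cong x y (≈⇒≃ p))
    }
  }
  where
  open ≃-Reasoning
  ⁻¹-cong : ∀ x y → element x ≃ element y → ⟪ inverse (diagram x) ⟫ ≃ ⟪ inverse (diagram y) ⟫
  ⁻¹-cong x y p = begin
    x⁻¹                               ≈⟨ identityʳ-⊠ x⁻¹ ⟨
    x⁻¹ ⊠ ⟦ 1ᴱ ⟧                      ≈⟨ congˡ-⊠ x⁻¹ (inverseʳ (diagram y)) ⟨
    x⁻¹ ⊠ (⟪ diagram y ⟫ ⊠ y⁻¹)       ≈⟨ congˡ-⊠ x⁻¹ (congʳ-⊠ y⁻¹ (≃.trans (diagram≃ x) (≃.trans p (≃.sym (diagram≃ y))))) ⟨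
    x⁻¹ ⊠ (⟪ diagram x ⟫ ⊠ y⁻¹)       ≈⟨ cancelˡ x⁻¹ ⟪ diagram x ⟫ y⁻¹ (inverseˡ (diagram x)) ⟩
    y⁻¹                               ∎
    where
    x⁻¹ = ⟪ inverse (diagram x) ⟫
    y⁻¹ = ⟪ inverse (diagram y) ⟫

private
  module G₃ = Group G₃

-- Equality of the left cosets xN and yN
infix 4 _≈ᴺ_
_≈ᴺ_ : ∣G₃∣ → ∣G₃∣ → Set
x ≈ᴺ y = ∃[ n ] N n × x G₃.≈ y G₃.∙ n

rawG₃/N : RawGroup 0ℓ 0ℓ
rawG₃/N = record
  { Carrier = ∣G₃∣ ; _≈_ = _≈ᴺ_ ; _∙_ = G₃._∙_ ; ε = G₃.ε ; _⁻¹ = G₃._⁻¹ }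

ψ : RawGroup.Carrier rawG₃/N → 𝔾.Carrier
ψ x = Ψ (diagram x)

open GroupMorphisms rawG₃/N 𝔾.rawGroup using (IsGroupMonomorphism; IsGroupIsomorphism)

ψ-isGroupMonomorphism : IsGroupMonomorphism ψ
ψ-isGroupMonomorphism = record
  { isGroupHomomorphism = record
    { isMonoidHomomorphism = record
      { isMagmaHomomorphism = record
        { isRelHomomorphism = record { cong = λ {x} {y} → ψ-cong {x} {y} }
        ; homo = λ x y → Ψ-⋆ (diagram x) (diagram y)
        }
      ; ε-homo = 𝔾.refl {𝔾.ε}
      }
    ; ⁻¹-homo = λ x → inverseˡ-unique (Ψ (inverse (diagram x))) (Ψ (diagram x)) (inverse-Ψ (diagram x))
    }
  ; injective = λ {x} {y} → ψ-injective {x} {y}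
  }
  where
  open GroupProperties S₄×±1 using (inverseˡ-unique)
  ψ-cong : ∀ {x y} → x ≈ᴺ y → ψ x 𝔾.≈ ψ y
  ψ-cong {x} {y} (n , n∈N , eq) = let (g , g-isV , n≃g) = N⇒IsV {n} n∈N in
    Ψ-cong (diagram x) (diagram y) g-isV (≃.trans (diagram≃ x) (≃.trans (≈⇒≃ eq) (cong-⊠ (≃.sym (diagram≃ y)) n≃g)))
  ψ-injective : ∀ {x y} → ψ x 𝔾.≈ ψ y → x ≈ᴺ y
  ψ-injective {x} {y} eq =
    let (g , g-isV , x≃yg) = Ψ-injective (diagram x) (diagram y) eq
        (n , n∈N , n≃g)    = IsV⇒N g-isV
    in n , n∈N , ≃⇒≈ (≃.trans (≃.sym (diagram≃ x)) (≃.trans x≃yg (cong-⊠ (diagram≃ y) (≃.sym n≃g))))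

ψ-isGroupIsomorphism : IsGroupIsomorphism ψ
ψ-isGroupIsomorphism = record
  { isGroupMonomorphism = ψ-isGroupMonomorphism
  ; surjective = λ g → let (D , eq) = Ψ-surjective g in
      [ D ]ᴳ , λ {x} x≈D → 𝔾.trans {ψ x} {Ψ D} {g} (IsGroupMonomorphism.⟦⟧-cong ψ-isGroupMonomorphism {x} {[ D ]ᴳ} x≈D) eq
  }

G₃/N : Group 0ℓ 0ℓ
G₃/N = record { isGroup = GroupMonomorphism.isGroup ψ-isGroupMonomorphism 𝔾.isGroup }

h : G₃.Carrier → Group.Carrier G₃/N
h x = x

-- ψ is the only homomorphism with these values, as the [C(S)] generate G₃.
ψ-C : ∀ S → ψ (h [ C S ]ᴳ) 𝔾.≈ ψ[C S ]
ψ-C S = 𝔾.identityʳ ψ[C S ]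

H : 𝒟₃ → 𝔾.Carrier
H D = ψ (h [ D ]ᴳ)

{-# OPTIONS --safe #-}

-- Let Mx = 0, and for a cut between two columns let uᵢ be the sum of x over row i to the
-- right of the cut minus the sum to its left. In a column with white squares S the
-- equations read (1 - A)x = u on S, where A is the skew matrix of the column, and crossing
-- it replaces u by u - 2x. So crossing S acts on u by -(1 + A)(1 - A)⁻¹ on the rows of S,
-- which is a signed permutation matrix. At the left end u is the vector of row sums and
-- at the right end it is minus that vector. Hence det M = 0 if and only if the product of
-- the column matrices has eigenvalue -1. These products form the octahedral group
-- S₄ × {±1}, the product for D being determined by H D, and the elements without
-- eigenvalue -1 are the identity and the rotations of order 3 and 4.
module Submission where

open import Defs
open import Data.List using ([]; _∷_)
open import Data.Product using (_,_)
open import Relation.Unary using (_≐_; _⊢_; _∪_)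
import Data.Fin.Permutation as Perm
import Data.Sign as Sign

import Algebra.Properties.Group as GroupProperties
import Algebra.Properties.Semiring.Sum as SumProperties
open import Algebra.Bundles using (CommutativeRing; Group)
open import Data.Fin as Fin using (Fin; zero; suc; toℕ; fromℕ<; inject₁; punchIn; punchOut; #_)
open import Data.Fin.Induction using (<-weakInduction-startingFrom)
import Data.Fin.Properties as Fin
open import Data.Fin.Subset using (Subset; _∈_; _∉_)
open import Data.Fin.Subset.Properties using (_∈?_)
open import Data.Integer as ℤ using (ℤ; 0ℤ; 1ℤ; -1ℤ; _+_; _*_; -_; _-_; _^_)
import Data.Integer.Properties as ℤ
open import Data.Integer.Tactic.RingSolver using (solve-∀)
open import Data.List as List using (List; _++_; map; filter; cartesianProduct; length; allFin)
open import Data.List.Membership.Propositional using (find) renaming (_∈_ to _∈ᴸ_)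
import Data.List.Membership.DecPropositional as DecMembership
open import Data.List.Membership.Propositional.Properties
  using (∈-allFin; ∈-cartesianProduct⁺; ∈-filter⁺; ∈-filter⁻; ∈-lookup)
open import Data.List.Relation.Unary.All as All using (All)
open import Data.List.Relation.Unary.AllPairs using (_∷_)
open import Data.List.Relation.Unary.Any as Any using (Any; here; there)
open import Data.List.Relation.Unary.Any.Properties using (lookup-index)
open import Data.List.Relation.Unary.Unique.Propositional using (Unique)
import Data.List.Relation.Unary.Unique.Propositional.Properties as Unique
open import Data.Nat as ℕ using (ℕ; zero; suc)
import Data.Nat.Properties as ℕ
open import Data.Product using (∃-syntax; _×_; proj₁; proj₂)
import Data.Product.Properties as Product
import Data.Sign.Properties as Sign
open import Data.Sign using (Sign)
open import Data.Sum using (_⊎_; inj₁; inj₂; [_,_]′)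
open import Data.Vec as Vec using (Vec; []; _∷_; lookup; here; there)
import Data.Vec.Properties as Vec
import Data.Vec.Functional as Vector
open import Data.Vec.Functional using (updateAt; insertAt)
open import Data.Vec.Functional.Properties using (updateAt-updates; updateAt-minimal; insertAt-lookup; insertAt-punchIn)
open import Function using (_∘_; _∋_; const; id)
open import Level using (0ℓ)
open import Relation.Binary.Definitions using (DecidableEquality)
open import Relation.Binary.PropositionalEquality
import Relation.Binary.Reasoning.Setoid as SetoidReasoning
open import Relation.Nullary using (Dec; yes; no; ¬_; ¬?; _×-dec_; _⊎-dec_; contradiction)
import Relation.Nullary.Decidable as Dec
open import Relation.Unary using (Pred; Decidable)

open SumProperties (CommutativeRing.semiring ℤ.+-*-commutativeRing)
  using (sum; sum-cong-≗; sum-replicate-zero; ∑-distrib-+; *-distribˡ-sum; sum-remove)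

-- Determinants and kernels of integer matrices

-- Why a column acts by a signed permutation: at a white row, u before the column is the sum of x
-- from the top through that row minus the sum below it, and u after the column is the sum above
-- that row minus the sum from it downwards. So each white row hands its value to the next white
-- row, and the first white row receives minus the value of the last. A black row has x = 0 and
-- keeps its value.
--
-- Working over ℤ shapes two steps. The equivalence of det = 0 with a nonzero integer kernel vector
-- is derived from the expansion along the first row, with elimination that never divides. And x is
-- half the difference of successive vectors u, so the solution built from an eigenvector w starts
-- from u = 2w.
--
-- That the product depends only on H D, and which products have eigenvalue -1, are finite checks
-- over `words`, which meets every coset once.

Matrix : ℕ → ℕ → Set
Matrix m n = Fin m → Fin n → ℤ

sum-zero : ∀ {n} {t : Fin n → ℤ} → (∀ i → t i ≡ 0ℤ) → sum t ≡ 0ℤ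
sum-zero {n} t≡0 = trans (sum-cong-≗ t≡0) (sum-replicate-zero n)

sum-single : ∀ {n} (c : Fin n) {t : Fin n → ℤ} → (∀ i → i ≢ c → t i ≡ 0ℤ) → sum t ≡ t c
sum-single {suc _} c {t} t≡0 = begin
  sum t                            ≡⟨ sum-remove {i = c} t ⟩
  t c + sum (λ i → t (punchIn c i)) ≡⟨ cong (t c +_) (sum-zero λ i → t≡0 (punchIn c i) (Fin.punchInᵢ≢i c i)) ⟩
  t c + 0ℤ                         ≡⟨ ℤ.+-identityʳ (t c) ⟩
  t c                              ∎
  where open ≡-Reasoning

sum-adjacent : ∀ {n} (p : Fin n) {t : Fin (suc n) → ℤ} → t (inject₁ p) + t (suc p) ≡ 0ℤ →
  (∀ i → i ≢ inject₁ p → i ≢ suc p → t i ≡ 0ℤ) → sum t ≡ 0ℤ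
sum-adjacent zero {t} pair others = begin
  t zero + (t (suc zero) + sum (λ i → t (suc (suc i))))
    ≡⟨ ℤ.+-assoc (t zero) _ _ ⟨
  t zero + t (suc zero) + sum (λ i → t (suc (suc i)))
    ≡⟨ cong₂ _+_ pair (sum-zero λ i → others (suc (suc i)) (λ ()) λ ()) ⟩
  0ℤ ∎
  where open ≡-Reasoning
sum-adjacent (suc p) pair others = cong₂ _+_ (others zero (λ ()) λ ())
  (sum-adjacent p pair λ i i≢p i≢sp → others (suc i) (i≢p ∘ Fin.suc-injective) (i≢sp ∘ Fin.suc-injective))

sum-linear : ∀ {n} a b (s t : Fin n → ℤ) → sum (λ i → a * s i + b * t i) ≡ a * sum s + b * sum t
sum-linear a b s t = trans (∑-distrib-+ (λ i → a * s i) (λ i → b * t i))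
  (sym (cong₂ _+_ (*-distribˡ-sum a s) (*-distribˡ-sum b t)))

minor : ∀ {n} → Matrix (suc n) (suc n) → Fin (suc n) → Matrix n n
minor A j i k = A (suc i) (punchIn j k)

det-cong : ∀ {n} {A B : Matrix n n} → (∀ i j → A i j ≡ B i j) → det A ≡ det B
det-cong {zero}          A≡B = refl
det-cong {suc n} {A} {B} A≡B = sum-cong-≗ λ j → cong₂ (λ a d → -1ℤ ^ toℕ j * a * d)
  (A≡B zero j) (det-cong {A = minor A j} {minor B j} λ i k → A≡B (suc i) (punchIn j k))

-- In the expansion, term c is linear through its entry, the three minors being equal; every other
-- term is linear through its minor, by induction. Entrywise hypotheses on three matrices pass to
-- minors directly, which an update of a column would not.
det-linear : ∀ {n} (c : Fin n) a b {A B C : Matrix n n} → (∀ i → C i c ≡ a * A i c + b * B i c) →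
  (∀ i j → j ≢ c → C i j ≡ A i j) → (∀ i j → j ≢ c → C i j ≡ B i j) → det C ≡ a * det A + b * det B
det-linear {suc n} c a b {A} {B} {C} atc C≡A C≡B =
  trans (sum-cong-≗ term) (sum-linear a b (λ j → -1ℤ ^ toℕ j * A zero j * det (minor A j)) (λ j → -1ℤ ^ toℕ j * B zero j * det (minor B j)))
  where
  term : ∀ j → -1ℤ ^ toℕ j * C zero j * det (minor C j) ≡
    a * (-1ℤ ^ toℕ j * A zero j * det (minor A j)) + b * (-1ℤ ^ toℕ j * B zero j * det (minor B j))
  term j with j Fin.≟ c
  ... | yes refl = trans
    (cong₂ (λ x d → -1ℤ ^ toℕ j * x * d) (atc zero) (det-cong λ i k → C≡A (suc i) (punchIn j k) (Fin.punchInᵢ≢i j k)))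
    (trans (lemma (-1ℤ ^ toℕ j) a b (A zero j) (B zero j) (det (minor A j)))
      (cong (λ d → a * (-1ℤ ^ toℕ j * A zero j * det (minor A j)) + b * (-1ℤ ^ toℕ j * B zero j * d))
        (det-cong λ i k → trans (sym (C≡A (suc i) (punchIn j k) (Fin.punchInᵢ≢i j k))) (C≡B (suc i) (punchIn j k) (Fin.punchInᵢ≢i j k)))))
    where
    lemma : ∀ s a b x y d → s * (a * x + b * y) * d ≡ a * (s * x * d) + b * (s * y * d)
    lemma = solve-∀
  ... | no j≢c = trans
    (cong (-1ℤ ^ toℕ j * C zero j *_) (det-linear (punchOut j≢c) a b {minor A j} {minor B j}
      (λ i → subst (λ k → C (suc i) k ≡ a * A (suc i) k + b * B (suc i) k) (sym (Fin.punchIn-punchOut j≢c)) (atc (suc i)))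
      (λ i k k≢ → C≡A (suc i) (punchIn j k) (away k≢))
      (λ i k k≢ → C≡B (suc i) (punchIn j k) (away k≢))))
    (trans (lemma (-1ℤ ^ toℕ j) a b (C zero j) (det (minor A j)) (det (minor B j)))
      (cong₂ (λ x y → a * (-1ℤ ^ toℕ j * x * det (minor A j)) + b * (-1ℤ ^ toℕ j * y * det (minor B j))) (C≡A zero j j≢c) (C≡B zero j j≢c)))
    where
    away : ∀ {k} → k ≢ punchOut j≢c → punchIn j k ≢ c
    away k≢ eq = k≢ (Fin.punchIn-injective j _ _ (trans eq (sym (Fin.punchIn-punchOut j≢c))))
    lemma : ∀ s a b x d e → s * x * (a * d + b * e) ≡ a * (s * x * d) + b * (s * x * e)
    lemma = solve-∀

punchIn-adjacent : ∀ {n} (p k : Fin n) → punchIn (inject₁ p) k ≡ punchIn (suc p) k ⊎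
  (punchIn (inject₁ p) k ≡ suc p × punchIn (suc p) k ≡ inject₁ p)
punchIn-adjacent zero    zero    = inj₂ (refl , refl)
punchIn-adjacent zero    (suc k) = inj₁ refl
punchIn-adjacent (suc p) zero    = inj₁ refl
punchIn-adjacent (suc p) (suc k) with punchIn-adjacent p k
... | inj₁ eq        = inj₁ (cong suc eq)
... | inj₂ (eq , eq′) = inj₂ (cong suc eq , cong suc eq′)

adjacent-preimage : ∀ {n} (p : Fin (suc n)) j → j ≢ inject₁ p → j ≢ suc p →
  ∃[ q ] punchIn j (inject₁ q) ≡ inject₁ p × punchIn j (suc q) ≡ suc p
adjacent-preimage zero zero                        j≢p j≢sp = contradiction refl j≢p
adjacent-preimage zero (suc zero)                  j≢p j≢sp = contradiction refl j≢sp
adjacent-preimage {suc n} zero (suc (suc j))       j≢p j≢sp = zero , refl , refl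
adjacent-preimage {suc n} (suc p) zero             j≢p j≢sp = p , refl , refl
adjacent-preimage {suc n} (suc p) (suc j)          j≢p j≢sp =
  let (q , eq , eq′) = adjacent-preimage p j (j≢p ∘ cong suc) (j≢sp ∘ cong suc) in suc q , cong suc eq , cong suc eq′

-- The terms of the two equal columns have equal minors and opposite signs. In every other term the
-- minor still has two equal adjacent columns.
det-adjacent : ∀ {n} (p : Fin n) {A : Matrix (suc n) (suc n)} → (∀ i → A i (inject₁ p) ≡ A i (suc p)) → det A ≡ 0ℤ
det-adjacent {suc n} p {A} eq = sum-adjacent p cancel others
  where
  minors : ∀ i k → minor A (inject₁ p) i k ≡ minor A (suc p) i k
  minors i k with punchIn-adjacent p k
  ... | inj₁ same       = cong (A (suc i)) same
  ... | inj₂ (e₁ , e₂) = trans (cong (A (suc i)) e₁) (trans (sym (eq (suc i))) (sym (cong (A (suc i)) e₂)))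
  lemma : ∀ s a d → s * a * d + (-1ℤ * s) * a * d ≡ 0ℤ
  lemma = solve-∀
  cancel : -1ℤ ^ toℕ (inject₁ p) * A zero (inject₁ p) * det (minor A (inject₁ p))
    + (-1ℤ * -1ℤ ^ toℕ p) * A zero (suc p) * det (minor A (suc p)) ≡ 0ℤ
  cancel = trans
    (cong (_+ (-1ℤ * -1ℤ ^ toℕ p) * A zero (suc p) * det (minor A (suc p)))
      (trans (cong₂ (λ n a → -1ℤ ^ n * a * det (minor A (inject₁ p))) (Fin.toℕ-inject₁ p) (eq zero))
             (cong (-1ℤ ^ toℕ p * A zero (suc p) *_) (det-cong minors))))
    (lemma (-1ℤ ^ toℕ p) (A zero (suc p)) (det (minor A (suc p))))
  others : ∀ j → j ≢ inject₁ p → j ≢ suc p → -1ℤ ^ toℕ j * A zero j * det (minor A j) ≡ 0ℤ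
  others j j≢p j≢sp with adjacent-preimage p j j≢p j≢sp
  ... | q , e₁ , e₂ = trans
    (cong (-1ℤ ^ toℕ j * A zero j *_) (det-adjacent q {minor A j} λ i →
      trans (cong (A (suc i)) e₁) (trans (eq (suc i)) (sym (cong (A (suc i)) e₂)))))
    (ℤ.*-zeroʳ (-1ℤ ^ toℕ j * A zero j))

infixl 7 _[_≔_]
_[_≔_] : ∀ {m n} → Matrix m n → Fin n → (Fin m → ℤ) → Matrix m n
(A [ c ≔ v ]) i = updateAt (A i) c (const (v i))

module _ {m n} (A : Matrix m n) (c : Fin n) (v : Fin m → ℤ) where

  ≔-at : ∀ i → (A [ c ≔ v ]) i c ≡ v i
  ≔-at i = updateAt-updates c (A i)

  ≔-off : ∀ i j → j ≢ c → (A [ c ≔ v ]) i j ≡ A i j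
  ≔-off i j j≢c = updateAt-minimal j c (A i) j≢c

≔-self : ∀ {m n} (A : Matrix m n) c i j → (A [ c ≔ (λ i → A i c) ]) i j ≡ A i j
≔-self A c i j with j Fin.≟ c
... | yes refl = ≔-at A c (λ i → A i c) i
... | no  j≢c  = ≔-off A c (λ i → A i c) i j j≢c

det-≔-linear : ∀ {n} (A : Matrix n n) c a b v w →
  det (A [ c ≔ (λ i → a * v i + b * w i) ]) ≡ a * det (A [ c ≔ v ]) + b * det (A [ c ≔ w ])
det-≔-linear A c a b v w = det-linear c a b
  (λ i → trans (≔-at A c u i) (sym (cong₂ (λ x y → a * x + b * y) (≔-at A c v i) (≔-at A c w i))))
  (λ i j j≢c → trans (≔-off A c u i j j≢c) (sym (≔-off A c v i j j≢c)))
  (λ i j j≢c → trans (≔-off A c u i j j≢c) (sym (≔-off A c w i j j≢c)))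
  where
  u = λ i → a * v i + b * w i

module _ {n} (A : Matrix (suc n) (suc n)) (p : Fin n) where

  private
    l r : Fin (suc n)
    l = inject₁ p
    r = suc p

    l≢r : l ≢ r
    l≢r eq = ℕ.1+n≢n (sym (trans (sym (Fin.toℕ-inject₁ p)) (cong toℕ eq)))

    F : (v w : Fin (suc n) → ℤ) → Matrix (suc n) (suc n)
    F v w = A [ l ≔ v ] [ r ≔ w ]

    F-l : ∀ v w i → F v w i l ≡ v i
    F-l v w i = trans (≔-off (A [ l ≔ v ]) r w i l l≢r) (≔-at A l v i)

    F-r : ∀ v w i → F v w i r ≡ w i
    F-r v w = ≔-at (A [ l ≔ v ]) r w

    F-off : ∀ v w i j → j ≢ l → j ≢ r → F v w i j ≡ A i j
    F-off v w i j j≢l j≢r = trans (≔-off (A [ l ≔ v ]) r w i j j≢r) (≔-off A l v i j j≢l)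

    F-off-l : ∀ v v′ w i j → j ≢ l → F v w i j ≡ F v′ w i j
    F-off-l v v′ w i j j≢l with j Fin.≟ r
    ... | yes refl = trans (F-r v w i) (sym (F-r v′ w i))
    ... | no  j≢r  = trans (F-off v w i j j≢l j≢r) (sym (F-off v′ w i j j≢l j≢r))

    F-equal : ∀ v → det (F v v) ≡ 0ℤ
    F-equal v = det-adjacent p {F v v} λ i → trans (F-l v v i) (sym (F-r v v i))

    -- Polarization: with s = v + w in both columns the determinant vanishes, and bilinearity leaves
    -- only the two mixed terms.
    F-skew : ∀ v w → det (F v w) ≡ - det (F w v)
    F-skew v w = begin
      det (F v w)
        ≡⟨ lemma (det (F v v)) (det (F v w)) (det (F w v)) (det (F w w)) ⟩
      (1ℤ * (1ℤ * det (F v v) + 1ℤ * det (F w v)) + 1ℤ * (1ℤ * det (F v w) + 1ℤ * det (F w w)))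
        - det (F v v) - det (F w w) - det (F w v)
        ≡⟨ cong₂ (λ x y → (1ℤ * x + 1ℤ * y) - det (F v v) - det (F w w) - det (F w v)) (linear v) (linear w) ⟨
      (1ℤ * det (F s v) + 1ℤ * det (F s w)) - det (F v v) - det (F w w) - det (F w v)
        ≡⟨ cong (λ x → x - det (F v v) - det (F w w) - det (F w v)) (det-≔-linear (A [ l ≔ s ]) r 1ℤ 1ℤ v w) ⟨
      det (F s s) - det (F v v) - det (F w w) - det (F w v)
        ≡⟨ cong₂ (λ x y → x - y - det (F w w) - det (F w v)) (F-equal s) (F-equal v) ⟩
      0ℤ - 0ℤ - det (F w w) - det (F w v)
        ≡⟨ cong (λ x → 0ℤ - 0ℤ - x - det (F w v)) (F-equal w) ⟩
      0ℤ - det (F w v)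
        ≡⟨ ℤ.+-identityˡ (- det (F w v)) ⟩
      - det (F w v) ∎
      where
      open ≡-Reasoning
      s : Fin (suc n) → ℤ
      s i = 1ℤ * v i + 1ℤ * w i
      lemma : ∀ a b c d → b ≡ (1ℤ * (1ℤ * a + 1ℤ * c) + 1ℤ * (1ℤ * b + 1ℤ * d)) - a - d - c
      lemma = solve-∀
      linear : ∀ x → det (F s x) ≡ 1ℤ * det (F v x) + 1ℤ * det (F w x)
      linear x = det-linear l 1ℤ 1ℤ
        (λ i → trans (F-l s x i) (sym (cong₂ (λ y z → 1ℤ * y + 1ℤ * z) (F-l v x i) (F-l w x i))))
        (F-off-l s v x) (F-off-l s w x)

  swapped : Matrix (suc n) (suc n)
  swapped = F (λ i → A i r) (λ i → A i l)

  swapped-l : ∀ i → swapped i l ≡ A i r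
  swapped-l = F-l (λ i → A i r) (λ i → A i l)

  swapped-off : ∀ i j → j ≢ l → j ≢ r → swapped i j ≡ A i j
  swapped-off = F-off (λ i → A i r) (λ i → A i l)

  det-swapped : det A ≡ - det swapped
  det-swapped = trans (det-cong {A = A} (λ i j → sym (F≡A i j))) (F-skew (λ i → A i l) (λ i → A i r))
    where
    F≡A : ∀ i j → F (λ i → A i l) (λ i → A i r) i j ≡ A i j
    F≡A i j with j Fin.≟ l | j Fin.≟ r
    ... | yes refl | _        = F-l (λ i → A i l) (λ i → A i r) i
    ... | no _     | yes refl = F-r (λ i → A i l) (λ i → A i r) i
    ... | no j≢l   | no j≢r   = F-off (λ i → A i l) (λ i → A i r) i j j≢l j≢r

-- Induction on the right one of the two columns: a swap with its left neighbour brings it closer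
-- and only changes the sign of the determinant, until the columns are adjacent.
det-alternating : ∀ {n} {p q : Fin n} → p ≢ q → (A : Matrix n n) → (∀ i → A i p ≡ A i q) → det A ≡ 0ℤ
det-alternating {suc n} {p} {q} p≢q A eq =
  [ (λ p≤q → ascending p≤q p≢q A eq) , (λ q≤p → ascending q≤p (p≢q ∘ sym) A (sym ∘ eq)) ]′ (Fin.≤-total p q)
  where
  Alternates : (p q : Fin (suc n)) → Set
  Alternates p q = p ≢ q → (A : Matrix (suc n) (suc n)) → (∀ i → A i p ≡ A i q) → det A ≡ 0ℤ
  ascending : ∀ {p q : Fin (suc n)} → p Fin.≤ q → Alternates p q
  ascending {p} p≤q = <-weakInduction-startingFrom (Alternates p) (contradiction refl) next p≤q
    where
    next : ∀ q → Alternates p (inject₁ q) → Alternates p (suc q)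
    next q ih p≢sq A eq with p Fin.≟ inject₁ q
    ... | yes refl = det-adjacent q {A} eq
    ... | no  p≢q  = trans (det-swapped A q) (cong -_ (ih p≢q (swapped A q) λ i →
      trans (swapped-off A q i p p≢q p≢sq) (trans (eq i) (sym (swapped-l A q i)))))

det-≔-repeat : ∀ {n} (A : Matrix n n) c j → j ≢ c → det (A [ c ≔ (λ i → A i j) ]) ≡ 0ℤ
det-≔-repeat A c j j≢c = det-alternating (j≢c ∘ sym) (A [ c ≔ v ]) λ i →
  trans (≔-at A c v i) (sym (≔-off A c v i j j≢c))
  where
  v = λ i → A i j

det-≔-sum : ∀ {n m} (A : Matrix n n) c (y : Fin m → ℤ) (V : Matrix n m) →
  det (A [ c ≔ (λ i → sum λ j → V i j * y j) ]) ≡ sum λ j → y j * det (A [ c ≔ (λ i → V i j) ])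
det-≔-sum {m = zero}  A c y V = det-≔-linear A c 0ℤ 0ℤ (λ _ → 0ℤ) (λ _ → 0ℤ)
det-≔-sum {m = suc m} A c y V = begin
  det (A [ c ≔ (λ i → V i zero * y zero + tail i) ])
    ≡⟨ det-linear c (y zero) 1ℤ
         (λ i → trans (≔-at A c u i) (trans (lemma (V i zero) (y zero) (tail i))
           (sym (cong₂ (λ x z → y zero * x + 1ℤ * z) (≔-at A c (λ i → V i zero) i) (≔-at A c tail i)))))
         (λ i j j≢c → trans (≔-off A c u i j j≢c) (sym (≔-off A c (λ i → V i zero) i j j≢c)))
         (λ i j j≢c → trans (≔-off A c u i j j≢c) (sym (≔-off A c tail i j j≢c))) ⟩
  y zero * det (A [ c ≔ (λ i → V i zero) ]) + 1ℤ * det (A [ c ≔ tail ])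
    ≡⟨ cong (y zero * det (A [ c ≔ (λ i → V i zero) ]) +_)
         (trans (ℤ.*-identityˡ (det (A [ c ≔ tail ]))) (det-≔-sum A c (y ∘ suc) λ i j → V i (suc j))) ⟩
  sum (λ j → y j * det (A [ c ≔ (λ i → V i j) ])) ∎
  where
  open ≡-Reasoning
  tail u : Fin _ → ℤ
  tail i = sum λ j → V i (suc j) * y (suc j)
  u i = V i zero * y zero + tail i
  lemma : ∀ v y t → v * y + t ≡ y * v + 1ℤ * t
  lemma = solve-∀

-- Vanishing determinants and integer kernels

record HasKernel {m n} (A : Matrix m n) : Set where
  constructor kernel
  field
    x       : Fin n → ℤ
    Ax≡0    : ∀ i → sum (λ j → A i j * x j) ≡ 0ℤ
    c       : Fin n
    nonzero : x c ≢ 0ℤ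

*-cancel-≢0 : ∀ {a b} → a ≢ 0ℤ → a * b ≡ 0ℤ → b ≡ 0ℤ
*-cancel-≢0 {a} {b} a≢0 ab≡0 = [ (λ a≡0 → contradiction a≡0 a≢0) , (λ b≡0 → b≡0) ]′ (ℤ.i*j≡0⇒i≡0∨j≡0 a {b} ab≡0)

-- Cramer's rule: replacing column c by Ax multiplies the determinant by x c, since the other
-- columns of A contribute repeated columns; but Ax = 0.
kernel⇒det≡0 : ∀ {n} (A : Matrix n n) → HasKernel A → det A ≡ 0ℤ
kernel⇒det≡0 A (kernel x Ax≡0 c xc≢0) = *-cancel-≢0 {x c} {det A} xc≢0 (begin
    x c * det A
      ≡⟨ cong (x c *_) (det-cong {A = A [ c ≔ (λ i → A i c) ]} (≔-self A c)) ⟨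
    x c * det (A [ c ≔ (λ i → A i c) ])
      ≡⟨ sum-single c {λ j → x j * det (A [ c ≔ (λ i → A i j) ])}
           (λ j j≢c → trans (cong (x j *_) (det-≔-repeat A c j j≢c)) (ℤ.*-zeroʳ (x j))) ⟨
    sum (λ j → x j * det (A [ c ≔ (λ i → A i j) ]))
      ≡⟨ det-≔-sum A c x A ⟨
    det (A [ c ≔ Ax ])
      -- A zero column is 0 times the column of A plus 0 times the same column.
      ≡⟨ det-linear c 0ℤ 0ℤ {A} {A} (λ i → trans (≔-at A c Ax i) (Ax≡0 i)) (≔-off A c Ax) (≔-off A c Ax) ⟩
    0ℤ ∎)
  where
  open ≡-Reasoning
  Ax : Fin _ → ℤ
  Ax i = sum λ j → A i j * x j

-- One step of fraction-free elimination, with pivot A 0 p.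
reduce : ∀ {m n} → Matrix (suc m) (suc n) → Fin (suc n) → Matrix m n
reduce A p i l = A zero p * A (suc i) (punchIn p l) - A zero (punchIn p l) * A (suc i) p

module _ {m n} (A : Matrix (suc m) (suc n)) (p : Fin (suc n)) where

  -- Multiplying y by the pivot makes the pivot row solvable for coordinate p without division.
  kernel-reduce : A zero p ≢ 0ℤ → HasKernel (reduce A p) → HasKernel A
  kernel-reduce a≢0 (kernel y By≡0 c yc≢0) = kernel x Ax≡0 (punchIn p c)
    λ xc≡0 → yc≢0 (*-cancel-≢0 a≢0 (trans (sym (insertAt-punchIn (λ l → A zero p * y l) p x₀ c)) xc≡0))
    where
    x₀ : ℤ
    x₀ = - sum λ l → A zero (punchIn p l) * y l
    x : Fin (suc n) → ℤ
    x = insertAt (λ l → A zero p * y l) p x₀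
    lemma : ∀ a r c s y → (a * r - c * s) * y ≡ - s * (c * y) + 1ℤ * (r * (a * y))
    lemma = solve-∀
    neg-swap : ∀ s t u → - s * t + 1ℤ * u ≡ s * - t + u
    neg-swap = solve-∀
    -- For any row r, eliminating coordinate p gives the reduced row applied to y. If r is the pivot
    -- row itself, the coefficients cancel.
    combine : ∀ (r : Fin (suc n) → ℤ) →
      sum (λ j → r j * x j) ≡ sum λ l → (A zero p * r (punchIn p l) - A zero (punchIn p l) * r p) * y l
    combine r = sym (begin
      sum (λ l → (A zero p * r (punchIn p l) - A zero (punchIn p l) * r p) * y l)
        ≡⟨ (sum-cong-≗ λ l → lemma (A zero p) (r (punchIn p l)) (A zero (punchIn p l)) (r p) (y l)) ⟩
      sum (λ l → - r p * (A zero (punchIn p l) * y l) + 1ℤ * (r (punchIn p l) * (A zero p * y l)))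
        ≡⟨ sum-linear (- r p) 1ℤ (λ l → A zero (punchIn p l) * y l) (λ l → r (punchIn p l) * (A zero p * y l)) ⟩
      - r p * (sum λ l → A zero (punchIn p l) * y l) + 1ℤ * (sum λ l → r (punchIn p l) * (A zero p * y l))
        ≡⟨ neg-swap (r p) (sum λ l → A zero (punchIn p l) * y l) _ ⟩
      r p * x₀ + sum (λ l → r (punchIn p l) * (A zero p * y l))
        ≡⟨ cong₂ _+_ (cong (r p *_) (insertAt-lookup (λ l → A zero p * y l) p x₀))
             (sum-cong-≗ λ l → cong (r (punchIn p l) *_) (insertAt-punchIn (λ l → A zero p * y l) p x₀ l)) ⟨
      r p * x p + sum (λ l → r (punchIn p l) * x (punchIn p l))
        ≡⟨ sum-remove {i = p} (λ j → r j * x j) ⟨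
      sum (λ j → r j * x j) ∎)
      where open ≡-Reasoning
    Ax≡0 : ∀ i → sum (λ j → A i j * x j) ≡ 0ℤ
    Ax≡0 zero    = trans (combine (A zero)) (sum-zero λ l → cancel (A zero p) (A zero (punchIn p l)) (y l))
      where
      cancel : ∀ a c y → (a * c - c * a) * y ≡ 0ℤ
      cancel = solve-∀
    Ax≡0 (suc i) = trans (combine (A (suc i))) (By≡0 i)

-- Induction on t, the number of columns that may already have been replaced.
det-column-operations : ∀ {n} (A C : Matrix n n) p a (b : Fin n → ℤ) t →
  (∀ i → C i p ≡ A i p) →
  (∀ j → j ≢ p → toℕ j ℕ.< t → ∀ i → C i j ≡ a * A i j + b j * A i p) →
  (∀ j → t ℕ.≤ toℕ j → ∀ i → C i j ≡ A i j) →
  det A ≡ 0ℤ → det C ≡ 0ℤ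
det-column-operations A C p a b zero    atp done todo detA≡0 = trans (det-cong {A = C} λ i j → todo j ℕ.z≤n i) detA≡0
det-column-operations {n} A C p a b (suc t) atp done todo detA≡0 with t ℕ.<? n
... | no  t≮n = det-column-operations A C p a b t atp (λ j j≢p j<t → done j j≢p (ℕ.m<n⇒m<1+n j<t))
  (λ j t≤j → contradiction (ℕ.≤-<-trans t≤j (Fin.toℕ<n j)) t≮n) detA≡0
... | yes t<n with fromℕ< t<n | Fin.toℕ-fromℕ< t<n
... | k | k≡t with k Fin.≟ p
... | yes refl = det-column-operations A C k a b t atp (λ j j≢p j<t → done j j≢p (ℕ.m<n⇒m<1+n j<t)) todo′ detA≡0
  where
  todo′ : ∀ j → t ℕ.≤ toℕ j → ∀ i → C i j ≡ A i j
  todo′ j t≤j with j Fin.≟ k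
  ... | yes refl = atp
  ... | no  j≢k  = todo j (ℕ.≤∧≢⇒< t≤j λ t≡j → j≢k (Fin.toℕ-injective (sym (trans k≡t t≡j))))
... | no  k≢p  = begin
  det C                                            ≡⟨ det-linear k a (b k) {C₀} {C [ k ≔ (λ i → C i p) ]} atk
                                                        (λ i j j≢k → sym (≔-off C k (λ i → A i k) i j j≢k))
                                                        (λ i j j≢k → sym (≔-off C k (λ i → C i p) i j j≢k)) ⟩
  a * det C₀ + b k * det (C [ k ≔ (λ i → C i p) ]) ≡⟨ cong₂ (λ x y → a * x + b k * y) C₀≡0 (det-≔-repeat C k p (k≢p ∘ sym)) ⟩
  a * 0ℤ + b k * 0ℤ                                ≡⟨ lemma a (b k) ⟩
  0ℤ                                               ∎
  where
  open ≡-Reasoning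
  C₀ : Matrix n n
  C₀ = C [ k ≔ (λ i → A i k) ]
  lemma : ∀ a b → a * 0ℤ + b * 0ℤ ≡ 0ℤ
  lemma = solve-∀
  atk : ∀ i → C i k ≡ a * C₀ i k + b k * (C [ k ≔ (λ i → C i p) ]) i k
  atk i = trans (done k k≢p (ℕ.≤-reflexive (cong suc k≡t)) i) (sym (cong₂ (λ x y → a * x + b k * y)
    (≔-at C k (λ i → A i k) i) (trans (≔-at C k (λ i → C i p) i) (atp i))))
  todo′ : ∀ j → t ℕ.≤ toℕ j → ∀ i → C₀ i j ≡ A i j
  todo′ j t≤j i with j Fin.≟ k
  ... | yes refl = ≔-at C k (λ i → A i k) i
  ... | no  j≢k  = trans (≔-off C k (λ i → A i k) i j j≢k) (todo j (ℕ.≤∧≢⇒< t≤j λ t≡j → j≢k (Fin.toℕ-injective (sym (trans k≡t t≡j)))) i)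
  C₀≡0 : det C₀ ≡ 0ℤ
  C₀≡0 = det-column-operations A C₀ p a b t
    (λ i → trans (≔-off C k (λ i → A i k) i p (k≢p ∘ sym)) (atp i))
    (λ j j≢p j<t i → trans (≔-off C k (λ i → A i k) i j λ { refl → ℕ.<-irrefl k≡t j<t }) (done j j≢p (ℕ.m<n⇒m<1+n j<t) i))
    todo′ detA≡0

-- Column operations clear the first row except for the pivot, and the minor at the pivot is then
-- `reduce A p`. Only the vanishing of the determinant is followed, so the powers of the pivot that
-- the operations produce need not be counted.
det-reduce : ∀ {n} (A : Matrix (suc n) (suc n)) p → A zero p ≢ 0ℤ → det A ≡ 0ℤ → det (reduce A p) ≡ 0ℤ
det-reduce {n} A p a≢0 detA≡0 = *-cancel-≢0 {s * A zero p} {det (reduce A p)}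
  (λ sa≡0 → a≢0 (*-cancel-≢0 {s} {A zero p} s≢0 sa≡0)) (begin
    s * A zero p * det (reduce A p)  ≡⟨ cong₂ (λ x d → s * x * d) (≔-at E₀ p v zero) (det-cong {A = minor E p} minor≡) ⟨
    s * E zero p * det (minor E p)   ≡⟨ sum-single p {λ j → -1ℤ ^ toℕ j * E zero j * det (minor E j)} first-row ⟨
    det E                            ≡⟨ det-column-operations A E p (A zero p) (λ j → - A zero j) (suc n) (≔-at E₀ p v)
                                          (λ j j≢p _ i → trans (≔-off E₀ p v i j j≢p) (lemma (A zero p * A i j) (A zero j) (A i p)))
                                          (λ j n<j → contradiction (Fin.toℕ<n j) (ℕ.≤⇒≯ n<j)) detA≡0 ⟩
    0ℤ                               ∎)
  where
  open ≡-Reasoning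
  s : ℤ
  s = -1ℤ ^ toℕ p
  s≢0 : s ≢ 0ℤ
  s≢0 eq with () ← ℤ.i^n≡0⇒i≡0 -1ℤ (toℕ p) eq
  v : Fin (suc n) → ℤ
  v i = A i p
  E₀ E : Matrix (suc n) (suc n)
  E₀ i j = A zero p * A i j - A zero j * A i p
  E = E₀ [ p ≔ v ]
  lemma : ∀ x c y → x - c * y ≡ x + - c * y
  lemma = solve-∀
  minor≡ : ∀ i l → minor E p i l ≡ reduce A p i l
  minor≡ i l = ≔-off E₀ p v (suc i) (punchIn p l) (Fin.punchInᵢ≢i p l)
  first-row : ∀ j → j ≢ p → -1ℤ ^ toℕ j * E zero j * det (minor E j) ≡ 0ℤ
  first-row j j≢p = trans
    (cong (λ x → -1ℤ ^ toℕ j * x * det (minor E j)) (trans (≔-off E₀ p v zero j j≢p) (cancel (A zero p) (A zero j))))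
    (zero-product (-1ℤ ^ toℕ j) (det (minor E j)))
    where
    cancel : ∀ a c → a * c - c * a ≡ 0ℤ
    cancel = solve-∀
    zero-product : ∀ x d → x * 0ℤ * d ≡ 0ℤ
    zero-product = solve-∀

pivot? : ∀ {n} (r : Fin n → ℤ) → (∃[ p ] r p ≢ 0ℤ) ⊎ (∀ j → r j ≡ 0ℤ)
pivot? r with Fin.any? (λ j → ¬? (r j ℤ.≟ 0ℤ))
... | yes found = inj₁ found
... | no  none  = inj₂ λ j → Dec.decidable-stable (r j ℤ.≟ 0ℤ) λ rj≢0 → none (j , rj≢0)

kernel-zero-row : ∀ {m n} {A : Matrix (suc m) n} → (∀ j → A zero j ≡ 0ℤ) → HasKernel (λ i → A (suc i)) → HasKernel A
kernel-zero-row {A = A} row≡0 (kernel x Ax≡0 c xc≢0) = kernel x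
  (λ { zero → sum-zero λ j → cong (_* x j) (row≡0 j) ; (suc i) → Ax≡0 i }) c xc≢0

-- Needed by `det≡0⇒kernel` when the first row is zero: the remaining rows then have one column too
-- many, and no determinant is available for them.
kernel-wide : ∀ {m} (A : Matrix m (suc m)) → HasKernel A
kernel-wide {zero}  A = kernel (λ _ → 1ℤ) (λ ()) zero λ ()
kernel-wide {suc m} A with pivot? (A zero)
... | inj₁ (p , a≢0) = kernel-reduce A p a≢0 (kernel-wide (reduce A p))
-- One column is dropped along with the zero row, to keep the shape; its coordinate is set to 0.
... | inj₂ row≡0 with kernel-wide (λ i j → A (suc i) (suc j))
... | kernel x Ax≡0 c xc≢0 = kernel-zero-row row≡0 (kernel (0ℤ Vector.∷ x)
  (λ i → cong₂ _+_ (ℤ.*-zeroʳ (A (suc i) zero)) (Ax≡0 i)) (suc c) xc≢0)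

det≡0⇒kernel : ∀ {n} (A : Matrix n n) → det A ≡ 0ℤ → HasKernel A
det≡0⇒kernel {suc n} A detA≡0 with pivot? (A zero)
... | inj₁ (p , a≢0) = kernel-reduce A p a≢0 (det≡0⇒kernel (reduce A p) (det-reduce A p a≢0 detA≡0))
... | inj₂ row≡0     = kernel-zero-row row≡0 (kernel-wide λ i → A (suc i))

-- The action of the columns

-- The action of - (1 + A) (1 - A)⁻¹ on the rows of S. It is also applied to literals below,
-- which makes the equality of two such operators decidable.
turn : ∀ {A : Set} → (A → A) → Subset 3 → Vec A 3 → Vec A 3
turn neg ∅     (a ∷ b ∷ c ∷ []) = a ∷ b ∷ c ∷ []
turn neg ⁅1⁆   (a ∷ b ∷ c ∷ []) = neg a ∷ b ∷ c ∷ []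
turn neg ⁅2⁆   (a ∷ b ∷ c ∷ []) = a ∷ neg b ∷ c ∷ []
turn neg ⁅3⁆   (a ∷ b ∷ c ∷ []) = a ∷ b ∷ neg c ∷ []
turn neg ⁅12⁆  (a ∷ b ∷ c ∷ []) = neg b ∷ a ∷ c ∷ []
turn neg ⁅13⁆  (a ∷ b ∷ c ∷ []) = neg c ∷ b ∷ a ∷ []
turn neg ⁅23⁆  (a ∷ b ∷ c ∷ []) = a ∷ neg c ∷ b ∷ []
turn neg ⁅123⁆ (a ∷ b ∷ c ∷ []) = neg c ∷ a ∷ b ∷ []

turns : ∀ {A : Set} → (A → A) → 𝒟₃ → Vec A 3 → Vec A 3
turns neg []      u = u
turns neg (S ∷ D) u = turns neg D (turn neg S u)

turns-⋆ : ∀ {A : Set} (neg : A → A) D E u → turns neg (D ⋆ E) u ≡ turns neg E (turns neg D u)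
turns-⋆ neg []      E u = refl
turns-⋆ neg (S ∷ D) E u = turns-⋆ neg D E (turn neg S u)

module _ {A B : Set} {neg : A → A} {neg′ : B → B} (φ : A → B) (φ-neg : ∀ a → φ (neg a) ≡ neg′ (φ a)) where

  turn-map : ∀ S u → turn neg′ S (Vec.map φ u) ≡ Vec.map φ (turn neg S u)
  turn-map ∅     (a ∷ b ∷ c ∷ []) = refl
  turn-map ⁅1⁆   (a ∷ b ∷ c ∷ []) = cong (_∷ φ b ∷ φ c ∷ []) (sym (φ-neg a))
  turn-map ⁅2⁆   (a ∷ b ∷ c ∷ []) = cong (λ x → φ a ∷ x ∷ φ c ∷ []) (sym (φ-neg b))
  turn-map ⁅3⁆   (a ∷ b ∷ c ∷ []) = cong (λ x → φ a ∷ φ b ∷ x ∷ []) (sym (φ-neg c))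
  turn-map ⁅12⁆  (a ∷ b ∷ c ∷ []) = cong (_∷ φ a ∷ φ c ∷ []) (sym (φ-neg b))
  turn-map ⁅13⁆  (a ∷ b ∷ c ∷ []) = cong (_∷ φ b ∷ φ a ∷ []) (sym (φ-neg c))
  turn-map ⁅23⁆  (a ∷ b ∷ c ∷ []) = cong (λ x → φ a ∷ x ∷ φ b ∷ []) (sym (φ-neg c))
  turn-map ⁅123⁆ (a ∷ b ∷ c ∷ []) = cong (_∷ φ a ∷ φ b ∷ []) (sym (φ-neg c))

  turns-map : ∀ D u → turns neg′ D (Vec.map φ u) ≡ Vec.map φ (turns neg D u)
  turns-map []      u = refl
  turns-map (S ∷ D) u = trans (cong (turns neg′ D) (turn-map S u)) (turns-map D (turn neg S u))

-- (s , i) stands for s times the i-th coordinate.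
Literal : Set
Literal = Sign × Fin 3

negate : Literal → Literal
negate (s , i) = Sign.opposite s , i

matrix : 𝒟₃ → Vec Literal 3
matrix D = turns negate D ((Sign.+ , # 0) ∷ (Sign.+ , # 1) ∷ (Sign.+ , # 2) ∷ [])

value : ∀ {A : Set} → (A → A) → Vec A 3 → Literal → A
value neg u (Sign.+ , i) = lookup u i
value neg u (Sign.- , i) = neg (lookup u i)

-- `matrix D` is the action on formal coordinates, and evaluating literals at u commutes with every
-- column. Involutivity of `neg` makes evaluation respect the negation of a negative literal.
turns-matrix : ∀ {A : Set} {neg : A → A} → (∀ a → neg (neg a) ≡ a) →
  ∀ D u → turns neg D u ≡ Vec.map (value neg u) (matrix D)
turns-matrix {neg = neg} involutive D u@(_ ∷ _ ∷ _ ∷ []) = turns-map (value neg u)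
  (λ { (Sign.+ , i) → refl ; (Sign.- , i) → sym (involutive (lookup u i)) }) D _

matrix-∷ : ∀ S D → matrix (S ∷ D) ≡ Vec.map (value negate (matrix (C S))) (matrix D)
matrix-∷ S D = turns-matrix (λ (s , i) → cong (_, i) (Sign.opposite-involutive s)) D (matrix (C S))

0ⱽ : Vec ℤ 3
0ⱽ = Vec.replicate 3 0ℤ

-ⱽ_ : Vec ℤ 3 → Vec ℤ 3
-ⱽ u = Vec.map -_ u

vec≡ : ∀ {a b c a′ b′ c′ : ℤ} → a ≡ a′ → b ≡ b′ → c ≡ c′ → (Vec ℤ 3 ∋ a ∷ b ∷ c ∷ []) ≡ a′ ∷ b′ ∷ c′ ∷ []
vec≡ refl refl refl = refl

turnsℤ : 𝒟₃ → Vec ℤ 3 → Vec ℤ 3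
turnsℤ D u = turns -_ D u

turnsℤ-cong : ∀ D E → matrix D ≡ matrix E → ∀ u → turnsℤ D u ≡ turnsℤ E u
turnsℤ-cong D E eq u = trans (turns-matrix ℤ.neg-involutive D u)
  (trans (cong (Vec.map (value -_ u)) eq) (sym (turns-matrix ℤ.neg-involutive E u)))

turnsℤ-neg : ∀ D u → turnsℤ D (-ⱽ u) ≡ -ⱽ (turnsℤ D u)
turnsℤ-neg = turns-map -_ (λ _ → refl)

-- Dependence of the column product on the image in S₄ × {±1}

_≟ᴹ_ : DecidableEquality (Vec Literal 3)
_≟ᴹ_ = Vec.≡-dec (Product.≡-dec Sign._≟_ Fin._≟_)

abstract
  -- Code and matrix must lead to the same word W′; this is what lets equality of codes imply
  -- equality of matrices.
  matrix-words : All (λ S → All (λ W → Any (λ W′ → act S (codeΨ W) ≡ codeΨ W′ ×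
    matrix (S ∷ W) ≡ matrix W′) words) words) (allSubsets 3)
  matrix-words = Dec.from-yes (All.all? (λ S → All.all? (λ W → Any.any? (λ W′ →
    act S (codeΨ W) ≟ᶜ codeΨ W′ ×-dec matrix (S ∷ W) ≟ᴹ matrix W′) words) words) (allSubsets 3))

wordOf : ∀ D → ∃[ W ] W ∈ᴸ words × codeΨ D ≡ codeΨ W × matrix D ≡ matrix W
wordOf []      = [] , here refl , refl , refl
wordOf (S ∷ D) =
  let (W , W∈ , code≡ , matrix≡)     = wordOf D
      (W′ , W′∈ , code≡′ , matrix≡′) = find (All.lookup (All.lookup matrix-words (∈-allSubsets S)) W∈)
  in W′ , W′∈ , trans (cong (act S) code≡) code≡′ ,
     trans (matrix-∷ S D) (trans (cong (Vec.map (value negate (matrix (C S)))) matrix≡) (trans (sym (matrix-∷ S W)) matrix≡′))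

-- Both diagrams share code and matrix with a word, and words with equal codes coincide by `check₂`.
matrix-Ψ : ∀ D E → Ψ D 𝔾.≈ Ψ E → matrix D ≡ matrix E
matrix-Ψ D E ΨD≈ΨE =
  let (W , W∈ , code≡ , matrix≡)     = wordOf D
      (W′ , W′∈ , code≡′ , matrix≡′) = wordOf E
      W≡W′ = All.lookup (All.lookup check₂ W∈) W′∈ (trans (sym code≡) (trans (sym (codeΨ-correct D))
               (trans (≈-code (Ψ D) (Ψ E) ΨD≈ΨE) (trans (codeΨ-correct E) code≡′))))
  in trans matrix≡ (trans (cong matrix W≡W′) (sym matrix≡′))

-- Directions of the 13 rotation axes of the cube: through faces, edges and vertices. A nonzero
-- eigenspace of a signed permutation matrix for -1 contains one of them.
lines : List (Vec ℤ 3)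
lines = (0ℤ ∷ 0ℤ ∷ 1ℤ ∷ []) ∷ (0ℤ ∷ 1ℤ ∷ 0ℤ ∷ []) ∷ (1ℤ ∷ 0ℤ ∷ 0ℤ ∷ [])
  ∷ (0ℤ ∷ 1ℤ ∷ 1ℤ ∷ []) ∷ (0ℤ ∷ 1ℤ ∷ -1ℤ ∷ []) ∷ (1ℤ ∷ 0ℤ ∷ 1ℤ ∷ [])
  ∷ (1ℤ ∷ 0ℤ ∷ -1ℤ ∷ []) ∷ (1ℤ ∷ 1ℤ ∷ 0ℤ ∷ []) ∷ (1ℤ ∷ -1ℤ ∷ 0ℤ ∷ [])
  ∷ (1ℤ ∷ 1ℤ ∷ 1ℤ ∷ []) ∷ (1ℤ ∷ 1ℤ ∷ -1ℤ ∷ []) ∷ (1ℤ ∷ -1ℤ ∷ 1ℤ ∷ []) ∷ (-1ℤ ∷ 1ℤ ∷ 1ℤ ∷ []) ∷ []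

-- For `rep₂`, the square (1 3)(2 4) of (1 2 3 4) times the square (1 4 2) of (1 2 4) is (1 2 3),
-- and the signs of the two full columns cancel.
rep₁ rep₂ rep₃ : 𝒟₃
rep₁ = []
rep₂ = ⁅23⁆ ∷ ⁅23⁆ ∷ ⁅123⁆ ∷ ⁅123⁆ ∷ []
rep₃ = C ⁅23⁆

representatives : List 𝒟₃
representatives = rep₁ ∷ rep₂ ∷ rep₃ ∷ []

abstract
  -- The second alternative is conjugacy written without inverses, as an equation of codes, with the
  -- conjugating element also taken from `words`.
  classify-words : All (λ W → Any (λ w → turnsℤ W w ≡ -ⱽ w × w ≢ 0ⱽ) lines ⊎
    Any (λ X → Any (λ E → codeΨ (W ⋆ E) ≡ codeΨ (E ⋆ X)) words) representatives) words
  classify-words = Dec.from-yes (All.all? (λ W →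
    Any.any? (λ w → (Vec.≡-dec ℤ._≟_ (turnsℤ W w) (-ⱽ w)) ×-dec ¬? (Vec.≡-dec ℤ._≟_ w 0ⱽ)) lines ⊎-dec
    Any.any? (λ X → Any.any? (λ E → codeΨ (W ⋆ E) ≟ᶜ codeΨ (E ⋆ X)) words) representatives) words)

-- Conjugacy as an equation between diagrams

module _ {a ℓ} (G : Group a ℓ) where
  private
    module G = Group G
  open GroupProperties G using (x≈z//y; //-rightDividesˡ)

  conjugate⇒intertwined : ∀ x y g → y G.≈ g G.∙ x G.∙ g G.⁻¹ → y G.∙ g G.≈ g G.∙ x
  conjugate⇒intertwined x y g eq = G.trans (G.∙-congʳ eq) (//-rightDividesˡ g (g G.∙ x))

  intertwined⇒conjugate : ∀ x y g → y G.∙ g G.≈ g G.∙ x → y G.≈ g G.∙ x G.∙ g G.⁻¹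
  intertwined⇒conjugate x y g = x≈z//y y g (g G.∙ x)

-- An equation between values of Ψ at diagrams can be carried over to the column products by
-- `matrix-Ψ`. Surjectivity of Ψ supplies a diagram E for any conjugating element.
Conjugate : 𝒟₃ → 𝒟₃ → Set
Conjugate X D = ∃[ E ] Ψ (D ⋆ E) 𝔾.≈ Ψ (E ⋆ X)

class⇒Conjugate : ∀ X x → Ψ X 𝔾.≈ x → ∀ D → ConjugacyClass x (Ψ D) → Conjugate X D
class⇒Conjugate X x ΨX≈x D (g , eq) =
  let (E , ΨE≈g) = Ψ-surjective g in E , (begin
    Ψ (D ⋆ E)      ≈⟨ Ψ-⋆ D E ⟩
    Ψ D 𝔾.∙ Ψ E    ≈⟨ 𝔾.∙-congˡ {Ψ D} {Ψ E} {g} ΨE≈g ⟩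
    Ψ D 𝔾.∙ g      ≈⟨ conjugate⇒intertwined S₄×±1 x (Ψ D) g eq ⟩
    g 𝔾.∙ x        ≈⟨ 𝔾.∙-cong {Ψ E} {g} {Ψ X} {x} ΨE≈g ΨX≈x ⟨
    Ψ E 𝔾.∙ Ψ X    ≈⟨ Ψ-⋆ E X ⟨
    Ψ (E ⋆ X)      ∎)
  where open SetoidReasoning 𝔾.setoid

Conjugate⇒class : ∀ X x → Ψ X 𝔾.≈ x → ∀ D → Conjugate X D → ConjugacyClass x (Ψ D)
Conjugate⇒class X x ΨX≈x D (E , eq) = Ψ E , intertwined⇒conjugate S₄×±1 x (Ψ D) (Ψ E) (begin
    Ψ D 𝔾.∙ Ψ E    ≈⟨ Ψ-⋆ D E ⟨
    Ψ (D ⋆ E)      ≈⟨ eq ⟩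
    Ψ (E ⋆ X)      ≈⟨ Ψ-⋆ E X ⟩
    Ψ E 𝔾.∙ Ψ X    ≈⟨ 𝔾.∙-congˡ {Ψ E} {Ψ X} {x} ΨX≈x ⟩
    Ψ E 𝔾.∙ x      ∎)
  where open SetoidReasoning 𝔾.setoid

-- Absence of the eigenvalue -1 as a class property

neg≡0⇒≡0 : ∀ {a} → - a ≡ 0ℤ → a ≡ 0ℤ
neg≡0⇒≡0 = ℤ.neg-injective

≡neg⇒≡0 : ∀ a → a ≡ - a → a ≡ 0ℤ
≡neg⇒≡0 (ℤ.+ zero) eq = refl

coordinates : ∀ {a b c a′ b′ c′ : ℤ} → (Vec ℤ 3 ∋ a ∷ b ∷ c ∷ []) ≡ a′ ∷ b′ ∷ c′ ∷ [] → a ≡ a′ × b ≡ b′ × c ≡ c′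
coordinates refl = refl , refl , refl

turn-≡0 : ∀ S u → turn -_ S u ≡ 0ⱽ → u ≡ 0ⱽ
turn-≡0 ∅     (a ∷ b ∷ c ∷ []) eq = eq
turn-≡0 ⁅1⁆   (a ∷ b ∷ c ∷ []) eq = let (p , q , r) = coordinates eq in vec≡ (neg≡0⇒≡0 p) q r
turn-≡0 ⁅2⁆   (a ∷ b ∷ c ∷ []) eq = let (p , q , r) = coordinates eq in vec≡ p (neg≡0⇒≡0 q) r
turn-≡0 ⁅3⁆   (a ∷ b ∷ c ∷ []) eq = let (p , q , r) = coordinates eq in vec≡ p q (neg≡0⇒≡0 r)
turn-≡0 ⁅12⁆  (a ∷ b ∷ c ∷ []) eq = let (p , q , r) = coordinates eq in vec≡ q (neg≡0⇒≡0 p) r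
turn-≡0 ⁅13⁆  (a ∷ b ∷ c ∷ []) eq = let (p , q , r) = coordinates eq in vec≡ r q (neg≡0⇒≡0 p)
turn-≡0 ⁅23⁆  (a ∷ b ∷ c ∷ []) eq = let (p , q , r) = coordinates eq in vec≡ p r (neg≡0⇒≡0 q)
turn-≡0 ⁅123⁆ (a ∷ b ∷ c ∷ []) eq = let (p , q , r) = coordinates eq in vec≡ q r (neg≡0⇒≡0 p)

turns-≡0 : ∀ D u → turnsℤ D u ≡ 0ⱽ → u ≡ 0ⱽ
turns-≡0 []      u eq = eq
turns-≡0 (S ∷ D) u eq = turn-≡0 S u (turns-≡0 D (turn -_ S u) eq)

Regular : 𝒟₃ → Set
Regular D = ∀ u → turnsℤ D u ≡ -ⱽ u → u ≡ 0ⱽ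

rep₁-regular : Regular rep₁
rep₁-regular (a ∷ b ∷ c ∷ []) eq = let (p , q , r) = coordinates eq in vec≡ (≡neg⇒≡0 a p) (≡neg⇒≡0 b q) (≡neg⇒≡0 c r)

rep₂-regular : Regular rep₂
rep₂-regular (a ∷ b ∷ c ∷ []) eq = vec≡ a≡0 b≡0 c≡0
  where
  p = proj₁ (coordinates eq)
  q = proj₁ (proj₂ (coordinates eq))
  r = proj₂ (proj₂ (coordinates eq))
  b≡-a : b ≡ - a
  b≡-a = trans (sym (ℤ.neg-involutive b)) p
  a≡b : a ≡ b
  a≡b = trans r (trans (cong -_ (trans (sym (ℤ.neg-involutive c)) q)) (ℤ.neg-involutive b))
  a≡0 : a ≡ 0ℤ
  a≡0 = ≡neg⇒≡0 a (trans a≡b b≡-a)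
  b≡0 : b ≡ 0ℤ
  b≡0 = trans (sym a≡b) a≡0
  c≡0 : c ≡ 0ℤ
  c≡0 = neg≡0⇒≡0 (trans (sym r) a≡0)

rep₃-regular : Regular rep₃
rep₃-regular (a ∷ b ∷ c ∷ []) eq = vec≡ (≡neg⇒≡0 a p) b≡0 (neg≡0⇒≡0 (trans (sym r) b≡0))
  where
  p = proj₁ (coordinates eq)
  q = proj₁ (proj₂ (coordinates eq))
  r = proj₂ (proj₂ (coordinates eq))
  b≡0 : b ≡ 0ℤ
  b≡0 = ≡neg⇒≡0 b (trans r q)

-- The leftmost column acts first, so the conjugacy equation says that E after D equals X after E.
-- Hence E carries eigenvectors of D for -1 to those of X, and it is injective by `turns-≡0`.
Conjugate-regular : ∀ X D → Conjugate X D → Regular X → Regular D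
Conjugate-regular X D (E , eq) X-regular u Du≡-u = turns-≡0 E u (X-regular (turnsℤ E u) (begin
  turnsℤ X (turnsℤ E u)    ≡⟨ turns-⋆ -_ E X u ⟨
  turnsℤ (E ⋆ X) u         ≡⟨ turnsℤ-cong (D ⋆ E) (E ⋆ X) (matrix-Ψ (D ⋆ E) (E ⋆ X) eq) u ⟨
  turnsℤ (D ⋆ E) u         ≡⟨ turns-⋆ -_ D E u ⟩
  turnsℤ E (turnsℤ D u)    ≡⟨ cong (turnsℤ E) Du≡-u ⟩
  turnsℤ E (-ⱽ u)          ≡⟨ turnsℤ-neg E u ⟩
  -ⱽ turnsℤ E u            ∎))
  where open ≡-Reasoning

classify : ∀ D → (∃[ w ] turnsℤ D w ≡ -ⱽ w × w ≢ 0ⱽ) ⊎ Any (λ X → Conjugate X D) representatives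
classify D with wordOf D
... | W , W∈ , code≡ , matrix≡ with All.lookup classify-words W∈
... | inj₁ eigen = let (w , _ , eq , w≢0) = find eigen in inj₁ (w , trans (turnsℤ-cong D W matrix≡ w) eq , w≢0)
... | inj₂ class = inj₂ (Any.map (λ {X} conj → let (E , _ , eq) = find conj in E , intertwine X E eq) class)
  where
  codeΨ-congˡ : ∀ E → codeΨ (D ⋆ E) ≡ codeΨ (W ⋆ E)
  codeΨ-congˡ E = trans (sym (codeΨ-correct (D ⋆ E))) (trans (≈-code (Ψ (D ⋆ E)) (Ψ (W ⋆ E)) (begin
    Ψ (D ⋆ E)     ≈⟨ Ψ-⋆ D E ⟩
    Ψ D 𝔾.∙ Ψ E   ≈⟨ 𝔾.∙-congʳ {Ψ E} {Ψ D} {Ψ W} (codeΨ-≈ D (Ψ W) (trans code≡ (sym (codeΨ-correct W)))) ⟩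
    Ψ W 𝔾.∙ Ψ E   ≈⟨ Ψ-⋆ W E ⟨
    Ψ (W ⋆ E)     ∎)) (codeΨ-correct (W ⋆ E)))
    where open SetoidReasoning 𝔾.setoid
  intertwine : ∀ X E → codeΨ (W ⋆ E) ≡ codeΨ (E ⋆ X) → Ψ (D ⋆ E) 𝔾.≈ Ψ (E ⋆ X)
  intertwine X E eq = codeΨ-≈ (D ⋆ E) (Ψ (E ⋆ X)) (trans (codeΨ-congˡ E) (trans eq (sym (codeΨ-correct (E ⋆ X)))))

-- The linear system of a diagram

∑ᴺ : ∀ {A : Set} → List A → (A → ℤ) → ℤ
∑ᴺ xs φ = sum (φ ∘ List.lookup xs)

∑ᴺ-++ : ∀ {A : Set} (xs ys : List A) φ → ∑ᴺ (xs ++ ys) φ ≡ ∑ᴺ xs φ + ∑ᴺ ys φ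
∑ᴺ-++ []       ys φ = sym (ℤ.+-identityˡ (∑ᴺ ys φ))
∑ᴺ-++ (x ∷ xs) ys φ = trans (cong (φ x +_) (∑ᴺ-++ xs ys φ)) (sym (ℤ.+-assoc (φ x) (∑ᴺ xs φ) (∑ᴺ ys φ)))

∑ᴺ-map : ∀ {A B : Set} (f : A → B) xs φ → ∑ᴺ (map f xs) φ ≡ ∑ᴺ xs (φ ∘ f)
∑ᴺ-map f []       φ = refl
∑ᴺ-map f (x ∷ xs) φ = cong (φ (f x) +_) (∑ᴺ-map f xs φ)

∑ᴺ-× : ∀ {A B : Set} (xs : List A) (ys : List B) φ →
  ∑ᴺ (cartesianProduct xs ys) φ ≡ ∑ᴺ xs λ x → ∑ᴺ ys λ y → φ (x , y)
∑ᴺ-× []       ys φ = refl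
∑ᴺ-× (x ∷ xs) ys φ = trans (∑ᴺ-++ (map (x ,_) ys) (cartesianProduct xs ys) φ) (cong₂ _+_ (∑ᴺ-map (x ,_) ys φ) (∑ᴺ-× xs ys φ))

∑ᴺ-tabulate : ∀ {A : Set} {n} (f : Fin n → A) φ → ∑ᴺ (List.tabulate f) φ ≡ sum (φ ∘ f)
∑ᴺ-tabulate {n = zero}  f φ = refl
∑ᴺ-tabulate {n = suc n} f φ = cong (φ (f zero) +_) (∑ᴺ-tabulate (f ∘ suc) φ)

-- Used to turn sums over labels of white squares into sums over the grid.
∑ᴺ-filter : ∀ {A : Set} {P : Pred A 0ℓ} (P? : Decidable P) xs φ → (∀ x → ¬ P x → φ x ≡ 0ℤ) →
  ∑ᴺ (filter P? xs) φ ≡ ∑ᴺ xs φ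
∑ᴺ-filter P? []       φ φ≡0 = refl
∑ᴺ-filter P? (x ∷ xs) φ φ≡0 with P? x
... | yes _  = cong (φ x +_) (∑ᴺ-filter P? xs φ φ≡0)
... | no ¬Px = trans (∑ᴺ-filter P? xs φ φ≡0) (trans (sym (ℤ.+-identityˡ (∑ᴺ xs φ))) (cong (_+ ∑ᴺ xs φ) (sym (φ≡0 x ¬Px))))

∑□ : ∀ {n} → (Square n → ℤ) → ℤ
∑□ φ = sum λ i → sum λ j → φ (i , j)

∑ᴺ-squares : ∀ n φ → ∑ᴺ (squares n) φ ≡ ∑□ φ
∑ᴺ-squares n φ = trans (∑ᴺ-× (allFin 3) (allFin n) φ) (trans (∑ᴺ-tabulate {n = 3} id (λ i → ∑ᴺ (allFin n) λ j → φ (i , j)))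
  (sum-cong-≗ λ i → ∑ᴺ-tabulate id λ j → φ (i , j)))

lookup-injective : ∀ {A : Set} {xs : List A} → Unique xs → ∀ i j → List.lookup xs i ≡ List.lookup xs j → i ≡ j
lookup-injective (x∉ ∷ u) zero    zero    eq = refl
lookup-injective (x∉ ∷ u) zero    (suc j) eq = contradiction eq (All.lookup x∉ (∈-lookup j))
lookup-injective (x∉ ∷ u) (suc i) zero    eq = contradiction (sym eq) (All.lookup x∉ (∈-lookup i))
lookup-injective (x∉ ∷ u) (suc i) (suc j) eq = cong suc (lookup-injective u i j eq)

-- Unknowns on the whole grid that vanish on black squares replace unknowns indexed by labels,
-- because removing a column would renumber the labels.
Supported : ∀ D → (Square (length D) → ℤ) → Set
Supported D X = ∀ i j → i ∉ List.lookup D j → X (i , j) ≡ 0ℤ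

-- The right side v is there for the induction: it collects the row sums of x over the columns
-- already removed on the left, which enter the equations with coefficient -1. Thus
-- `rowSum X i - v i` is u at the cut before D.
Solves : ∀ D → (v : Fin 3 → ℤ) → (Square (length D) → ℤ) → Set
Solves D v X = ∀ i j → i ∈ List.lookup D j → ∑□ (λ q → entry (i , j) q * X q) ≡ v i

module _ (D : 𝒟₃) where

  private
    white : Fin (length (whiteSquares D)) → Square (length D)
    white = List.lookup (whiteSquares D)

    _∈ᵂ?_ : ∀ (q : Square (length D)) qs → Dec (q ∈ᴸ qs)
    _∈ᵂ?_ = DecMembership._∈?_ (Product.≡-dec Fin._≟_ Fin._≟_)

    white-unique : Unique (whiteSquares D)
    white-unique = Unique.filter⁺ (white? D) (Unique.cartesianProduct⁺ (Unique.allFin⁺ 3) (Unique.allFin⁺ (length D)))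

    white-complete : ∀ i j → i ∈ List.lookup D j → (i , j) ∈ᴸ whiteSquares D
    white-complete i j i∈ = ∈-filter⁺ (white? D) (∈-cartesianProduct⁺ (∈-allFin i) (∈-allFin j)) i∈

    M-sum : ∀ {X} → Supported D X → ∀ a → sum (λ b → M D a b * X (white b)) ≡ ∑□ λ q → entry (white a) q * X q
    M-sum {X} supported a = trans
      (∑ᴺ-filter (white? D) (squares (length D)) (λ q → entry (white a) q * X q) λ (i , j) i∉ →
        trans (cong (entry (white a) (i , j) *_) (supported i j i∉)) (ℤ.*-zeroʳ (entry (white a) (i , j))))
      (∑ᴺ-squares (length D) λ q → entry (white a) q * X q)

  extend : (Fin (length (whiteSquares D)) → ℤ) → Square (length D) → ℤ
  extend x q with q ∈ᵂ? whiteSquares D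
  ... | yes q∈ = x (Any.index q∈)
  ... | no  _  = 0ℤ

  extend-white : ∀ x b → extend x (white b) ≡ x b
  extend-white x b with white b ∈ᵂ? whiteSquares D
  ... | yes q∈ = cong x (lookup-injective white-unique (Any.index q∈) b (sym (lookup-index q∈)))
  ... | no  q∉ = contradiction (∈-lookup b) q∉

  extend-supported : ∀ x → Supported D (extend x)
  extend-supported x i j i∉ with (i , j) ∈ᵂ? whiteSquares D
  ... | yes q∈ = contradiction (proj₂ (∈-filter⁻ (white? D) {xs = squares (length D)} q∈)) i∉
  ... | no  _  = refl

  kernel⇒solution : HasKernel (M D) → ∃[ X ] Supported D X × Solves D (λ _ → 0ℤ) X × ∃[ q ] X q ≢ 0ℤ
  kernel⇒solution (kernel x Mx≡0 c xc≢0) = extend x , extend-supported x , solves ,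
    white c , λ eq → xc≢0 (trans (sym (extend-white x c)) eq)
    where
    solves-white : ∀ a → ∑□ (λ q → entry (white a) q * extend x q) ≡ 0ℤ
    solves-white a = trans (sym (M-sum (extend-supported x) a))
      (trans (sum-cong-≗ λ b → cong (M D a b *_) (extend-white x b)) (Mx≡0 a))
    solves : Solves D (λ _ → 0ℤ) (extend x)
    solves i j i∈ = subst (λ p → ∑□ (λ q → entry p q * extend x q) ≡ 0ℤ)
      (sym (lookup-index (white-complete i j i∈))) (solves-white (Any.index (white-complete i j i∈)))

  solution⇒kernel : ∀ {X} → Supported D X → Solves D (λ _ → 0ℤ) X → HasKernel (M D) ⊎ (∀ q → X q ≡ 0ℤ)
  solution⇒kernel {X} supported solves with pivot? (X ∘ white)
  ... | inj₁ (c , Xc≢0) = inj₁ (kernel (X ∘ white)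
    (λ a → trans (M-sum supported a)
      (solves _ _ (proj₂ (∈-filter⁻ (white? D) {xs = squares (length D)} (∈-lookup a))))) c Xc≢0)
  ... | inj₂ white≡0 = inj₂ zero-everywhere
    where
    zero-everywhere : ∀ q → X q ≡ 0ℤ
    zero-everywhere (i , j) with i ∈? List.lookup D j
    ... | yes i∈ = trans (cong X (lookup-index (white-complete i j i∈))) (white≡0 (Any.index (white-complete i j i∈)))
    ... | no  i∉ = supported i j i∉

-- Removing the first column

later : ∀ {n} → (Square (suc n) → ℤ) → Square n → ℤ
later X (i , j) = X (i , suc j)

rowSum : ∀ {n} → (Square n → ℤ) → Fin 3 → ℤ
rowSum X i = sum λ j → X (i , j)

-- The matrix A of a full column.
columnEntry : Fin 3 → Fin 3 → ℤ
columnEntry i k = entry {1} (i , zero) (k , zero)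

columnSum : (Fin 3 → ℤ) → Fin 3 → ℤ
columnSum x i = sum λ k → columnEntry i k * x k

module _ {n : ℕ} where

  entry-right : ∀ i k l → k ≢ i → entry {suc n} (i , zero) (k , suc l) ≡ 0ℤ
  entry-right ① ① l k≢i = contradiction refl k≢i
  entry-right ① ② l k≢i = refl
  entry-right ① ③ l k≢i = refl
  entry-right ② ① l k≢i = refl
  entry-right ② ② l k≢i = contradiction refl k≢i
  entry-right ② ③ l k≢i = refl
  entry-right ③ ① l k≢i = refl
  entry-right ③ ② l k≢i = refl
  entry-right ③ ③ l k≢i = contradiction refl k≢i

  entry-left : ∀ i j k → k ≢ i → entry {suc n} (i , suc j) (k , zero) ≡ 0ℤ
  entry-left ① j ① k≢i = contradiction refl k≢i
  entry-left ① j ② k≢i = refl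
  entry-left ① j ③ k≢i = refl
  entry-left ② j ① k≢i = refl
  entry-left ② j ② k≢i = contradiction refl k≢i
  entry-left ② j ③ k≢i = refl
  entry-left ③ j ① k≢i = refl
  entry-left ③ j ② k≢i = refl
  entry-left ③ j ③ k≢i = contradiction refl k≢i

  entry-right-same : ∀ i l → entry {suc n} (i , zero) (i , suc l) ≡ 1ℤ
  entry-right-same ① l = refl
  entry-right-same ② l = refl
  entry-right-same ③ l = refl

  entry-left-same : ∀ i j → entry {suc n} (i , suc j) (i , zero) ≡ -1ℤ
  entry-left-same ① j = refl
  entry-left-same ② j = refl
  entry-left-same ③ j = refl

module _ {n : ℕ} (X : Square (suc n) → ℤ) where

  ∑□-first : ∀ i → ∑□ (λ q → entry (i , zero) q * X q) ≡ columnSum (λ k → X (k , zero)) i + rowSum (later X) i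
  ∑□-first i = begin
    sum (λ k → columnEntry i k * X (k , zero) + row k)
      ≡⟨ ∑-distrib-+ (λ k → columnEntry i k * X (k , zero)) row ⟩
    columnSum (λ k → X (k , zero)) i + sum row
      ≡⟨ cong (columnSum (λ k → X (k , zero)) i +_) (sum-single i {row} λ k k≢i → sum-zero λ l →
           cong (_* X (k , suc l)) (entry-right i k l k≢i)) ⟩
    columnSum (λ k → X (k , zero)) i + row i
      ≡⟨ cong (columnSum (λ k → X (k , zero)) i +_) (sum-cong-≗ λ l →
           trans (cong (_* X (i , suc l)) (entry-right-same i l)) (ℤ.*-identityˡ (X (i , suc l)))) ⟩
    columnSum (λ k → X (k , zero)) i + rowSum (later X) i ∎
    where
    open ≡-Reasoning
    row : Fin 3 → ℤ
    row k = sum λ l → entry {suc n} (i , zero) (k , suc l) * X (k , suc l)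

  ∑□-later : ∀ i j → ∑□ (λ q → entry (i , suc j) q * X q) ≡ - X (i , zero) + ∑□ λ q → entry (i , j) q * later X q
  ∑□-later i j = begin
    sum (λ k → left k + row k)
      ≡⟨ ∑-distrib-+ left row ⟩
    sum left + sum row
      ≡⟨ cong (_+ sum row) (sum-single i {left} λ k k≢i → cong (_* X (k , zero)) (entry-left i j k k≢i)) ⟩
    left i + sum row
      ≡⟨ cong (_+ sum row) (trans (cong (_* X (i , zero)) (entry-left-same i j)) (ℤ.-1*i≡-i (X (i , zero)))) ⟩
    - X (i , zero) + sum row ∎
    where
    open ≡-Reasoning
    left row : Fin 3 → ℤ
    left k = entry {suc n} (i , suc j) (k , zero) * X (k , zero)
    row k = sum λ l → entry {n} (i , j) (k , l) * X (k , suc l)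

module _ {S D} X (supported : Supported (S ∷ D) X) where

  supported-first : ∀ i → i ∉ S → X (i , zero) ≡ 0ℤ
  supported-first i = supported i zero

  supported-later : Supported D (later X)
  supported-later i j = supported i (suc j)

module _ {S D} v X (solves : Solves (S ∷ D) v X) where

  solves-first : ∀ i → i ∈ S → v i - rowSum (later X) i ≡ columnSum (λ k → X (k , zero)) i
  solves-first i i∈S = trans (cong (_- rowSum (later X) i) (trans (sym (solves i zero i∈S)) (∑□-first X i)))
    (cancel (columnSum (λ k → X (k , zero)) i) (rowSum (later X) i))
    where
    cancel : ∀ a b → a + b - b ≡ a
    cancel = solve-∀

  solves-later : Solves D (λ i → v i + X (i , zero)) (later X)
  solves-later i j i∈ = trans (cancel (X (i , zero)) (∑□ λ q → entry (i , j) q * later X q))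
    (cong (_+ X (i , zero)) (trans (sym (∑□-later X i j)) (solves i (suc j) i∈)))
    where
    cancel : ∀ a b → b ≡ - a + b + a
    cancel = solve-∀

-- The equations of one column

vec : (Fin 3 → ℤ) → Vec ℤ 3
vec = Vec.tabulate

columnSum-① : ∀ x → columnSum x ① ≡ x ② + x ③
columnSum-① x = lemma (x ①) (x ②) (x ③)
  where
  lemma : ∀ a b c → 0ℤ * a + (1ℤ * b + (1ℤ * c + 0ℤ)) ≡ b + c
  lemma = solve-∀

columnSum-② : ∀ x → columnSum x ② ≡ - x ① + x ③
columnSum-② x = lemma (x ①) (x ②) (x ③)
  where
  lemma : ∀ a b c → -1ℤ * a + (0ℤ * b + (1ℤ * c + 0ℤ)) ≡ - a + c
  lemma = solve-∀

columnSum-③ : ∀ x → columnSum x ③ ≡ - x ① + - x ②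
columnSum-③ x = lemma (x ①) (x ②) (x ③)
  where
  lemma : ∀ a b c → -1ℤ * a + (-1ℤ * b + (0ℤ * c + 0ℤ)) ≡ - a + - b
  lemma = solve-∀

module _ where
  private
    black : ∀ x d → x ≡ 0ℤ → x - d ≡ - d - x
    black _ d refl = lemma d
      where
      lemma : ∀ d → 0ℤ - d ≡ - d - 0ℤ
      lemma = solve-∀

    -- The indices are white rows: `next` moves the value of the upper one down unchanged, `wrap`
    -- moves that of the lower one up with the opposite sign. In `wrap₁₂`, `next₁₃` and `wrap₂₃` the
    -- third row is black.
    next₁₂ : ∀ a b c d e → d ≡ b + c → e ≡ - a + c → a - d ≡ - e - b
    next₁₂ a b c _ _ refl refl = lemma a b c
      where
      lemma : ∀ a b c → a - (b + c) ≡ - (- a + c) - b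
      lemma = solve-∀

    next₂₃ : ∀ a b c e f → e ≡ - a + c → f ≡ - a + - b → b - e ≡ - f - c
    next₂₃ a b c _ _ refl refl = lemma a b c
      where
      lemma : ∀ a b c → b - (- a + c) ≡ - (- a + - b) - c
      lemma = solve-∀

    wrap₁₃ : ∀ a b c d f → d ≡ b + c → f ≡ - a + - b → - (c - f) ≡ - d - a
    wrap₁₃ a b c _ _ refl refl = lemma a b c
      where
      lemma : ∀ a b c → - (c - (- a + - b)) ≡ - (b + c) - a
      lemma = solve-∀

    wrap₁₂ : ∀ a b c d e → c ≡ 0ℤ → d ≡ b + c → e ≡ - a + c → - (b - e) ≡ - d - a
    wrap₁₂ a b _ _ _ refl refl refl = lemma a b
      where
      lemma : ∀ a b → - (b - (- a + 0ℤ)) ≡ - (b + 0ℤ) - a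
      lemma = solve-∀

    next₁₃ : ∀ a b c d f → b ≡ 0ℤ → d ≡ b + c → f ≡ - a + - b → a - d ≡ - f - c
    next₁₃ a _ c _ _ refl refl refl = lemma a c
      where
      lemma : ∀ a c → a - (0ℤ + c) ≡ - (- a + - 0ℤ) - c
      lemma = solve-∀

    wrap₂₃ : ∀ a b c e f → a ≡ 0ℤ → e ≡ - a + c → f ≡ - a + - b → - (c - f) ≡ - e - b
    wrap₂₃ _ b c _ _ refl refl refl = lemma b c
      where
      lemma : ∀ b c → - (c - (- 0ℤ + - b)) ≡ - (- 0ℤ + c) - b
      lemma = solve-∀

    single : ∀ x d → d ≡ 0ℤ → - (x - d) ≡ - d - x
    single x _ refl = lemma x
      where
      lemma : ∀ x → - (x - 0ℤ) ≡ - 0ℤ - x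
      lemma = solve-∀

  -- The equations (1 - A) x = u of a column, with u = x - d.
  column-turn : ∀ S (x d : Fin 3 → ℤ) → (∀ i → i ∉ S → x i ≡ 0ℤ) → (∀ i → i ∈ S → d i ≡ columnSum x i) →
    turn -_ S (vec λ i → x i - d i) ≡ vec λ i → - d i - x i
  column-turn S x d out solves = go S out (λ ①∈ → trans (solves ① ①∈) (columnSum-① x))
    (λ ②∈ → trans (solves ② ②∈) (columnSum-② x)) (λ ③∈ → trans (solves ③ ③∈) (columnSum-③ x))
    where
    x₁ = x ①
    x₂ = x ②
    x₃ = x ③
    d₁ = d ①
    d₂ = d ②
    d₃ = d ③
    go : ∀ S → (∀ i → i ∉ S → x i ≡ 0ℤ) → (① ∈ S → d ① ≡ x ② + x ③) → (② ∈ S → d ② ≡ - x ① + x ③) →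
      (③ ∈ S → d ③ ≡ - x ① + - x ②) → turn -_ S (vec λ i → x i - d i) ≡ vec λ i → - d i - x i
    go ∅     out e₁ e₂ e₃ = vec≡ (black x₁ d₁ (out ① λ ())) (black x₂ d₂ (out ② λ { (there ()) })) (black x₃ d₃ (out ③ λ { (there (there ())) }))
    go ⁅1⁆   out e₁ e₂ e₃ = vec≡
      (single x₁ d₁ (trans (e₁ here) (cong₂ _+_ (out ② λ { (there ()) }) (out ③ λ { (there (there ())) }))))
      (black x₂ d₂ (out ② λ { (there ()) })) (black x₃ d₃ (out ③ λ { (there (there ())) }))
    go ⁅2⁆   out e₁ e₂ e₃ = vec≡
      (black x₁ d₁ (out ① λ ()))
      (single x₂ d₂ (trans (e₂ (there here)) (cong₂ (λ a b → - a + b) (out ① λ ()) (out ③ λ { (there (there ())) }))))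
      (black x₃ d₃ (out ③ λ { (there (there ())) }))
    go ⁅3⁆   out e₁ e₂ e₃ = vec≡
      (black x₁ d₁ (out ① λ ())) (black x₂ d₂ (out ② λ { (there ()) }))
      (single x₃ d₃ (trans (e₃ (there (there here))) (cong₂ (λ a b → - a + - b) (out ① λ ()) (out ② λ { (there ()) }))))
    go ⁅12⁆  out e₁ e₂ e₃ = vec≡
      (wrap₁₂ x₁ x₂ x₃ d₁ d₂ (out ③ λ { (there (there ())) }) (e₁ here) (e₂ (there here)))
      (next₁₂ x₁ x₂ x₃ d₁ d₂ (e₁ here) (e₂ (there here)))
      (black x₃ d₃ (out ③ λ { (there (there ())) }))
    go ⁅13⁆  out e₁ e₂ e₃ = vec≡
      (wrap₁₃ x₁ x₂ x₃ d₁ d₃ (e₁ here) (e₃ (there (there here))))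
      (black x₂ d₂ (out ② λ { (there ()) }))
      (next₁₃ x₁ x₂ x₃ d₁ d₃ (out ② λ { (there ()) }) (e₁ here) (e₃ (there (there here))))
    go ⁅23⁆  out e₁ e₂ e₃ = vec≡
      (black x₁ d₁ (out ① λ ()))
      (wrap₂₃ x₁ x₂ x₃ d₂ d₃ (out ① λ ()) (e₂ (there here)) (e₃ (there (there here))))
      (next₂₃ x₁ x₂ x₃ d₂ d₃ (e₂ (there here)) (e₃ (there (there here))))
    go ⁅123⁆ out e₁ e₂ e₃ = vec≡
      (wrap₁₃ x₁ x₂ x₃ d₁ d₃ (e₁ here) (e₃ (there (there here))))
      (next₁₂ x₁ x₂ x₃ d₁ d₂ (e₁ here) (e₂ (there here)))
      (next₂₃ x₁ x₂ x₃ d₂ d₃ (e₂ (there here)) (e₃ (there (there here))))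

-- Converse to `column-turn`, doubled: with w′ the turned w, the solution of (1 - A)x = 2w is x = w
-- - w′, so Ax = x - 2w = - w - w′ on S.
columnSum-turn : ∀ S w i → i ∈ S → columnSum (λ k → lookup w k - lookup (turn -_ S w) k) i ≡ - lookup w i - lookup (turn -_ S w) i
columnSum-turn S w i i∈S = trans (closed-form i) (go S w i i∈S)
  where
  x : Fin 3 → ℤ
  x k = lookup w k - lookup (turn -_ S w) k
  closed : (Fin 3 → ℤ) → Fin 3 → ℤ
  closed x ① = x ② + x ③
  closed x ② = - x ① + x ③
  closed x ③ = - x ① + - x ②
  closed-form : ∀ i → columnSum x i ≡ closed x i
  closed-form ① = columnSum-① x
  closed-form ② = columnSum-② x
  closed-form ③ = columnSum-③ x
  go : ∀ S w i → i ∈ S → closed (λ k → lookup w k - lookup (turn -_ S w) k) i ≡ - lookup w i - lookup (turn -_ S w) i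
  go ⁅1⁆ (a ∷ b ∷ c ∷ []) ① _ = lemma a b c
    where
    lemma : ∀ a b c → (b - b) + (c - c) ≡ - a - - a
    lemma = solve-∀
  go ⁅2⁆ (a ∷ b ∷ c ∷ []) ② _ = lemma a b c
    where
    lemma : ∀ a b c → - (a - a) + (c - c) ≡ - b - - b
    lemma = solve-∀
  go ⁅3⁆ (a ∷ b ∷ c ∷ []) ③ _ = lemma a b c
    where
    lemma : ∀ a b c → - (a - a) + - (b - b) ≡ - c - - c
    lemma = solve-∀
  go ⁅12⁆ (a ∷ b ∷ c ∷ []) ① _ = lemma a b c
    where
    lemma : ∀ a b c → (b - a) + (c - c) ≡ - a - - b
    lemma = solve-∀
  go ⁅12⁆ (a ∷ b ∷ c ∷ []) ② _ = lemma a b c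
    where
    lemma : ∀ a b c → - (a - - b) + (c - c) ≡ - b - a
    lemma = solve-∀
  go ⁅13⁆ (a ∷ b ∷ c ∷ []) ① _ = lemma a b c
    where
    lemma : ∀ a b c → (b - b) + (c - a) ≡ - a - - c
    lemma = solve-∀
  go ⁅13⁆ (a ∷ b ∷ c ∷ []) ③ _ = lemma a b c
    where
    lemma : ∀ a b c → - (a - - c) + - (b - b) ≡ - c - a
    lemma = solve-∀
  go ⁅23⁆ (a ∷ b ∷ c ∷ []) ② _ = lemma a b c
    where
    lemma : ∀ a b c → - (a - a) + (c - b) ≡ - b - - c
    lemma = solve-∀
  go ⁅23⁆ (a ∷ b ∷ c ∷ []) ③ _ = lemma a b c
    where
    lemma : ∀ a b c → - (a - a) + - (b - - c) ≡ - c - b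
    lemma = solve-∀
  go ⁅123⁆ (a ∷ b ∷ c ∷ []) ① _ = lemma a b c
    where
    lemma : ∀ a b c → (b - a) + (c - b) ≡ - a - - c
    lemma = solve-∀
  go ⁅123⁆ (a ∷ b ∷ c ∷ []) ② _ = lemma a b c
    where
    lemma : ∀ a b c → - (a - - c) + (c - b) ≡ - b - a
    lemma = solve-∀
  go ⁅123⁆ (a ∷ b ∷ c ∷ []) ③ _ = lemma a b c
    where
    lemma : ∀ a b c → - (a - - c) + - (b - a) ≡ - c - b
    lemma = solve-∀
  go ∅     _ ①  ()
  go ∅     _ ②  (there ())
  go ∅     _ ③  (there (there ()))
  go ⁅1⁆   _ ②  (there ())
  go ⁅1⁆   _ ③  (there (there ()))
  go ⁅2⁆   _ ①  ()
  go ⁅2⁆   _ ③  (there (there ()))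
  go ⁅3⁆   _ ①  ()
  go ⁅3⁆   _ ②  (there ())
  go ⁅12⁆  _ ③  (there (there ()))
  go ⁅13⁆  _ ②  (there ())
  go ⁅23⁆  _ ①  ()

turn-black : ∀ S w i → i ∉ S → lookup (turn -_ S w) i ≡ lookup w i
turn-black ∅     (_ ∷ _ ∷ _ ∷ []) i _   = refl
turn-black ⁅1⁆   (_ ∷ _ ∷ _ ∷ []) ① i∉ = contradiction here i∉
turn-black ⁅1⁆   (_ ∷ _ ∷ _ ∷ []) ② _  = refl
turn-black ⁅1⁆   (_ ∷ _ ∷ _ ∷ []) ③ _  = refl
turn-black ⁅2⁆   (_ ∷ _ ∷ _ ∷ []) ① _  = refl
turn-black ⁅2⁆   (_ ∷ _ ∷ _ ∷ []) ② i∉ = contradiction (there here) i∉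
turn-black ⁅2⁆   (_ ∷ _ ∷ _ ∷ []) ③ _  = refl
turn-black ⁅3⁆   (_ ∷ _ ∷ _ ∷ []) ① _  = refl
turn-black ⁅3⁆   (_ ∷ _ ∷ _ ∷ []) ② _  = refl
turn-black ⁅3⁆   (_ ∷ _ ∷ _ ∷ []) ③ i∉ = contradiction (there (there here)) i∉
turn-black ⁅12⁆  (_ ∷ _ ∷ _ ∷ []) ① i∉ = contradiction here i∉
turn-black ⁅12⁆  (_ ∷ _ ∷ _ ∷ []) ② i∉ = contradiction (there here) i∉
turn-black ⁅12⁆  (_ ∷ _ ∷ _ ∷ []) ③ _  = refl
turn-black ⁅13⁆  (_ ∷ _ ∷ _ ∷ []) ① i∉ = contradiction here i∉
turn-black ⁅13⁆  (_ ∷ _ ∷ _ ∷ []) ② _  = refl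
turn-black ⁅13⁆  (_ ∷ _ ∷ _ ∷ []) ③ i∉ = contradiction (there (there here)) i∉
turn-black ⁅23⁆  (_ ∷ _ ∷ _ ∷ []) ① _  = refl
turn-black ⁅23⁆  (_ ∷ _ ∷ _ ∷ []) ② i∉ = contradiction (there here) i∉
turn-black ⁅23⁆  (_ ∷ _ ∷ _ ∷ []) ③ i∉ = contradiction (there (there here)) i∉
turn-black ⁅123⁆ (_ ∷ _ ∷ _ ∷ []) ① i∉ = contradiction here i∉
turn-black ⁅123⁆ (_ ∷ _ ∷ _ ∷ []) ② i∉ = contradiction (there here) i∉
turn-black ⁅123⁆ (_ ∷ _ ∷ _ ∷ []) ③ i∉ = contradiction (there (there here)) i∉

turn-0ⱽ : ∀ S → turn -_ S 0ⱽ ≡ 0ⱽ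
turn-0ⱽ ∅     = refl
turn-0ⱽ ⁅1⁆   = refl
turn-0ⱽ ⁅2⁆   = refl
turn-0ⱽ ⁅3⁆   = refl
turn-0ⱽ ⁅12⁆  = refl
turn-0ⱽ ⁅13⁆  = refl
turn-0ⱽ ⁅23⁆  = refl
turn-0ⱽ ⁅123⁆ = refl

-- Crossing the whole diagram

column-step : ∀ S {D} v X → Supported (S ∷ D) X → Solves (S ∷ D) v X →
  turn -_ S (vec λ i → rowSum X i - v i) ≡ vec λ i → rowSum (later X) i - (v i + X (i , zero))
column-step S v X supported solves = begin
  turn -_ S (vec λ i → rowSum X i - v i)                                     ≡⟨ cong (turn -_ S) (Vec.tabulate-cong λ i → before (X (i , zero)) (rowSum (later X) i) (v i)) ⟩
  turn -_ S (vec λ i → X (i , zero) - (v i - rowSum (later X) i))            ≡⟨ column-turn S (λ i → X (i , zero)) (λ i → v i - rowSum (later X) i)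
                                                                                  (supported-first X supported) (solves-first v X solves) ⟩
  vec (λ i → - (v i - rowSum (later X) i) - X (i , zero))                    ≡⟨ (Vec.tabulate-cong λ i → after (X (i , zero)) (rowSum (later X) i) (v i)) ⟩
  vec (λ i → rowSum (later X) i - (v i + X (i , zero)))                      ∎
  where
  open ≡-Reasoning
  before : ∀ x t v → (x + t) - v ≡ x - (v - t)
  before = solve-∀
  after : ∀ x t v → - (v - t) - x ≡ t - (v + x)
  after = solve-∀

turns-rowSum : ∀ D v X → Supported D X → Solves D v X →
  turnsℤ D (vec λ i → rowSum X i - v i) ≡ vec λ i → - v i - rowSum X i
turns-rowSum []      v X supported solves = Vec.tabulate-cong λ i → lemma (v i)
  where
  lemma : ∀ v → 0ℤ - v ≡ - v - 0ℤ
  lemma = solve-∀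
turns-rowSum (S ∷ D) v X supported solves = begin
  turnsℤ D (turn -_ S (vec λ i → rowSum X i - v i))                          ≡⟨ cong (turnsℤ D) (column-step S v X supported solves) ⟩
  turnsℤ D (vec λ i → rowSum (later X) i - (v i + X (i , zero)))             ≡⟨ turns-rowSum D (λ i → v i + X (i , zero)) (later X)
                                                                                  (supported-later X supported) (solves-later v X solves) ⟩
  vec (λ i → - (v i + X (i , zero)) - rowSum (later X) i)                    ≡⟨ (Vec.tabulate-cong λ i → lemma (X (i , zero)) (rowSum (later X) i) (v i)) ⟩
  vec (λ i → - v i - rowSum X i)                                             ∎
  where
  open ≡-Reasoning
  lemma : ∀ x t v → - (v + x) - t ≡ - v - (x + t)
  lemma = solve-∀

lookup-0ⱽ : ∀ (t : Fin 3 → ℤ) → vec t ≡ 0ⱽ → ∀ i → t i ≡ 0ℤ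
lookup-0ⱽ t eq i = trans (sym (Vec.lookup∘tabulate t i)) (trans (cong (λ u → lookup u i) eq) (Vec.lookup-replicate i 0ℤ))

-- If u is zero at one cut, it is zero after the next column too; as the two differ by 2x, the
-- column of x is zero. The identity `lemma` yields x = - x, which avoids halving.
solution-unique : ∀ D v X → Supported D X → Solves D v X → vec (λ i → rowSum X i - v i) ≡ 0ⱽ → ∀ q → X q ≡ 0ℤ
solution-unique (S ∷ D) v X supported solves u≡0 = zero-everywhere
  where
  u′≡0 : vec (λ i → rowSum (later X) i - (v i + X (i , zero))) ≡ 0ⱽ
  u′≡0 = trans (sym (column-step S v X supported solves)) (trans (cong (turn -_ S) u≡0) (turn-0ⱽ S))
  lemma : ∀ x t v → x ≡ ((x + t) - v) - (t - (v + x)) - x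
  lemma = solve-∀
  zero-everywhere : ∀ q → X q ≡ 0ℤ
  zero-everywhere (i , zero)  = ≡neg⇒≡0 x (begin
    x                                           ≡⟨ lemma x t (v i) ⟩
    ((x + t) - v i) - (t - (v i + x)) - x       ≡⟨ cong₂ (λ a b → a - b - x) (lookup-0ⱽ (λ i → rowSum X i - v i) u≡0 i)
                                                     (lookup-0ⱽ (λ i → rowSum (later X) i - (v i + X (i , zero))) u′≡0 i) ⟩
    0ℤ - 0ℤ - x                                 ≡⟨ ℤ.+-identityˡ (- x) ⟩
    - x                                         ∎)
    where
    open ≡-Reasoning
    x = X (i , zero)
    t = rowSum (later X) i
  zero-everywhere (i , suc j) = solution-unique D (λ i → v i + X (i , zero)) (later X)
    (supported-later X supported) (solves-later v X solves) u′≡0 (i , j)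

-- The x whose vector u is 2w at the left end, so that half of each change of u is integral.
solution : ∀ (D : 𝒟₃) → Vec ℤ 3 → Square (length D) → ℤ
solution (S ∷ D) w (i , zero)  = lookup w i - lookup (turn -_ S w) i
solution (S ∷ D) w (i , suc j) = solution D (turn -_ S w) (i , j)

solution-supported : ∀ D w → Supported D (solution D w)
solution-supported (S ∷ D) w i zero    i∉ = trans (cong (λ x → lookup w i - x) (turn-black S w i i∉)) (ℤ.+-inverseʳ (lookup w i))
solution-supported (S ∷ D) w i (suc j) i∉ = solution-supported D (turn -_ S w) i j i∉

solution-rowSum : ∀ D w i → rowSum (solution D w) i ≡ lookup w i - lookup (turnsℤ D w) i
solution-rowSum []      w i = sym (ℤ.+-inverseʳ (lookup w i))
solution-rowSum (S ∷ D) w i = trans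
  (cong (lookup w i - lookup (turn -_ S w) i +_) (solution-rowSum D (turn -_ S w) i))
  (lemma (lookup w i) (lookup (turn -_ S w) i) (lookup (turnsℤ D (turn -_ S w)) i))
  where
  lemma : ∀ a b c → (a - b) + (b - c) ≡ a - c
  lemma = solve-∀

-- Stated for every w, as the induction turns w column by column. The right side vanishes exactly
-- when w is an eigenvector for -1 or zero.
solution-solves : ∀ D w → Solves D (λ i → - lookup w i - lookup (turnsℤ D w) i) (solution D w)
solution-solves (S ∷ D) w i zero    i∈ = begin
  ∑□ (λ q → entry (i , zero) q * X q)                               ≡⟨ ∑□-first X i ⟩
  columnSum (λ k → X (k , zero)) i + rowSum (later X) i             ≡⟨ cong₂ _+_ (columnSum-turn S w i i∈) (solution-rowSum D (turn -_ S w) i) ⟩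
  (- a - b) + (b - c)                                               ≡⟨ lemma a b c ⟩
  - a - c                                                           ∎
  where
  open ≡-Reasoning
  X = solution (S ∷ D) w
  a = lookup w i
  b = lookup (turn -_ S w) i
  c = lookup (turnsℤ (S ∷ D) w) i
  lemma : ∀ a b c → (- a - b) + (b - c) ≡ - a - c
  lemma = solve-∀
solution-solves (S ∷ D) w i (suc j) i∈ = begin
  ∑□ (λ q → entry (i , suc j) q * X q)                              ≡⟨ ∑□-later X i j ⟩
  - (a - b) + ∑□ (λ q → entry (i , j) q * later X q)                ≡⟨ cong (- (a - b) +_) (solution-solves D (turn -_ S w) i j i∈) ⟩
  - (a - b) + (- b - c)                                             ≡⟨ lemma a b c ⟩
  - a - c                                                           ∎
  where
  open ≡-Reasoning
  X = solution (S ∷ D) w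
  a = lookup w i
  b = lookup (turn -_ S w) i
  c = lookup (turnsℤ (S ∷ D) w) i
  lemma : ∀ a b c → - (a - b) + (- b - c) ≡ - a - c
  lemma = solve-∀

-- Primitivity and the eigenvalue -1

regular⇒primitive : ∀ D → Regular D → Primitive D
regular⇒primitive D regular detM≡0 =
  let (X , supported , solves , q , Xq≢0) = kernel⇒solution D (det≡0⇒kernel (M D) detM≡0)
  in Xq≢0 (solution-unique D (λ _ → 0ℤ) X supported solves
       (regular (vec λ i → rowSum X i - 0ℤ) (trans (turns-rowSum D (λ _ → 0ℤ) X supported solves)
         (Vec.tabulate-cong {n = 3} λ i → lemma (rowSum X i)))) q)
  where
  lemma : ∀ t → - 0ℤ - t ≡ - (t - 0ℤ)
  lemma = solve-∀

eigenvector⇒det≡0 : ∀ D w → turnsℤ D w ≡ -ⱽ w → w ≢ 0ⱽ → det (M D) ≡ 0ℤ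
eigenvector⇒det≡0 D w Dw≡-w w≢0 =
  [ kernel⇒det≡0 (M D) , (λ X≡0 → contradiction (w≡0 w (wᵢ≡0 X≡0)) w≢0) ]′ (solution⇒kernel D (solution-supported D w) solves)
  where
  Dwᵢ≡-wᵢ : ∀ i → lookup (turnsℤ D w) i ≡ - lookup w i
  Dwᵢ≡-wᵢ i = trans (cong (λ u → lookup u i) Dw≡-w) (Vec.lookup-map i -_ w)
  solves : Solves D (λ _ → 0ℤ) (solution D w)
  solves i j i∈ = trans (solution-solves D w i j i∈)
    (trans (cong (λ u → - lookup w i - u) (Dwᵢ≡-wᵢ i)) (ℤ.+-inverseʳ (- lookup w i)))
  -- The row sums of the solution are w minus its image, which is - w. If the solution were zero,
  -- then w = - w.
  wᵢ≡0 : (∀ q → solution D w q ≡ 0ℤ) → ∀ i → lookup w i ≡ 0ℤ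
  wᵢ≡0 X≡0 i = ≡neg⇒≡0 (lookup w i) (trans
    (ℤ.i-j≡0⇒i≡j (lookup w i) (lookup (turnsℤ D w) i) (trans (sym (solution-rowSum D w i)) (sum-zero λ j → X≡0 (i , j))))
    (Dwᵢ≡-wᵢ i))
  w≡0 : ∀ w → (∀ i → lookup w i ≡ 0ℤ) → w ≡ 0ⱽ
  w≡0 (_ ∷ _ ∷ _ ∷ []) eq = vec≡ (eq ①) (eq ②) (eq ③)

g₁ g₂ g₃ : 𝔾.Carrier
g₁ = Perm.id , Sign.+
g₂ = cycle (① ∷ ② ∷ ③ ∷ []) , Sign.+
g₃ = cycle (① ∷ ② ∷ ③ ∷ ④ ∷ []) , Sign.+

Ψ-rep₁ : Ψ rep₁ 𝔾.≈ g₁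
Ψ-rep₁ = codeΨ-≈ rep₁ g₁ refl

Ψ-rep₂ : Ψ rep₂ 𝔾.≈ g₂
Ψ-rep₂ = codeΨ-≈ rep₂ g₂ refl

Ψ-rep₃ : Ψ rep₃ 𝔾.≈ g₃
Ψ-rep₃ = codeΨ-≈ rep₃ g₃ refl

proposition7p6 : Primitive ≐
    H ⊢ (ConjugacyClass (Perm.id , Sign.+)
    ∪ ConjugacyClass (cycle (① ∷ ② ∷ ③ ∷ []) , Sign.+)
    ∪ ConjugacyClass (cycle (① ∷ ② ∷ ③ ∷ ④ ∷ []) , Sign.+))
proposition7p6 = (λ {D} → primitive⇒class D) , (λ {D} → class⇒primitive D)
  where
  Classes : 𝔾.Carrier → Set
  Classes = ConjugacyClass g₁ ∪ ConjugacyClass g₂ ∪ ConjugacyClass g₃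
  primitive⇒class : ∀ D → Primitive D → Classes (Ψ D)
  primitive⇒class D D-primitive with classify D
  ... | inj₁ (w , Dw≡-w , w≢0)           = contradiction (eigenvector⇒det≡0 D w Dw≡-w w≢0) D-primitive
  ... | inj₂ (here conj)                 = inj₁ (Conjugate⇒class rep₁ g₁ Ψ-rep₁ D conj)
  ... | inj₂ (there (here conj))         = inj₂ (inj₁ (Conjugate⇒class rep₂ g₂ Ψ-rep₂ D conj))
  ... | inj₂ (there (there (here conj))) = inj₂ (inj₂ (Conjugate⇒class rep₃ g₃ Ψ-rep₃ D conj))
  class⇒primitive : ∀ D → Classes (Ψ D) → Primitive D
  class⇒primitive D (inj₁ class)        = regular⇒primitive D
    (Conjugate-regular rep₁ D (class⇒Conjugate rep₁ g₁ Ψ-rep₁ D class) rep₁-regular)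
  class⇒primitive D (inj₂ (inj₁ class)) = regular⇒primitive D
    (Conjugate-regular rep₂ D (class⇒Conjugate rep₂ g₂ Ψ-rep₂ D class) rep₂-regular)
  class⇒primitive D (inj₂ (inj₂ class)) = regular⇒primitive D
    (Conjugate-regular rep₃ D (class⇒Conjugate rep₃ g₃ Ψ-rep₃ D class) rep₃-regular)
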